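{- For every prime power $q$ and every positive integer $n$, $$\prod_{\substack{p \in \mathcal{I}_q \\ \deg p \le n}} \left(1 - \frac{1}{\|p\|}\right) \le \frac{1}{e^{\gamma} n}.$$
   Context: $\mathcal{I}_q$ is the set of monic irreducible polynomials in $\mathbb{F}_q[x]$, $\|p\| = q^{\deg p}$, and $\gamma$ is the Euler–Mascheroni constant. -}

module Defs where

open import Level using (_⊔_) renaming (suc to lsuc)
open import Algebra.Bundles using (CommutativeRing; RawSemiring)
open import Algebra.Apartness.Bundles using (HeytingField; HeytingCommutativeRing)
import Algebra.Definitions.RawSemiring as RawSemiringDefinitions
open import Algebra.Definitions.RawMagma using (_,_)
open import Relation.Binary.Definitions using (tri<; tri≈; tri>)
import Data.Nat.Properties as ℕ
open import Data.Nat.Primality using (Prime)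
open import Data.Fin.Base as Fin using (Fin)
import Data.Fin.Properties as Fin
open import Data.List.Base as List using (List; []; _∷_; _++_)
open import Data.Vec.Base as Vec using (Vec; []; _∷_)
open import Data.Product.Base using (∃; ∃₂; _×_; _,_; proj₁; proj₂)
open import Data.Sum.Base using (_⊎_; inj₁; inj₂)
open import Data.Empty using (⊥-elim)
open import Function.Bundles using (Inverse)
open import Function.Base using (_∘_)
open import Relation.Binary.PropositionalEquality as ≡ using (_≡_)
open import Relation.Nullary using (¬_; Dec; yes; no)
open import Relation.Nullary.Decidable using (map′; _×-dec_)
import Relation.Binary.Reasoning.Setoid as SetoidReasoning
open import Data.Nat.Base as ℕ using (ℕ; zero; suc; z≤n; s≤s; _!)
open import Data.Integer.Base as ℤ using (ℤ; +_; +≤+; 1ℤ)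
import Data.Integer.Properties as ℤ
open import Data.Rational.Base as ℚ using (ℚ; 0ℚ; 1ℚ; ½; mkℚ; _/_)
import Data.Rational.Properties as ℚ
import Data.Rational.Unnormalised.Base as ℚᵘ
import Data.Rational.Unnormalised.Properties as ℚᵘ
open import Data.Rational.Solver using (module +-*-Solver)

module Rationals where
  open import Data.Rational.Base using (_+_; _*_; _-_; -_; ∣_∣; _≤_; _<_; *≤*; *<*)
  open +-*-Solver using (solve; _:=_; _:+_; _:*_; _:-_; :-_; con)

  ι : ℕ → ℚ
  ι n = + n / 1

  -- 1/(n + 1)
  unit : ℕ → ℚ
  unit n = 1ℤ / suc n

  frac-≤ : ∀ a d b e → a ℕ.* suc e ℕ.≤ b ℕ.* suc d → (+ a / suc d) ≤ (+ b / suc e)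
  frac-≤ a d b e h = ℚ.toℚᵘ-cancel-≤ (ℚᵘ.≤-respˡ-≃ (ℚᵘ.≃-sym (ℚ.toℚᵘ-fromℚᵘ (ℚᵘ.mkℚᵘ (+ a) d)))
    (ℚᵘ.≤-respʳ-≃ (ℚᵘ.≃-sym (ℚ.toℚᵘ-fromℚᵘ (ℚᵘ.mkℚᵘ (+ b) e))) (ℚᵘ.*≤*
      (≡.subst₂ ℤ._≤_ (ℤ.pos-* a (suc e)) (ℤ.pos-* b (suc d)) (+≤+ h)))))

  frac-≡ : ∀ a d b e → a ℕ.* suc e ≡ b ℕ.* suc d → (+ a / suc d) ≡ (+ b / suc e)
  frac-≡ a d b e h = ℚ.≤-antisym (frac-≤ a d b e (ℕ.≤-reflexive h))
                                  (frac-≤ b e a d (ℕ.≤-reflexive (≡.sym h)))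

  frac-* : ∀ a d b e → (+ a / suc d) * (+ b / suc e) ≡ (+ (a ℕ.* b) / suc (e ℕ.+ d ℕ.* suc e))
  frac-* a d b e = ℚ.toℚᵘ-injective (begin
    ℚ.toℚᵘ ((+ a / suc d) * (+ b / suc e))        ≈⟨ ℚ.toℚᵘ-homo-* (+ a / suc d) (+ b / suc e) ⟩
    ℚ.toℚᵘ (+ a / suc d) ℚᵘ.* ℚ.toℚᵘ (+ b / suc e) ≈⟨ ℚᵘ.*-cong (ℚ.toℚᵘ-fromℚᵘ (ℚᵘ.mkℚᵘ (+ a) d))
                                                              (ℚ.toℚᵘ-fromℚᵘ (ℚᵘ.mkℚᵘ (+ b) e)) ⟩
    ℚᵘ.mkℚᵘ (+ a) d ℚᵘ.* ℚᵘ.mkℚᵘ (+ b) e           ≡⟨ ≡.cong (λ z → ℚᵘ.mkℚᵘ z _) (≡.sym (ℤ.pos-* a b)) ⟩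
    ℚᵘ.mkℚᵘ (+ (a ℕ.* b)) (e ℕ.+ d ℕ.* suc e)      ≈⟨ ℚ.toℚᵘ-fromℚᵘ _ ⟨
    ℚ.toℚᵘ (+ (a ℕ.* b) / suc (e ℕ.+ d ℕ.* suc e)) ∎)
    where open ℚᵘ.≃-Reasoning

  ι-+ : ∀ m n → ι (m ℕ.+ n) ≡ ι m + ι n
  ι-+ m n = ℚ.toℚᵘ-injective (begin
    ℚ.toℚᵘ (ι (m ℕ.+ n))                     ≈⟨ ℚ.toℚᵘ-fromℚᵘ (ℚᵘ.mkℚᵘ (+ (m ℕ.+ n)) 0) ⟩
    ℚᵘ.mkℚᵘ (+ (m ℕ.+ n)) 0                  ≡⟨ ≡.cong₂ (λ x y → ℚᵘ.mkℚᵘ (x ℤ.+ y) 0) (ℤ.*-identityʳ (+ m)) (ℤ.*-identityʳ (+ n)) ⟨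
    ℚᵘ.mkℚᵘ (+ m) 0 ℚᵘ.+ ℚᵘ.mkℚᵘ (+ n) 0     ≈⟨ ℚᵘ.+-cong (ℚ.toℚᵘ-fromℚᵘ (ℚᵘ.mkℚᵘ (+ m) 0)) (ℚ.toℚᵘ-fromℚᵘ (ℚᵘ.mkℚᵘ (+ n) 0)) ⟨
    ℚ.toℚᵘ (ι m) ℚᵘ.+ ℚ.toℚᵘ (ι n)           ≈⟨ ℚ.toℚᵘ-homo-+ (ι m) (ι n) ⟨
    ℚ.toℚᵘ (ι m + ι n)                       ∎)
    where open ℚᵘ.≃-Reasoning

  ι-unit : ∀ n → ι (suc n) * unit n ≡ 1ℚ
  ι-unit n = ≡.trans (frac-* (suc n) 0 1 n)
    (frac-≡ (suc n ℕ.* 1) (n ℕ.+ 0) 1 0 (≡.cong (λ z → z) (ℕlem n)))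
    where
    ℕlem : ∀ n → suc n ℕ.* 1 ℕ.* 1 ≡ 1 ℕ.* suc (n ℕ.+ 0)
    ℕlem n = ≡.trans (ℕ.*-identityʳ _) (≡.trans (ℕ.*-identityʳ _)
      (≡.sym (≡.trans (ℕ.*-identityˡ _) (≡.cong suc (ℕ.+-identityʳ n)))))

  ι-≤ : ∀ {m n} → m ℕ.≤ n → ι m ≤ ι n
  ι-≤ {m} {n} h = frac-≤ m 0 n 0 (ℕ.*-monoˡ-≤ 1 h)

  0≤ι : ∀ n → 0ℚ ≤ ι n
  0≤ι n = ι-≤ {0} {n} z≤n

  unit-antitone : ∀ {m n} → m ℕ.≤ n → unit n ≤ unit m
  unit-antitone {m} {n} h = frac-≤ 1 n 1 m (ℕ.*-monoʳ-≤ 1 (s≤s h))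

  0<unit : ∀ n → 0ℚ < unit n
  0<unit n = ℚ.positive⁻¹ (unit n) {{ℚ.normalize-pos 1 (suc n)}}

  0≤unit : ∀ n → 0ℚ ≤ unit n
  0≤unit n = ℚ.<⇒≤ (0<unit n)

  archimedean : ∀ {ε} → 0ℚ < ε → ∃ λ n → unit n ≤ ε
  archimedean {mkℚ (+ zero) d c} h = ⊥-elim (ℚ.<-irrefl (≡.sym (ℚ.↥p≡0⇒p≡0 (mkℚ (+ zero) d c) ≡.refl)) h)
  archimedean {mkℚ (+ suc a) d c} h = d ,
    ≡.subst (unit d ≤_) (ℚ.fromℚᵘ-toℚᵘ (mkℚ (+ suc a) d c))
      (frac-≤ 1 d (suc a) d (ℕ.*-monoˡ-≤ (suc d) (s≤s {0} {a} z≤n)))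
  archimedean {mkℚ ℤ.-[1+ a ] d c} (*<* ())

  *-mono : ∀ {a b c d} → 0ℚ ≤ a → 0ℚ ≤ d → a ≤ b → c ≤ d → a * c ≤ b * d
  *-mono {a} {b} {c} {d} 0≤a 0≤d a≤b c≤d =
    ℚ.≤-trans (ℚ.*-monoˡ-≤-nonNeg a {{ℚ.nonNegative 0≤a}} c≤d)
              (ℚ.*-monoʳ-≤-nonNeg d {{ℚ.nonNegative 0≤d}} a≤b)

  0≤* : ∀ {a b} → 0ℚ ≤ a → 0ℚ ≤ b → 0ℚ ≤ a * b
  0≤* {a} {b} p r = ≡.subst (_≤ a * b) (ℚ.*-zeroʳ a) (ℚ.*-monoˡ-≤-nonNeg a {{ℚ.nonNegative p}} r)

  0<* : ∀ {a b} → 0ℚ < a → 0ℚ < b → 0ℚ < a * b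
  0<* {a} {b} p r = ≡.subst (_< a * b) (ℚ.*-zeroʳ a) (ℚ.*-monoʳ-<-pos a {{ℚ.positive p}} r)

  0<½* : ∀ {ε} → 0ℚ < ε → 0ℚ < ½ * ε
  0<½* = 0<* (0<unit 1)

  half+half : ∀ ε → ½ * ε + ½ * ε ≡ ε
  half+half = solve 1 (λ e → con ½ :* e :+ con ½ :* e := e) ≡.refl

  p≤p+r : ∀ p {r} → 0ℚ ≤ r → p ≤ p + r
  p≤p+r p {r} h = ≡.subst (_≤ p + r) (ℚ.+-identityʳ p) (ℚ.+-monoʳ-≤ p h)

  0≤∸ : ∀ {a b} → a ≤ b → 0ℚ ≤ b - a
  0≤∸ {a} {b} h = ≡.subst (_≤ b - a) (ℚ.+-inverseʳ a) (ℚ.+-monoˡ-≤ (- a) h)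

  0≤∸⁻¹ : ∀ {a b} → 0ℚ ≤ b - a → a ≤ b
  0≤∸⁻¹ {a} {b} h = ≡.subst₂ _≤_ (ℚ.+-identityˡ a)
    (solve 2 (λ a b → b :- a :+ a := b) ≡.refl a b) (ℚ.+-monoˡ-≤ a h)

  ∣-∣-comm : ∀ a b → ∣ a - b ∣ ≡ ∣ b - a ∣
  ∣-∣-comm a b = ≡.trans (≡.sym (ℚ.∣-p∣≡∣p∣ (a - b)))
    (≡.cong ∣_∣ (solve 2 (λ a b → :- (a :- b) := b :- a) ≡.refl a b))

  triangle : ∀ a b c → ∣ a - c ∣ ≤ ∣ a - b ∣ + ∣ b - c ∣
  triangle a b c = ≡.subst (λ z → ∣ z ∣ ≤ ∣ a - b ∣ + ∣ b - c ∣)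
    (solve 3 (λ a b c → (a :- b) :+ (b :- c) := a :- c) ≡.refl a b c)
    (ℚ.∣p+q∣≤∣p∣+∣q∣ (a - b) (b - c))

  p≤∣p∣ : ∀ p → p ≤ ∣ p ∣
  p≤∣p∣ p with ℚ.≤-total 0ℚ p
  ... | inj₁ h = ℚ.≤-reflexive (≡.sym (ℚ.0≤p⇒∣p∣≡p h))
  ... | inj₂ h = ℚ.≤-trans h (ℚ.0≤∣p∣ p)

  ∣∣≤ : ∀ {p e} → p ≤ e → - p ≤ e → ∣ p ∣ ≤ e
  ∣∣≤ {p} {e} h k with ℚ.∣p∣≡p∨∣p∣≡-p p
  ... | inj₁ eq = ≡.subst (_≤ e) (≡.sym eq) h
  ... | inj₂ eq = ≡.subst (_≤ e) (≡.sym eq) k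

  squeeze : ∀ {a b e} → a ≤ b → b ≤ a + e → ∣ b - a ∣ ≤ e
  squeeze {a} {b} {e} h k = ≡.subst (_≤ e) (≡.sym (ℚ.0≤p⇒∣p∣≡p (0≤∸ h)))
    (≡.subst (b - a ≤_) (solve 2 (λ a e → a :+ e :- a := e) ≡.refl a e) (ℚ.+-monoˡ-≤ (- a) k))

  ∣∣-lipschitz : ∀ a b → ∣ ∣ a ∣ - ∣ b ∣ ∣ ≤ ∣ a - b ∣
  ∣∣-lipschitz a b = ∣∣≤ (half a b) (≡.subst₂ _≤_
      (solve 2 (λ a b → b :- a := :- (a :- b)) ≡.refl (∣ a ∣) (∣ b ∣)) (∣-∣-comm b a) (half b a))
    where
    half : ∀ a b → ∣ a ∣ - ∣ b ∣ ≤ ∣ a - b ∣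
    half a b = ≡.subst (∣ a ∣ - ∣ b ∣ ≤_) (solve 2 (λ x y → x :+ y :- y := x) ≡.refl (∣ a - b ∣) (∣ b ∣))
      (ℚ.+-monoˡ-≤ (- ∣ b ∣) (≡.subst (λ z → ∣ z ∣ ≤ ∣ a - b ∣ + ∣ b ∣)
        (solve 2 (λ a b → a :- b :+ b := a) ≡.refl a b) (ℚ.∣p+q∣≤∣p∣+∣q∣ (a - b) b)))

  -- 1/p, with the convention 1/0 = 0.
  inverse : ℚ → ℚ
  inverse p with p ℚ.≟ 0ℚ
  ... | yes _  = 0ℚ
  ... | no p≢0 = (ℚ.1/ p) {{ℚ.≢-nonZero p≢0}}

  inverse-* : ∀ {p} → 0ℚ < p → inverse p * p ≡ 1ℚ
  inverse-* {p} 0<p with p ℚ.≟ 0ℚ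
  ... | yes p≡0 = ⊥-elim (ℚ.<-irrefl (≡.sym p≡0) 0<p)
  ... | no p≢0  = ℚ.*-inverseˡ p {{ℚ.≢-nonZero p≢0}}

  0≤inverse : ∀ {p} → 0ℚ < p → 0ℚ ≤ inverse p
  0≤inverse {p} 0<p with ℚ.≤-total 0ℚ (inverse p)
  ... | inj₁ h = h
  ... | inj₂ h = ⊥-elim (ℚ.<-irrefl ≡.refl (ℚ.<-≤-trans (0<unit 0) (≡.subst₂ _≤_ (inverse-* 0<p) (ℚ.*-zeroˡ p)
      (ℚ.*-monoʳ-≤-nonNeg p {{ℚ.nonNegative (ℚ.<⇒≤ 0<p)}} h))))

  inverse-≤ : ∀ {δ p} → 0ℚ < δ → δ ≤ p → inverse p ≤ inverse δ
  inverse-≤ {δ} {p} 0<δ δ≤p = ≡.subst₂ _≤_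
    (≡.trans (≡.cong (inverse p *_) (≡.trans (ℚ.*-comm δ (inverse δ)) (inverse-* 0<δ))) (ℚ.*-identityʳ _))
    (≡.trans (solve 3 (λ a b c → a :* (b :* c) := (a :* b) :* c) ≡.refl (inverse p) p (inverse δ))
      (≡.trans (≡.cong (_* inverse δ) (inverse-* 0<p)) (ℚ.*-identityˡ _)))
    (ℚ.*-monoˡ-≤-nonNeg (inverse p) {{ℚ.nonNegative (0≤inverse 0<p)}}
      (ℚ.*-monoʳ-≤-nonNeg (inverse δ) {{ℚ.nonNegative (0≤inverse 0<δ)}} δ≤p))
    where
    0<p : 0ℚ < p
    0<p = ℚ.<-≤-trans 0<δ δ≤p

  0<inverse : ∀ {p} → 0ℚ < p → 0ℚ < inverse p
  0<inverse {p} 0<p with ℚ.<-cmp 0ℚ (inverse p)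
  ... | tri< h _ _ = h
  ... | tri≈ _ e _ = ⊥-elim (ℚ.1≢0
      (≡.trans (≡.sym (inverse-* 0<p)) (≡.trans (≡.cong (_* p) (≡.sym e)) (ℚ.*-zeroˡ p))))
  ... | tri> _ _ h = ⊥-elim (ℚ.<-irrefl ≡.refl (ℚ.<-≤-trans h (0≤inverse 0<p)))

  -- Σ[ n ] f is the sum of f j over j < n.
  Σ[_] : ℕ → (ℕ → ℚ) → ℚ
  Σ[ zero  ] f = 0ℚ
  Σ[ suc n ] f = Σ[ n ] f + f n

  Σ-≤ : ∀ n {f g} → (∀ j → j ℕ.< n → f j ≤ g j) → Σ[ n ] f ≤ Σ[ n ] g
  Σ-≤ zero    h = ℚ.≤-refl
  Σ-≤ (suc n) h = ℚ.+-mono-≤ (Σ-≤ n λ j l → h j (ℕ.m≤n⇒m≤1+n l)) (h n ℕ.≤-refl)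

  Σ-≡ : ∀ n {f g} → (∀ j → f j ≡ g j) → Σ[ n ] f ≡ Σ[ n ] g
  Σ-≡ zero    h = ≡.refl
  Σ-≡ (suc n) h = ≡.cong₂ _+_ (Σ-≡ n h) (h n)

  Σ-const : ∀ n a → Σ[ n ] (λ _ → a) ≡ ι n * a
  Σ-const zero    a = ≡.sym (ℚ.*-zeroˡ a)
  Σ-const (suc n) a = ≡.trans (≡.cong (_+ a) (Σ-const n a))
    (≡.trans (solve 2 (λ m a → m :* a :+ a := (con 1ℚ :+ m) :* a) ≡.refl (ι n) a)
      (≡.cong (_* a) (≡.sym (ι-+ 1 n))))

  Σ-split : ∀ m n f → Σ[ m ℕ.+ n ] f ≡ Σ[ m ] f + Σ[ n ] (λ j → f (m ℕ.+ j))
  Σ-split m zero    f = ≡.trans (≡.cong (λ k → Σ[ k ] f) (ℕ.+-identityʳ m)) (≡.sym (ℚ.+-identityʳ _))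
  Σ-split m (suc n) f = ≡.trans (≡.cong (λ k → Σ[ k ] f) (ℕ.+-suc m n))
    (≡.trans (≡.cong (_+ f (m ℕ.+ n)) (Σ-split m n f)) (ℚ.+-assoc (Σ[ m ] f) _ _))

  Σ-blocks : ∀ l k f → Σ[ l ℕ.* k ] f ≡ Σ[ l ] (λ i → Σ[ k ] (λ j → f (i ℕ.* k ℕ.+ j)))
  Σ-blocks zero    k f = ≡.refl
  Σ-blocks (suc l) k f = ≡.trans (≡.cong (λ z → Σ[ z ] f) (ℕ.+-comm k (l ℕ.* k)))
    (≡.trans (Σ-split (l ℕ.* k) k f) (≡.cong (_+ Σ[ k ] (λ j → f (l ℕ.* k ℕ.+ j))) (Σ-blocks l k f)))

module Reals where
  open Rationals
  open +-*-Solver using (solve; _:=_; _:+_; _:*_; _:-_; :-_; con)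

  IsCauchySequence : (ℕ → ℚ) → Set
  IsCauchySequence x = ∀ {ε} → 0ℚ ℚ.< ε →
    ∃ λ N → ∀ {m n} → N ℕ.≤ m → N ℕ.≤ n → ℚ.∣ x m ℚ.- x n ∣ ℚ.≤ ε

  record ℝ : Set where
    constructor real
    field
      seq    : ℕ → ℚ
      cauchy : IsCauchySequence seq

  open ℝ public

  infix 4 _≤_
  _≤_ : ℝ → ℝ → Set
  x ≤ y = ∀ {ε} → 0ℚ ℚ.< ε → ∃ λ N → ∀ {n} → N ℕ.≤ n → seq x n ℚ.≤ seq y n ℚ.+ ε

  record Positive (x : ℝ) : Set where
    constructor bounded-below
    field
      {δ}   : ℚ
      0<δ   : 0ℚ ℚ.< δ
      index : ℕ
      bound : ∀ {n} → index ℕ.≤ n → δ ℚ.≤ seq x n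

  fromℚ : ℚ → ℝ
  fromℚ p = real (λ _ → p) λ {ε} 0<ε → 0 , λ _ _ →
    ≡.subst (λ z → ℚ.∣ z ∣ ℚ.≤ ε) (≡.sym (ℚ.+-inverseʳ p)) (ℚ.<⇒≤ 0<ε)

  fromℕ : ℕ → ℝ
  fromℕ n = fromℚ (+ n / 1)

  infixl 6 _+_ _-_
  _+_ : ℝ → ℝ → ℝ
  x + y = real (λ n → seq x n ℚ.+ seq y n) λ {ε} 0<ε →
    let N , p = cauchy x (0<½* 0<ε)
        M , r = cauchy y (0<½* 0<ε)
    in N ℕ.⊔ M , λ {m} {n} hm hn → begin
      ℚ.∣ (seq x m ℚ.+ seq y m) ℚ.- (seq x n ℚ.+ seq y n) ∣
        ≡⟨ ≡.cong ℚ.∣_∣ (solve 4 (λ a b c d → (a :+ b) :- (c :+ d) := (a :- c) :+ (b :- d)) ≡.refl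
             (seq x m) (seq y m) (seq x n) (seq y n)) ⟩
      ℚ.∣ (seq x m ℚ.- seq x n) ℚ.+ (seq y m ℚ.- seq y n) ∣
        ≤⟨ ℚ.∣p+q∣≤∣p∣+∣q∣ (seq x m ℚ.- seq x n) _ ⟩
      ℚ.∣ seq x m ℚ.- seq x n ∣ ℚ.+ ℚ.∣ seq y m ℚ.- seq y n ∣
        ≤⟨ ℚ.+-mono-≤ (p (ℕ.m⊔n≤o⇒m≤o N M hm) (ℕ.m⊔n≤o⇒m≤o N M hn))
                      (r (ℕ.m⊔n≤o⇒n≤o N M hm) (ℕ.m⊔n≤o⇒n≤o N M hn)) ⟩
      ½ ℚ.* ε ℚ.+ ½ ℚ.* ε  ≡⟨ half+half ε ⟩
      ε                    ∎
    where open ℚ.≤-Reasoning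

  _-_ : ℝ → ℝ → ℝ
  x - y = real (λ n → seq x n ℚ.- seq y n) λ {ε} 0<ε →
    let N , p = cauchy x (0<½* 0<ε)
        M , r = cauchy y (0<½* 0<ε)
    in N ℕ.⊔ M , λ {m} {n} hm hn → begin
      ℚ.∣ (seq x m ℚ.- seq y m) ℚ.- (seq x n ℚ.- seq y n) ∣
        ≡⟨ ≡.cong ℚ.∣_∣ (solve 4 (λ a b c d → (a :- b) :- (c :- d) := (a :- c) :+ (d :- b)) ≡.refl
             (seq x m) (seq y m) (seq x n) (seq y n)) ⟩
      ℚ.∣ (seq x m ℚ.- seq x n) ℚ.+ (seq y n ℚ.- seq y m) ∣
        ≤⟨ ℚ.∣p+q∣≤∣p∣+∣q∣ (seq x m ℚ.- seq x n) _ ⟩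
      ℚ.∣ seq x m ℚ.- seq x n ∣ ℚ.+ ℚ.∣ seq y n ℚ.- seq y m ∣
        ≤⟨ ℚ.+-mono-≤ (p (ℕ.m⊔n≤o⇒m≤o N M hm) (ℕ.m⊔n≤o⇒m≤o N M hn))
                      (r (ℕ.m⊔n≤o⇒n≤o N M hn) (ℕ.m⊔n≤o⇒n≤o N M hm)) ⟩
      ½ ℚ.* ε ℚ.+ ½ ℚ.* ε  ≡⟨ half+half ε ⟩
      ε                    ∎
    where open ℚ.≤-Reasoning

  ∣_∣ : ℝ → ℝ
  ∣ x ∣ = real (λ n → ℚ.∣ seq x n ∣) λ 0<ε →
    let N , p = cauchy x 0<ε
    in N , λ {m} {n} hm hn → ℚ.≤-trans (∣∣-lipschitz (seq x m) (seq x n)) (p hm hn)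

  upper : ∀ p → ∃ λ n → p ℚ.≤ ι n
  upper (mkℚ (+ a) d c) = a , ≡.subst (ℚ._≤ ι a) (ℚ.fromℚᵘ-toℚᵘ (mkℚ (+ a) d c))
    (frac-≤ a d a 0 (ℕ.*-monoʳ-≤ a (s≤s z≤n)))
  upper (mkℚ ℤ.-[1+ a ] d c) = 0 , ℚ.<⇒≤ (ℚ.negative⁻¹ (mkℚ ℤ.-[1+ a ] d c))

  eventually-bounded : ∀ x → ∃₂ λ b N → ∀ {n} → N ℕ.≤ n → ℚ.∣ seq x n ∣ ℚ.≤ ι b
  eventually-bounded x =
    let N , p = cauchy x (0<unit 0)
        b , r = upper (1ℚ ℚ.+ ℚ.∣ seq x N ∣)
    in b , N , λ {n} hn → begin
      ℚ.∣ seq x n ∣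
        ≡⟨ ≡.cong ℚ.∣_∣ (solve 2 (λ a c → a := a :- c :+ c) ≡.refl (seq x n) (seq x N)) ⟩
      ℚ.∣ seq x n ℚ.- seq x N ℚ.+ seq x N ∣                ≤⟨ ℚ.∣p+q∣≤∣p∣+∣q∣ (seq x n ℚ.- seq x N) _ ⟩
      ℚ.∣ seq x n ℚ.- seq x N ∣ ℚ.+ ℚ.∣ seq x N ∣          ≤⟨ ℚ.+-monoˡ-≤ ℚ.∣ seq x N ∣ (p hn ℕ.≤-refl) ⟩
      1ℚ ℚ.+ ℚ.∣ seq x N ∣                                  ≤⟨ r ⟩
      ι b                                                   ∎
    where open ℚ.≤-Reasoning

  ι*unit* : ∀ b z → ι (suc b) ℚ.* (unit b ℚ.* z) ≡ z
  ι*unit* b z = ≡.trans (≡.sym (ℚ.*-assoc (ι (suc b)) (unit b) z))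
    (≡.trans (≡.cong (ℚ._* z) (ι-unit b)) (ℚ.*-identityˡ z))

  infixl 7 _*_
  _*_ : ℝ → ℝ → ℝ
  x * y = real (λ n → seq x n ℚ.* seq y n) λ {ε} 0<ε →
    let b , N₁ , β = eventually-bounded x
        c , N₂ , κ = eventually-bounded y
        N₃ , p = cauchy x (0<* (0<unit c) (0<½* 0<ε))
        N₄ , r = cauchy y (0<* (0<unit b) (0<½* 0<ε))
        N = (N₁ ℕ.⊔ N₂) ℕ.⊔ (N₃ ℕ.⊔ N₄)
        h₁ : ∀ {n} → N ℕ.≤ n → N₁ ℕ.≤ n
        h₁ h = ℕ.m⊔n≤o⇒m≤o N₁ N₂ (ℕ.m⊔n≤o⇒m≤o (N₁ ℕ.⊔ N₂) (N₃ ℕ.⊔ N₄) h)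
        h₂ : ∀ {n} → N ℕ.≤ n → N₂ ℕ.≤ n
        h₂ h = ℕ.m⊔n≤o⇒n≤o N₁ N₂ (ℕ.m⊔n≤o⇒m≤o (N₁ ℕ.⊔ N₂) (N₃ ℕ.⊔ N₄) h)
        h₃ : ∀ {n} → N ℕ.≤ n → N₃ ℕ.≤ n
        h₃ h = ℕ.m⊔n≤o⇒m≤o N₃ N₄ (ℕ.m⊔n≤o⇒n≤o (N₁ ℕ.⊔ N₂) (N₃ ℕ.⊔ N₄) h)
        h₄ : ∀ {n} → N ℕ.≤ n → N₄ ℕ.≤ n
        h₄ h = ℕ.m⊔n≤o⇒n≤o N₃ N₄ (ℕ.m⊔n≤o⇒n≤o (N₁ ℕ.⊔ N₂) (N₃ ℕ.⊔ N₄) h)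
    in N , λ {m} {n} hm hn → begin
      ℚ.∣ seq x m ℚ.* seq y m ℚ.- seq x n ℚ.* seq y n ∣
        ≡⟨ ≡.cong ℚ.∣_∣ (solve 4 (λ a b c d → a :* b :- c :* d := a :* (b :- d) :+ d :* (a :- c)) ≡.refl
             (seq x m) (seq y m) (seq x n) (seq y n)) ⟩
      ℚ.∣ seq x m ℚ.* (seq y m ℚ.- seq y n) ℚ.+ seq y n ℚ.* (seq x m ℚ.- seq x n) ∣
        ≤⟨ ℚ.∣p+q∣≤∣p∣+∣q∣ (seq x m ℚ.* (seq y m ℚ.- seq y n)) _ ⟩
      ℚ.∣ seq x m ℚ.* (seq y m ℚ.- seq y n) ∣ ℚ.+ ℚ.∣ seq y n ℚ.* (seq x m ℚ.- seq x n) ∣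
        ≡⟨ ≡.cong₂ ℚ._+_ (ℚ.∣p*q∣≡∣p∣*∣q∣ (seq x m) _) (ℚ.∣p*q∣≡∣p∣*∣q∣ (seq y n) _) ⟩
      ℚ.∣ seq x m ∣ ℚ.* ℚ.∣ seq y m ℚ.- seq y n ∣ ℚ.+ ℚ.∣ seq y n ∣ ℚ.* ℚ.∣ seq x m ℚ.- seq x n ∣
        ≤⟨ ℚ.+-mono-≤
             (*-mono (ℚ.0≤∣p∣ (seq x m)) (0≤* (0≤unit b) (ℚ.<⇒≤ (0<½* 0<ε)))
               (ℚ.≤-trans (β (h₁ hm)) (ι-≤ {b} {suc b} (ℕ.n≤1+n b))) (r (h₄ hm) (h₄ hn)))
             (*-mono (ℚ.0≤∣p∣ (seq y n)) (0≤* (0≤unit c) (ℚ.<⇒≤ (0<½* 0<ε)))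
               (ℚ.≤-trans (κ (h₂ hn)) (ι-≤ {c} {suc c} (ℕ.n≤1+n c))) (p (h₃ hm) (h₃ hn))) ⟩
      ι (suc b) ℚ.* (unit b ℚ.* (½ ℚ.* ε)) ℚ.+ ι (suc c) ℚ.* (unit c ℚ.* (½ ℚ.* ε))
        ≡⟨ ≡.cong₂ ℚ._+_ (ι*unit* b (½ ℚ.* ε)) (ι*unit* c (½ ℚ.* ε)) ⟩
      ½ ℚ.* ε ℚ.+ ½ ℚ.* ε  ≡⟨ half+half ε ⟩
      ε                    ∎
    where open ℚ.≤-Reasoning

  infixr 8 _^_
  _^_ : ℝ → ℕ → ℝ
  x ^ zero  = fromℚ 1ℚ
  x ^ suc n = x * x ^ n

  -- ∑[ n ] f is the sum of f j over j < n.
  ∑[_] : ℕ → (ℕ → ℝ) → ℝ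
  ∑[ zero  ] f = fromℚ 0ℚ
  ∑[ suc n ] f = ∑[ n ] f + f n

  -- Entries of seq x that vanish, of which there are finitely many, are sent to 0.
  infix 9 _⁻¹
  _⁻¹ : (x : ℝ) → {{Positive x}} → ℝ
  (x ⁻¹) {{bounded-below {δ} 0<δ N₁ h}} = real (λ n → inverse (seq x n)) λ {ε} 0<ε →
    let N₂ , p = cauchy x (0<* 0<ε (0<* 0<δ 0<δ))
        D = inverse δ
        h₁ : ∀ {n} → N₁ ℕ.⊔ N₂ ℕ.≤ n → N₁ ℕ.≤ n
        h₁ = ℕ.m⊔n≤o⇒m≤o N₁ N₂
        pos : ∀ {n} → N₁ ℕ.⊔ N₂ ℕ.≤ n → 0ℚ ℚ.< seq x n
        pos hn = ℚ.<-≤-trans 0<δ (h (h₁ hn))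
    in N₁ ℕ.⊔ N₂ , λ {m} {n} hm hn →
      let a = seq x m ; b = seq x n ; A = inverse a ; B = inverse b in begin
      ℚ.∣ A ℚ.- B ∣
        ≡⟨ ≡.cong ℚ.∣_∣ (≡.cong₂ ℚ._-_
             (≡.trans (≡.sym (ℚ.*-identityʳ A)) (≡.cong (A ℚ.*_) (≡.sym (inverse-* (pos hn)))))
             (≡.trans (≡.sym (ℚ.*-identityʳ B)) (≡.cong (B ℚ.*_) (≡.sym (inverse-* (pos hm)))))) ⟩
      ℚ.∣ A ℚ.* (B ℚ.* b) ℚ.- B ℚ.* (A ℚ.* a) ∣
        ≡⟨ ≡.cong ℚ.∣_∣ (solve 4 (λ A B a b → A :* (B :* b) :- B :* (A :* a) := (A :* B) :* (b :- a)) ≡.refl A B a b) ⟩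
      ℚ.∣ (A ℚ.* B) ℚ.* (b ℚ.- a) ∣
        ≡⟨ ℚ.∣p*q∣≡∣p∣*∣q∣ (A ℚ.* B) (b ℚ.- a) ⟩
      ℚ.∣ A ℚ.* B ∣ ℚ.* ℚ.∣ b ℚ.- a ∣
        ≡⟨ ≡.cong (ℚ._* ℚ.∣ b ℚ.- a ∣) (ℚ.0≤p⇒∣p∣≡p (0≤* (0≤inverse (pos hm)) (0≤inverse (pos hn)))) ⟩
      (A ℚ.* B) ℚ.* ℚ.∣ b ℚ.- a ∣
        ≤⟨ *-mono (0≤* (0≤inverse (pos hm)) (0≤inverse (pos hn))) (ℚ.<⇒≤ (0<* 0<ε (0<* 0<δ 0<δ)))
             (*-mono (0≤inverse (pos hm)) (0≤inverse 0<δ) (inverse-≤ 0<δ (h (h₁ hm))) (inverse-≤ 0<δ (h (h₁ hn))))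
             (p (ℕ.m⊔n≤o⇒n≤o N₁ N₂ hn) (ℕ.m⊔n≤o⇒n≤o N₁ N₂ hm)) ⟩
      (D ℚ.* D) ℚ.* (ε ℚ.* (δ ℚ.* δ))
        ≡⟨ solve 3 (λ D d e → (D :* D) :* (e :* (d :* d)) := ((D :* d) :* (D :* d)) :* e) ≡.refl D δ ε ⟩
      ((D ℚ.* δ) ℚ.* (D ℚ.* δ)) ℚ.* ε
        ≡⟨ ≡.cong (λ z → (z ℚ.* z) ℚ.* ε) (inverse-* 0<δ) ⟩
      (1ℚ ℚ.* 1ℚ) ℚ.* ε
        ≡⟨ ℚ.*-identityˡ ε ⟩
      ε ∎
    where open ℚ.≤-Reasoning

  IsCauchy : (ℕ → ℝ) → Set
  IsCauchy X = ∀ {ε} → 0ℚ ℚ.< ε →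
    ∃ λ N → ∀ {m n} → N ℕ.≤ m → N ℕ.≤ n → ∣ X m - X n ∣ ≤ fromℚ ε

  -- The n-th approximation to the limit is an entry of X n that is within
  -- 1/(n + 1) of all later entries of X n.
  lim : (X : ℕ → ℝ) → IsCauchy X → ℝ
  lim X isCauchy = real y λ {ε} 0<ε →
    let η = ½ ℚ.* (½ ℚ.* ε)
        0<η = 0<½* (0<½* 0<ε)
        N₁ , p = isCauchy 0<η
        N₂ , r = archimedean 0<η
    in N₁ ℕ.⊔ N₂ , λ {m} {n} hm hn →
      let K , s = p (ℕ.m⊔n≤o⇒m≤o N₁ N₂ hm) (ℕ.m⊔n≤o⇒m≤o N₁ N₂ hn) 0<η
          k = (K ℕ.⊔ index m) ℕ.⊔ index n
          K≤k : K ℕ.≤ k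
          K≤k = ℕ.≤-trans (ℕ.m≤m⊔n K (index m)) (ℕ.m≤m⊔n (K ℕ.⊔ index m) (index n))
          m≤k : index m ℕ.≤ k
          m≤k = ℕ.≤-trans (ℕ.m≤n⊔m K (index m)) (ℕ.m≤m⊔n (K ℕ.⊔ index m) (index n))
          n≤k : index n ℕ.≤ k
          n≤k = ℕ.m≤n⊔m (K ℕ.⊔ index m) (index n)
      in begin
      ℚ.∣ y m ℚ.- y n ∣
        ≤⟨ triangle (y m) (seq (X m) k) (y n) ⟩
      ℚ.∣ y m ℚ.- seq (X m) k ∣ ℚ.+ ℚ.∣ seq (X m) k ℚ.- y n ∣
        ≤⟨ ℚ.+-mono-≤
             (ℚ.≤-trans (close m ℕ.≤-refl m≤k) (ℚ.≤-trans (unit-antitone (ℕ.m⊔n≤o⇒n≤o N₁ N₂ hm)) r))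
             (triangle (seq (X m) k) (seq (X n) k) (y n)) ⟩
      η ℚ.+ (ℚ.∣ seq (X m) k ℚ.- seq (X n) k ∣ ℚ.+ ℚ.∣ seq (X n) k ℚ.- y n ∣)
        ≤⟨ ℚ.+-monoʳ-≤ η (ℚ.+-mono-≤ (s K≤k)
             (ℚ.≤-trans (close n n≤k ℕ.≤-refl) (ℚ.≤-trans (unit-antitone (ℕ.m⊔n≤o⇒n≤o N₁ N₂ hn)) r))) ⟩
      η ℚ.+ ((η ℚ.+ η) ℚ.+ η)
        ≡⟨ solve 1 (λ e → let h = con ½ :* (con ½ :* e) in h :+ ((h :+ h) :+ h) := e) ≡.refl ε ⟩
      ε ∎
    where
    open ℚ.≤-Reasoning
    index : ℕ → ℕ
    index n = proj₁ (cauchy (X n) (0<unit n))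
    y : ℕ → ℚ
    y n = seq (X n) (index n)
    close : ∀ n {i j} → index n ℕ.≤ i → index n ℕ.≤ j → ℚ.∣ seq (X n) i ℚ.- seq (X n) j ∣ ℚ.≤ unit n
    close n = proj₂ (cauchy (X n) (0<unit n))

  inv! : ℕ → ℚ
  inv! k = (1ℤ / (k !)) {{k ℕ.!≢0}}

  expTerm : ℝ → ℕ → ℝ
  expTerm x k = x ^ k * fromℚ (inv! k)

  expSum : ℝ → ℕ → ℝ
  expSum x n = ∑[ n ] (expTerm x)

  -- The right-endpoint Riemann sum of ∫₁ⁿ dt/t with mesh 1/M, where M = m + 1:
  -- (1/M) Σ 1/(1 + (j + 1)/M) = Σ 1/(M + j + 1) over j < (n - 1) M.
  logSum : ℕ → ℕ → ℚ
  logSum n m = Σ[ (n ℕ.∸ 1) ℕ.* suc m ] λ j → 1ℤ / suc (suc m ℕ.+ j)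

  harmonic : ℕ → ℚ
  harmonic n = Σ[ n ] λ j → 1ℤ / suc j

  ι*unit : ∀ k b → ι (suc k) ℚ.* unit (k ℕ.+ b ℕ.* suc k) ≡ unit b
  ι*unit k b = ≡.trans (frac-* (suc k) 0 1 (k ℕ.+ b ℕ.* suc k))
    (frac-≡ (suc k ℕ.* 1) ((k ℕ.+ b ℕ.* suc k) ℕ.+ 0) 1 b (
      ≡.trans (≡.cong (ℕ._* suc b) (ℕ.*-identityʳ (suc k)))
      (≡.trans (ℕ.*-comm (suc k) (suc b))
      (≡.sym (≡.trans (ℕ.*-identityˡ _) (≡.cong suc (ℕ.+-identityʳ (k ℕ.+ b ℕ.* suc k))))))))

  -- With K = k + 1: the sum of 1/(aK + j + 1) over j < K, which lies between
  -- 1/(a + 1) and 1/a.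
  block : ℕ → ℕ → ℚ
  block k a = Σ[ suc k ] λ j → unit (a ℕ.* suc k ℕ.+ j)

  block-≤ : ∀ k b → block k (suc b) ℚ.≤ unit b
  block-≤ k b = ℚ.≤-trans
    (Σ-≤ (suc k) {g = λ _ → unit (k ℕ.+ b ℕ.* suc k)} λ j _ →
      unit-antitone (ℕ.≤-trans (ℕ.n≤1+n _) (ℕ.m≤m+n (suc b ℕ.* suc k) j)))
    (ℚ.≤-reflexive (≡.trans (Σ-const (suc k) _) (ι*unit k b)))

  block-≥ : ∀ k a → unit a ℚ.≤ block k a
  block-≥ k a = ℚ.≤-trans
    (ℚ.≤-reflexive (≡.sym (≡.trans (Σ-const (suc k) _) (ι*unit k a))))
    (Σ-≤ (suc k) {f = λ _ → unit (k ℕ.+ a ℕ.* suc k)} λ { j (s≤s j≤k) →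
      unit-antitone (ℕ.≤-trans (ℕ.+-monoʳ-≤ (a ℕ.* suc k) j≤k) (ℕ.≤-reflexive (ℕ.+-comm (a ℕ.* suc k) k))) })

  telescope : ∀ m l → Σ[ l ] (λ i → unit (m ℕ.+ i)) ℚ.+ unit (m ℕ.+ l) ≡ unit m ℚ.+ Σ[ l ] (λ i → unit (suc m ℕ.+ i))
  telescope m zero    = ≡.trans (ℚ.+-identityˡ _) (≡.trans (≡.cong unit (ℕ.+-identityʳ m)) (≡.sym (ℚ.+-identityʳ _)))
  telescope m (suc l) = ≡.trans (≡.cong₂ ℚ._+_ (telescope m l) (≡.cong unit (ℕ.+-suc m l)))
    (ℚ.+-assoc (unit m) _ _)

  refine : ∀ n m k → logSum n (k ℕ.+ m ℕ.* suc k) ≡ Σ[ (n ℕ.∸ 1) ℕ.* suc m ] λ i → block k (suc m ℕ.+ i)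
  refine n m k =
    ≡.trans (≡.cong (λ z → Σ[ z ] f) (≡.sym (ℕ.*-assoc (n ℕ.∸ 1) (suc m) (suc k))))
    (≡.trans (Σ-blocks ((n ℕ.∸ 1) ℕ.* suc m) (suc k) f)
    (Σ-≡ ((n ℕ.∸ 1) ℕ.* suc m) λ i → Σ-≡ (suc k) λ j → ≡.cong unit
      (≡.trans (≡.sym (ℕ.+-assoc (suc m ℕ.* suc k) (i ℕ.* suc k) j))
               (≡.cong (ℕ._+ j) (≡.sym (ℕ.*-distribʳ-+ (suc k) (suc m) i))))))
    where
    f : ℕ → ℚ
    f j = unit (suc m ℕ.* suc k ℕ.+ j)

  refine-≥ : ∀ n m k → logSum n m ℚ.≤ logSum n (k ℕ.+ m ℕ.* suc k)
  refine-≥ n m k = ≡.subst (logSum n m ℚ.≤_) (≡.sym (refine n m k))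
    (Σ-≤ ((n ℕ.∸ 1) ℕ.* suc m) λ i _ → block-≥ k (suc m ℕ.+ i))

  refine-≤ : ∀ n m k → logSum n (k ℕ.+ m ℕ.* suc k) ℚ.≤ logSum n m ℚ.+ unit m
  refine-≤ n m k = begin
    logSum n (k ℕ.+ m ℕ.* suc k)                       ≡⟨ refine n m k ⟩
    Σ[ l ] (λ i → block k (suc m ℕ.+ i))               ≤⟨ Σ-≤ l (λ i _ → block-≤ k (m ℕ.+ i)) ⟩
    Σ[ l ] (λ i → unit (m ℕ.+ i))                      ≤⟨ p≤p+r (Σ[ l ] (λ i → unit (m ℕ.+ i))) (0≤unit (m ℕ.+ l)) ⟩
    Σ[ l ] (λ i → unit (m ℕ.+ i)) ℚ.+ unit (m ℕ.+ l)   ≡⟨ telescope m l ⟩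
    unit m ℚ.+ logSum n m                              ≡⟨ ℚ.+-comm (unit m) _ ⟩
    logSum n m ℚ.+ unit m                              ∎
    where
    open ℚ.≤-Reasoning
    l = (n ℕ.∸ 1) ℕ.* suc m

  logSum-cauchy : ∀ n → IsCauchySequence (logSum n)
  logSum-cauchy n {ε} 0<ε =
    let N , r = archimedean (0<½* 0<ε)
    in N , λ {i} {j} hi hj →
      let c = j ℕ.+ i ℕ.* suc j
          c′ = i ℕ.+ j ℕ.* suc i
          c≡c′ : c ≡ c′
          c≡c′ = ℕ.suc-injective (ℕ.*-comm (suc i) (suc j))
      in begin
      ℚ.∣ logSum n i ℚ.- logSum n j ∣
        ≤⟨ triangle (logSum n i) (logSum n c) (logSum n j) ⟩
      ℚ.∣ logSum n i ℚ.- logSum n c ∣ ℚ.+ ℚ.∣ logSum n c ℚ.- logSum n j ∣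
        ≤⟨ ℚ.+-mono-≤
             (≡.subst (ℚ._≤ unit i) (∣-∣-comm (logSum n c) (logSum n i)) (squeeze (refine-≥ n i j) (refine-≤ n i j)))
             (≡.subst (λ z → ℚ.∣ logSum n z ℚ.- logSum n j ∣ ℚ.≤ unit j) (≡.sym c≡c′)
               (squeeze (refine-≥ n j i) (refine-≤ n j i))) ⟩
      unit i ℚ.+ unit j
        ≤⟨ ℚ.+-mono-≤ (ℚ.≤-trans (unit-antitone hi) r) (ℚ.≤-trans (unit-antitone hj) r) ⟩
      ½ ℚ.* ε ℚ.+ ½ ℚ.* ε  ≡⟨ half+half ε ⟩
      ε                    ∎
    where open ℚ.≤-Reasoning

  -- The natural logarithm of n ≥ 1, as ∫₁ⁿ dt/t (log 0 has the junk value 0).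
  log : ℕ → ℝ
  log n = real (logSum n) (logSum-cauchy n)

  -- The Euler–Mascheroni constant is the limit of H_N - log N, here with N = n + 1.
  gammaTerm : ℕ → ℝ
  gammaTerm n = fromℚ (harmonic (suc n)) - log (suc n)

  gammaTerm-suc : ∀ s m → seq (gammaTerm (suc s)) m ≡
    seq (gammaTerm s) m ℚ.+ (unit (suc s) ℚ.- block m (suc s))
  gammaTerm-suc s m = ≡.trans
    (≡.cong (λ z → harmonic (suc (suc s)) ℚ.- z) (≡.trans (logSum-blocks (suc s)) (≡.cong (ℚ._+ block m (suc s)) (≡.sym (logSum-blocks s)))))
    (solve 4 (λ h u r b → (h :+ u) :- (r :+ b) := (h :- r) :+ (u :- b)) ≡.refl
      (harmonic (suc s)) (unit (suc s)) (logSum (suc s) m) (block m (suc s)))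
    where
    logSum-blocks : ∀ s → logSum (suc s) m ≡ Σ[ s ] λ i → block m (suc i)
    logSum-blocks s = ≡.trans (Σ-blocks s (suc m) (λ j → unit (suc m ℕ.+ j)))
      (Σ-≡ s λ i → Σ-≡ (suc m) λ j → ≡.cong unit (≡.sym (ℕ.+-assoc (suc m) (i ℕ.* suc m) j)))

  gammaTerm-decreasing : ∀ N d m → seq (gammaTerm (N ℕ.+ d)) m ℚ.≤ seq (gammaTerm N) m
  gammaTerm-decreasing N zero    m = ℚ.≤-reflexive (≡.cong (λ z → seq (gammaTerm z) m) (ℕ.+-identityʳ N))
  gammaTerm-decreasing N (suc d) m = begin
    seq (gammaTerm (N ℕ.+ suc d)) m    ≡⟨ ≡.cong (λ z → seq (gammaTerm z) m) (ℕ.+-suc N d) ⟩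
    seq (gammaTerm (suc (N ℕ.+ d))) m  ≡⟨ gammaTerm-suc (N ℕ.+ d) m ⟩
    g ℚ.+ (u ℚ.- b)                    ≤⟨ ℚ.+-monoʳ-≤ g (ℚ.+-monoˡ-≤ (ℚ.- b) (block-≥ m (suc (N ℕ.+ d)))) ⟩
    g ℚ.+ (b ℚ.- b)                    ≡⟨ solve 2 (λ g b → g :+ (b :- b) := g) ≡.refl g b ⟩
    g                                  ≤⟨ gammaTerm-decreasing N d m ⟩
    seq (gammaTerm N) m                ∎
    where
    open ℚ.≤-Reasoning
    g = seq (gammaTerm (N ℕ.+ d)) m
    u = unit (suc (N ℕ.+ d))
    b = block m (suc (N ℕ.+ d))

  gammaTerm-increasing : ∀ N d m →
    seq (gammaTerm N) m ℚ.- unit N ℚ.≤ seq (gammaTerm (N ℕ.+ d)) m ℚ.- unit (N ℕ.+ d)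
  gammaTerm-increasing N zero    m = ℚ.≤-reflexive (≡.sym (≡.cong (λ z → seq (gammaTerm z) m ℚ.- unit z) (ℕ.+-identityʳ N)))
  gammaTerm-increasing N (suc d) m = begin
    seq (gammaTerm N) m ℚ.- unit N     ≤⟨ gammaTerm-increasing N d m ⟩
    g ℚ.- v                            ≤⟨ ℚ.+-monoʳ-≤ g (ℚ.neg-antimono-≤ (block-≤ m (N ℕ.+ d))) ⟩
    g ℚ.- b                            ≡⟨ solve 3 (λ g b u → g :- b := g :+ (u :- b) :- u) ≡.refl g b u ⟩
    g ℚ.+ (u ℚ.- b) ℚ.- u              ≡⟨ ≡.cong (ℚ._- u) (gammaTerm-suc (N ℕ.+ d) m) ⟨
    seq (gammaTerm (suc (N ℕ.+ d))) m ℚ.- unit (suc (N ℕ.+ d))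
      ≡⟨ ≡.cong (λ z → seq (gammaTerm z) m ℚ.- unit z) (ℕ.+-suc N d) ⟨
    seq (gammaTerm (N ℕ.+ suc d)) m ℚ.- unit (N ℕ.+ suc d)  ∎
    where
    open ℚ.≤-Reasoning
    g = seq (gammaTerm (N ℕ.+ d)) m
    v = unit (N ℕ.+ d)
    u = unit (suc (N ℕ.+ d))
    b = block m (suc (N ℕ.+ d))

  gammaTerm-close : ∀ {N n} m → N ℕ.≤ n → ℚ.∣ seq (gammaTerm N) m ℚ.- seq (gammaTerm n) m ∣ ℚ.≤ unit N
  gammaTerm-close {N} {n} m N≤n with ℕ.m≤n⇒∃[o]m+o≡n N≤n
  ... | d , ≡.refl = squeeze (gammaTerm-decreasing N d m) (begin
    a                        ≡⟨ solve 2 (λ a u → a := (a :- u) :+ u) ≡.refl a (unit N) ⟩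
    (a ℚ.- unit N) ℚ.+ unit N  ≤⟨ ℚ.+-monoˡ-≤ (unit N) (gammaTerm-increasing N d m) ⟩
    (b ℚ.- unit (N ℕ.+ d)) ℚ.+ unit N  ≤⟨ ℚ.+-monoˡ-≤ (unit N) (ℚ.+-monoʳ-≤ b (ℚ.neg-antimono-≤ (0≤unit (N ℕ.+ d)))) ⟩
    (b ℚ.+ 0ℚ) ℚ.+ unit N    ≡⟨ ≡.cong (ℚ._+ unit N) (ℚ.+-identityʳ b) ⟩
    b ℚ.+ unit N             ∎)
    where
    open ℚ.≤-Reasoning
    a = seq (gammaTerm N) m
    b = seq (gammaTerm (N ℕ.+ d)) m

  gammaTerm-cauchy : IsCauchy gammaTerm
  gammaTerm-cauchy {ε} 0<ε =
    let N , r = archimedean (0<½* 0<ε)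
    in N , λ {m} {n} hm hn {δ} 0<δ → 0 , λ {k} _ →
      let a = seq (gammaTerm m) k ; b = seq (gammaTerm n) k ; c = seq (gammaTerm N) k in begin
      ℚ.∣ a ℚ.- b ∣                    ≤⟨ triangle a c b ⟩
      ℚ.∣ a ℚ.- c ∣ ℚ.+ ℚ.∣ c ℚ.- b ∣  ≤⟨ ℚ.+-mono-≤
           (ℚ.≤-trans (ℚ.≤-trans (ℚ.≤-reflexive (∣-∣-comm a c)) (gammaTerm-close k hm)) r)
           (ℚ.≤-trans (gammaTerm-close k hn) r) ⟩
      ½ ℚ.* ε ℚ.+ ½ ℚ.* ε              ≡⟨ half+half ε ⟩
      ε                                ≤⟨ p≤p+r ε (ℚ.<⇒≤ 0<δ) ⟩
      ε ℚ.+ δ                          ∎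
    where open ℚ.≤-Reasoning

  γ : ℝ
  γ = lim gammaTerm gammaTerm-cauchy

  0≤gammaTerm : ∀ s m → 0ℚ ℚ.≤ seq (gammaTerm s) m
  0≤gammaTerm s m = ℚ.≤-trans (0≤unit s) (0≤∸⁻¹ (gammaTerm-increasing 0 s m))

  0≤inv! : ∀ k → 0ℚ ℚ.≤ inv! k
  0≤inv! k = ℚ.nonNegative⁻¹ (inv! k) {{ℚ.normalize-nonNeg 1 (k !) {{k ℕ.!≢0}}}}

  inv!-suc : ∀ k → inv! (suc k) ≡ inv! k ℚ.* unit k
  inv!-suc k = lemma (k !) {{k ℕ.!≢0}} {{suc k ℕ.!≢0}}
    where
    lemma : ∀ f .{{_ : ℕ.NonZero f}} .{{_ : ℕ.NonZero (suc k ℕ.* f)}} → 1ℤ / (suc k ℕ.* f) ≡ (1ℤ / f) ℚ.* unit k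
    lemma (suc f) = ≡.sym (≡.trans (frac-* 1 f 1 k)
      (frac-≡ 1 (k ℕ.+ f ℕ.* suc k) 1 (f ℕ.+ k ℕ.* suc f) (≡.cong (1 ℕ.*_) (ℕ.*-comm (suc k) (suc f)))))

  -- majorant b k = b^k/k!
  majorant : ℕ → ℕ → ℚ
  majorant b zero    = 1ℚ
  majorant b (suc k) = majorant b k ℚ.* (ι b ℚ.* unit k)

  0≤majorant : ∀ b k → 0ℚ ℚ.≤ majorant b k
  0≤majorant b zero    = 0≤ι 1
  0≤majorant b (suc k) = 0≤* (0≤majorant b k) (0≤* (0≤ι b) (0≤unit k))

  expTerm-suc : ∀ x k m → seq (expTerm x (suc k)) m ≡ seq (expTerm x k) m ℚ.* (seq x m ℚ.* unit k)
  expTerm-suc x k m = ≡.trans (≡.cong (seq x m ℚ.* seq (x ^ k) m ℚ.*_) (inv!-suc k))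
    (solve 4 (λ a p i u → a :* p :* (i :* u) := p :* i :* (a :* u)) ≡.refl
      (seq x m) (seq (x ^ k) m) (inv! k) (unit k))

  expTerm-≤ : ∀ x b m → ℚ.∣ seq x m ∣ ℚ.≤ ι b → ∀ k → ℚ.∣ seq (expTerm x k) m ∣ ℚ.≤ majorant b k
  expTerm-≤ x b m h zero    = ℚ.≤-refl
  expTerm-≤ x b m h (suc k) = begin
    ℚ.∣ seq (expTerm x (suc k)) m ∣                            ≡⟨ ≡.cong ℚ.∣_∣ (expTerm-suc x k m) ⟩
    ℚ.∣ seq (expTerm x k) m ℚ.* (seq x m ℚ.* unit k) ∣         ≡⟨ ℚ.∣p*q∣≡∣p∣*∣q∣ (seq (expTerm x k) m) _ ⟩
    ℚ.∣ seq (expTerm x k) m ∣ ℚ.* ℚ.∣ seq x m ℚ.* unit k ∣     ≡⟨ ≡.cong (ℚ.∣ seq (expTerm x k) m ∣ ℚ.*_)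
         (≡.trans (ℚ.∣p*q∣≡∣p∣*∣q∣ (seq x m) (unit k)) (≡.cong (ℚ.∣ seq x m ∣ ℚ.*_) (ℚ.0≤p⇒∣p∣≡p (0≤unit k)))) ⟩
    ℚ.∣ seq (expTerm x k) m ∣ ℚ.* (ℚ.∣ seq x m ∣ ℚ.* unit k)   ≤⟨ *-mono (ℚ.0≤∣p∣ (seq (expTerm x k) m))
         (0≤* (0≤ι b) (0≤unit k)) (expTerm-≤ x b m h k)
         (ℚ.*-monoʳ-≤-nonNeg (unit k) {{ℚ.nonNegative (0≤unit k)}} h) ⟩
    majorant b k ℚ.* (ι b ℚ.* unit k)                          ∎
    where open ℚ.≤-Reasoning

  majorant-halves : ∀ b k → b ℕ.+ b ℕ.≤ k → majorant b (suc k) ℚ.≤ majorant b k ℚ.* ½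
  majorant-halves b k h = ℚ.*-monoˡ-≤-nonNeg (majorant b k) {{ℚ.nonNegative (0≤majorant b k)}}
    (≡.subst (ℚ._≤ ½) (≡.sym (frac-* b 0 1 k)) (frac-≤ (b ℕ.* 1) (k ℕ.+ 0) 1 1 (begin
      b ℕ.* 1 ℕ.* 2          ≡⟨ ≡.cong (ℕ._* 2) (ℕ.*-identityʳ b) ⟩
      b ℕ.* 2                ≡⟨ ℕ.*-comm b 2 ⟩
      b ℕ.+ (b ℕ.+ 0)        ≡⟨ ≡.cong (b ℕ.+_) (ℕ.+-identityʳ b) ⟩
      b ℕ.+ b                ≤⟨ h ⟩
      k                      ≤⟨ ℕ.n≤1+n k ⟩
      suc k                  ≡⟨ ≡.cong suc (ℕ.+-identityʳ k) ⟨
      suc (k ℕ.+ 0)          ≡⟨ ℕ.*-identityˡ _ ⟨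
      1 ℕ.* suc (k ℕ.+ 0)    ∎)))
    where open ℕ.≤-Reasoning

  majorant-decay : ∀ b j → majorant b (b ℕ.+ b ℕ.+ j) ℚ.≤ majorant b (b ℕ.+ b) ℚ.* unit j
  majorant-decay b zero    = ℚ.≤-reflexive (≡.trans (≡.cong (majorant b) (ℕ.+-identityʳ (b ℕ.+ b))) (≡.sym (ℚ.*-identityʳ _)))
  majorant-decay b (suc j) = begin
    majorant b (b ℕ.+ b ℕ.+ suc j)    ≡⟨ ≡.cong (majorant b) (ℕ.+-suc (b ℕ.+ b) j) ⟩
    majorant b (suc (b ℕ.+ b ℕ.+ j))  ≤⟨ majorant-halves b (b ℕ.+ b ℕ.+ j) (ℕ.m≤m+n (b ℕ.+ b) j) ⟩
    majorant b (b ℕ.+ b ℕ.+ j) ℚ.* ½  ≤⟨ ℚ.*-monoʳ-≤-nonNeg ½ (majorant-decay b j) ⟩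
    T ℚ.* unit j ℚ.* ½                ≡⟨ ℚ.*-assoc T (unit j) ½ ⟩
    T ℚ.* (unit j ℚ.* ½)              ≤⟨ ℚ.*-monoˡ-≤-nonNeg T {{ℚ.nonNegative (0≤majorant b (b ℕ.+ b))}} unit-halves ⟩
    T ℚ.* unit (suc j)                ∎
    where
    open ℚ.≤-Reasoning
    T = majorant b (b ℕ.+ b)
    unit-halves : unit j ℚ.* ½ ℚ.≤ unit (suc j)
    unit-halves = ≡.subst (ℚ._≤ unit (suc j)) (≡.sym (frac-* 1 j 1 1))
      (frac-≤ 1 (1 ℕ.+ j ℕ.* 2) 1 (suc j) (ℕ.*-monoʳ-≤ 1 (s≤s (s≤s (ℕ.m≤m*n j 2)))))

  majorant-tail : ∀ b N → b ℕ.+ b ℕ.≤ N → ∀ d →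
    Σ[ d ] (λ j → majorant b (N ℕ.+ j)) ℚ.+ (majorant b (N ℕ.+ d) ℚ.+ majorant b (N ℕ.+ d)) ℚ.≤
    majorant b N ℚ.+ majorant b N
  majorant-tail b N h zero    = ℚ.≤-reflexive (≡.trans (ℚ.+-identityˡ _)
    (≡.cong (λ z → majorant b z ℚ.+ majorant b z) (ℕ.+-identityʳ N)))
  majorant-tail b N h (suc d) = begin
    S ℚ.+ t ℚ.+ (majorant b (N ℕ.+ suc d) ℚ.+ majorant b (N ℕ.+ suc d))
      ≡⟨ ≡.cong (λ z → S ℚ.+ t ℚ.+ (majorant b z ℚ.+ majorant b z)) (ℕ.+-suc N d) ⟩
    S ℚ.+ t ℚ.+ (majorant b (suc (N ℕ.+ d)) ℚ.+ majorant b (suc (N ℕ.+ d)))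
      ≤⟨ ℚ.+-monoʳ-≤ (S ℚ.+ t) (ℚ.+-mono-≤ halves halves) ⟩
    S ℚ.+ t ℚ.+ (t ℚ.* ½ ℚ.+ t ℚ.* ½)
      ≡⟨ solve 2 (λ s t → s :+ t :+ (t :* con ½ :+ t :* con ½) := s :+ (t :+ t)) ≡.refl S t ⟩
    S ℚ.+ (t ℚ.+ t)              ≤⟨ majorant-tail b N h d ⟩
    majorant b N ℚ.+ majorant b N  ∎
    where
    open ℚ.≤-Reasoning
    S = Σ[ d ] (λ j → majorant b (N ℕ.+ j))
    t = majorant b (N ℕ.+ d)
    halves : majorant b (suc (N ℕ.+ d)) ℚ.≤ t ℚ.* ½
    halves = majorant-halves b (N ℕ.+ d) (ℕ.≤-trans h (ℕ.m≤m+n N d))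

  expSum-tail : ∀ x b m → ℚ.∣ seq x m ∣ ℚ.≤ ι b → ∀ N d →
    ℚ.∣ seq (expSum x (N ℕ.+ d)) m ℚ.- seq (expSum x N) m ∣ ℚ.≤ Σ[ d ] (λ j → majorant b (N ℕ.+ j))
  expSum-tail x b m h N zero    = ℚ.≤-reflexive (≡.cong ℚ.∣_∣ (≡.trans
    (≡.cong (λ z → seq (expSum x z) m ℚ.- seq (expSum x N) m) (ℕ.+-identityʳ N)) (ℚ.+-inverseʳ (seq (expSum x N) m))))
  expSum-tail x b m h N (suc d) = begin
    ℚ.∣ seq (expSum x (N ℕ.+ suc d)) m ℚ.- s ∣  ≡⟨ ≡.cong (λ z → ℚ.∣ seq (expSum x z) m ℚ.- s ∣) (ℕ.+-suc N d) ⟩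
    ℚ.∣ (r ℚ.+ t) ℚ.- s ∣           ≡⟨ ≡.cong ℚ.∣_∣ (solve 3 (λ r t s → (r :+ t) :- s := (r :- s) :+ t) ≡.refl r t s) ⟩
    ℚ.∣ (r ℚ.- s) ℚ.+ t ∣           ≤⟨ ℚ.∣p+q∣≤∣p∣+∣q∣ (r ℚ.- s) t ⟩
    ℚ.∣ r ℚ.- s ∣ ℚ.+ ℚ.∣ t ∣       ≤⟨ ℚ.+-mono-≤ (expSum-tail x b m h N d) (expTerm-≤ x b m h (N ℕ.+ d)) ⟩
    Σ[ suc d ] (λ j → majorant b (N ℕ.+ j))  ∎
    where
    open ℚ.≤-Reasoning
    s = seq (expSum x N) m
    r = seq (expSum x (N ℕ.+ d)) m
    t = seq (expTerm x (N ℕ.+ d)) m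

  majorant-small : ∀ b {ε} → 0ℚ ℚ.< ε → ∃ λ N → b ℕ.+ b ℕ.≤ N × majorant b N ℚ.≤ ε
  majorant-small b {ε} 0<ε =
    let c , p = upper (majorant b (b ℕ.+ b))
        d , r = archimedean 0<ε
        j = c ℕ.+ d ℕ.* suc c
    in b ℕ.+ b ℕ.+ j , ℕ.m≤m+n (b ℕ.+ b) j , (begin
      majorant b (b ℕ.+ b ℕ.+ j)       ≤⟨ majorant-decay b j ⟩
      majorant b (b ℕ.+ b) ℚ.* unit j  ≤⟨ ℚ.*-monoʳ-≤-nonNeg (unit j) {{ℚ.nonNegative (0≤unit j)}}
                                           (ℚ.≤-trans p (ι-≤ {c} {suc c} (ℕ.n≤1+n c))) ⟩
      ι (suc c) ℚ.* unit j             ≡⟨ ι*unit c d ⟩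
      unit d                           ≤⟨ r ⟩
      ε                                ∎)
    where open ℚ.≤-Reasoning

  expSum-near : ∀ x b N {ε} → b ℕ.+ b ℕ.≤ N → majorant b N ℚ.≤ ½ ℚ.* ε →
    ∀ {k} → ℚ.∣ seq x k ∣ ℚ.≤ ι b → ∀ d →
    ℚ.∣ seq (expSum x (N ℕ.+ d)) k ℚ.- seq (expSum x N) k ∣ ℚ.≤ ε
  expSum-near x b N {ε} b+b≤N small {k} β d = begin
    ℚ.∣ seq (expSum x (N ℕ.+ d)) k ℚ.- seq (expSum x N) k ∣  ≤⟨ expSum-tail x b k β N d ⟩
    S                              ≤⟨ p≤p+r S (0≤majorant b (N ℕ.+ d)) ⟩
    S ℚ.+ t                        ≤⟨ ℚ.+-monoʳ-≤ S (p≤p+r t (0≤majorant b (N ℕ.+ d))) ⟩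
    S ℚ.+ (majorant b (N ℕ.+ d) ℚ.+ majorant b (N ℕ.+ d))  ≤⟨ majorant-tail b N b+b≤N d ⟩
    majorant b N ℚ.+ majorant b N  ≤⟨ ℚ.+-mono-≤ small small ⟩
    ½ ℚ.* ε ℚ.+ ½ ℚ.* ε            ≡⟨ half+half ε ⟩
    ε                              ∎
    where
    open ℚ.≤-Reasoning
    S = Σ[ d ] (λ j → majorant b (N ℕ.+ j))
    t = majorant b (N ℕ.+ d)

  from : ∀ (P : ℕ → Set) {N} → (∀ d → P (N ℕ.+ d)) → ∀ {n} → N ℕ.≤ n → P n
  from P h N≤n = ≡.subst P (ℕ.m+[n∸m]≡n N≤n) (h _)

  expSum-close : ∀ x b N {ε} → b ℕ.+ b ℕ.≤ N → majorant b N ℚ.≤ ½ ℚ.* (½ ℚ.* ε) →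
    ∀ {k} → ℚ.∣ seq x k ∣ ℚ.≤ ι b → ∀ {m n} → N ℕ.≤ m → N ℕ.≤ n →
    ℚ.∣ seq (expSum x m) k ℚ.- seq (expSum x n) k ∣ ℚ.≤ ε
  expSum-close x b N {ε} b+b≤N small {k} β {m} {n} hm hn = begin
    ℚ.∣ p ℚ.- r ∣                    ≤⟨ triangle p s r ⟩
    ℚ.∣ p ℚ.- s ∣ ℚ.+ ℚ.∣ s ℚ.- r ∣  ≤⟨ ℚ.+-mono-≤ (near hm)
                                         (≡.subst (ℚ._≤ ½ ℚ.* ε) (∣-∣-comm r s) (near hn)) ⟩
    ½ ℚ.* ε ℚ.+ ½ ℚ.* ε              ≡⟨ half+half ε ⟩
    ε                                ∎
    where
    open ℚ.≤-Reasoning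
    p = seq (expSum x m) k
    r = seq (expSum x n) k
    s = seq (expSum x N) k
    near : ∀ {n} → N ℕ.≤ n → ℚ.∣ seq (expSum x n) k ℚ.- s ∣ ℚ.≤ ½ ℚ.* ε
    near = from (λ n → ℚ.∣ seq (expSum x n) k ℚ.- s ∣ ℚ.≤ ½ ℚ.* ε) (expSum-near x b N b+b≤N small β)

  expSum-cauchy : ∀ x → IsCauchy (expSum x)
  expSum-cauchy x {ε} 0<ε =
    let b , K , β = eventually-bounded x
        N , b+b≤N , small = majorant-small b (0<½* (0<½* 0<ε))
    in N , λ hm hn 0<δ → K , λ K≤k →
      ℚ.≤-trans (expSum-close x b N b+b≤N small (β K≤k) hm hn) (p≤p+r ε (ℚ.<⇒≤ 0<δ))

  exp : ℝ → ℝ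
  exp x = lim (expSum x) (expSum-cauchy x)

  0≤γ : ∀ m → 0ℚ ℚ.≤ seq γ m
  0≤γ m = 0≤gammaTerm m (proj₁ (cauchy (gammaTerm m) (0<unit m)))

  1≤expSum : ∀ {x} → (∀ m → 0ℚ ℚ.≤ seq x m) → ∀ n m → 1ℚ ℚ.≤ seq (expSum x (suc n)) m
  1≤expSum {x} 0≤x zero    m = ℚ.≤-refl
  1≤expSum {x} 0≤x (suc n) m = begin
    1ℚ                                   ≤⟨ 1≤expSum {x} 0≤x n m ⟩
    seq (expSum x (suc n)) m             ≤⟨ p≤p+r (seq (expSum x (suc n)) m) (0≤* (0≤^ (suc n)) (0≤inv! (suc n))) ⟩
    seq (expSum x (suc (suc n))) m       ∎
    where
    open ℚ.≤-Reasoning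
    0≤^ : ∀ k → 0ℚ ℚ.≤ seq (x ^ k) m
    0≤^ zero    = 0≤ι 1
    0≤^ (suc k) = 0≤* (0≤x m) (0≤^ k)

  exp-γ-positive : Positive (exp γ)
  exp-γ-positive = bounded-below (0<unit 0) 1 λ { {suc n} _ → 1≤expSum {γ} 0≤γ n _ }

  *-positive : ∀ {x y} → Positive x → Positive y → Positive (x * y)
  *-positive (bounded-below 0<δ N h) (bounded-below 0<η M k) = bounded-below (0<* 0<δ 0<η) (N ℕ.⊔ M) λ hn →
    *-mono (ℚ.<⇒≤ 0<δ) (ℚ.≤-trans (ℚ.<⇒≤ 0<η) (k (ℕ.m⊔n≤o⇒n≤o N M hn)))
      (h (ℕ.m⊔n≤o⇒m≤o N M hn)) (k (ℕ.m⊔n≤o⇒n≤o N M hn))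

  fromℕ-positive : ∀ n .{{_ : ℕ.NonZero n}} → Positive (fromℕ n)
  fromℕ-positive (suc n) = bounded-below (0<unit 0) 0 λ _ → ι-≤ {1} {suc n} (s≤s z≤n)

  e^γn-positive : ∀ n .{{_ : ℕ.NonZero n}} → Positive (exp γ * fromℕ n)
  e^γn-positive n = *-positive {exp γ} {fromℕ n} exp-γ-positive (fromℕ-positive n)

record FiniteField c ℓ₁ ℓ₂ (q : ℕ) : Set (lsuc (c ⊔ ℓ₁ ⊔ ℓ₂)) where
  field
    heytingField : HeytingField c ℓ₁ ℓ₂

  open HeytingField heytingField public
  open HeytingCommutativeRing heytingCommutativeRing public using (commutativeRing)

  field
    elements : Inverse (≡.setoid (Fin q)) setoid

-- The list a₀ ∷ a₁ ∷ … ∷ [] stands for a₀ + a₁ x + ….  Trailing zeros are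
-- allowed, so polynomials are compared coefficient by coefficient.
module Polynomial {c ℓ} (R : CommutativeRing c ℓ) where
  open CommutativeRing R

  Poly : Set c
  Poly = List Carrier

  coeff : Poly → ℕ → Carrier
  coeff []      i       = 0#
  coeff (a ∷ p) zero    = a
  coeff (a ∷ p) (suc i) = coeff p i

  infix 4 _≈ₚ_
  _≈ₚ_ : Poly → Poly → Set ℓ
  p ≈ₚ r = ∀ i → coeff p i ≈ coeff r i

  infixl 6 _+ₚ_
  _+ₚ_ : Poly → Poly → Poly
  []      +ₚ r       = r
  (a ∷ p) +ₚ []      = a ∷ p
  (a ∷ p) +ₚ (b ∷ r) = a + b ∷ p +ₚ r

  infixl 7 _*ₚ_
  _*ₚ_ : Poly → Poly → Poly
  []      *ₚ r = []
  (a ∷ p) *ₚ r = List.map (a *_) r +ₚ (0# ∷ p *ₚ r)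

  1ₚ : Poly
  1ₚ = 1# ∷ []

  rawSemiring : RawSemiring c ℓ
  rawSemiring = record
    { Carrier = Poly ; _≈_ = _≈ₚ_
    ; _+_ = _+ₚ_ ; _*_ = _*ₚ_ ; 0# = [] ; 1# = 1ₚ
    }

  open RawSemiringDefinitions rawSemiring public using (Irreducible; _∣_)

  -- x^deg plus the terms of degree < deg, whose coefficients are listed in lower.
  record Monic : Set c where
    constructor monic
    field
      deg   : ℕ
      lower : Vec Carrier deg

    poly : Poly
    poly = Vec.toList lower ++ 1# ∷ []

  open Monic public

  IrreducibleMonic : Monic → Set (c ⊔ ℓ)
  IrreducibleMonic f = Irreducible (poly f)

  open SetoidReasoning setoid

  tail : Poly → Poly
  tail []      = []
  tail (_ ∷ p) = p

  coeff-tail : ∀ p i → coeff (tail p) i ≡ coeff p (suc i)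
  coeff-tail []      i = ≡.refl
  coeff-tail (_ ∷ p) i = ≡.refl

  coeff-+ : ∀ p r i → coeff (p +ₚ r) i ≈ coeff p i + coeff r i
  coeff-+ []      r       i       = sym (+-identityˡ _)
  coeff-+ (a ∷ p) []      i       = sym (+-identityʳ _)
  coeff-+ (a ∷ p) (b ∷ r) zero    = refl
  coeff-+ (a ∷ p) (b ∷ r) (suc i) = coeff-+ p r i

  coeff-map : ∀ a r i → coeff (List.map (a *_) r) i ≈ a * coeff r i
  coeff-map a []      i       = sym (zeroʳ a)
  coeff-map a (b ∷ r) zero    = refl
  coeff-map a (b ∷ r) (suc i) = coeff-map a r i

  coeff-*-zero : ∀ p r → coeff (p *ₚ r) 0 ≈ coeff p 0 * coeff r 0
  coeff-*-zero []      r = sym (zeroˡ _)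
  coeff-*-zero (a ∷ p) r = begin
    coeff (List.map (a *_) r +ₚ (0# ∷ p *ₚ r)) 0 ≈⟨ coeff-+ (List.map (a *_) r) _ 0 ⟩
    coeff (List.map (a *_) r) 0 + 0#             ≈⟨ +-identityʳ _ ⟩
    coeff (List.map (a *_) r) 0                  ≈⟨ coeff-map a r 0 ⟩
    a * coeff r 0                                ∎

  coeff-*-suc : ∀ p r i →
    coeff (p *ₚ r) (suc i) ≈ coeff p 0 * coeff r (suc i) + coeff (tail p *ₚ r) i
  coeff-*-suc []      r i = sym (trans (+-identityʳ _) (zeroˡ _))
  coeff-*-suc (a ∷ p) r i =
    trans (coeff-+ (List.map (a *_) r) _ (suc i)) (+-congʳ (coeff-map a r (suc i)))

  tail-cong : ∀ p p′ → p ≈ₚ p′ → tail p ≈ₚ tail p′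
  tail-cong p p′ e i = begin
    coeff (tail p) i   ≡⟨ coeff-tail p i ⟩
    coeff p (suc i)    ≈⟨ e (suc i) ⟩
    coeff p′ (suc i)   ≡⟨ coeff-tail p′ i ⟨
    coeff (tail p′) i  ∎

  *ₚ-cong : ∀ {p p′ r r′} → p ≈ₚ p′ → r ≈ₚ r′ → p *ₚ r ≈ₚ p′ *ₚ r′
  *ₚ-cong {p} {p′} {r} {r′} e f zero = begin
    coeff (p *ₚ r) 0       ≈⟨ coeff-*-zero p r ⟩
    coeff p 0 * coeff r 0  ≈⟨ *-cong (e 0) (f 0) ⟩
    coeff p′ 0 * coeff r′ 0 ≈⟨ coeff-*-zero p′ r′ ⟨
    coeff (p′ *ₚ r′) 0     ∎
  *ₚ-cong {p} {p′} {r} {r′} e f (suc i) = begin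
    coeff (p *ₚ r) (suc i)                                   ≈⟨ coeff-*-suc p r i ⟩
    coeff p 0 * coeff r (suc i) + coeff (tail p *ₚ r) i      ≈⟨ +-cong (*-cong (e 0) (f (suc i)))
                                                                  (*ₚ-cong {tail p} {tail p′} (tail-cong p p′ e) f i) ⟩
    coeff p′ 0 * coeff r′ (suc i) + coeff (tail p′ *ₚ r′) i  ≈⟨ coeff-*-suc p′ r′ i ⟨
    coeff (p′ *ₚ r′) (suc i)                                 ∎

  -- p has degree < n.
  Below : Poly → ℕ → Set ℓ
  Below p n = ∀ i → n ℕ.≤ i → coeff p i ≈ 0#

  tail-below : ∀ p {n} → Below p (suc n) → Below (tail p) n
  tail-below p b i n≤i = trans (reflexive (coeff-tail p i)) (b (suc i) (s≤s n≤i))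

  *ₚ-zeroˡ : ∀ p r → Below p 0 → Below (p *ₚ r) 0
  *ₚ-zeroˡ p r b zero    _ = begin
    coeff (p *ₚ r) 0       ≈⟨ coeff-*-zero p r ⟩
    coeff p 0 * coeff r 0  ≈⟨ *-congʳ (b 0 z≤n) ⟩
    0# * coeff r 0         ≈⟨ zeroˡ _ ⟩
    0#                     ∎
  *ₚ-zeroˡ p r b (suc i) _ = begin
    coeff (p *ₚ r) (suc i)                               ≈⟨ coeff-*-suc p r i ⟩
    coeff p 0 * coeff r (suc i) + coeff (tail p *ₚ r) i  ≈⟨ +-cong (*-congʳ (b 0 z≤n))
                                                             (*ₚ-zeroˡ (tail p) r (λ j _ → trans (reflexive (coeff-tail p j)) (b (suc j) z≤n)) i z≤n) ⟩
    0# * coeff r (suc i) + 0#                            ≈⟨ +-identityʳ _ ⟩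
    0# * coeff r (suc i)                                 ≈⟨ zeroˡ _ ⟩
    0#                                                   ∎

  *ₚ-lead : ∀ m n p r → Below p (suc m) → Below r (suc n) →
    coeff (p *ₚ r) (m ℕ.+ n) ≈ coeff p m * coeff r n
  *ₚ-lead zero zero p r bp br = coeff-*-zero p r
  *ₚ-lead zero (suc n) p r bp br = begin
    coeff (p *ₚ r) (suc n)                               ≈⟨ coeff-*-suc p r n ⟩
    coeff p 0 * coeff r (suc n) + coeff (tail p *ₚ r) n  ≈⟨ +-congˡ (*ₚ-zeroˡ (tail p) r (tail-below p bp) n z≤n) ⟩
    coeff p 0 * coeff r (suc n) + 0#                     ≈⟨ +-identityʳ _ ⟩
    coeff p 0 * coeff r (suc n)                          ∎
  *ₚ-lead (suc m) n p r bp br = begin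
    coeff (p *ₚ r) (suc (m ℕ.+ n))                                   ≈⟨ coeff-*-suc p r (m ℕ.+ n) ⟩
    coeff p 0 * coeff r (suc (m ℕ.+ n)) + coeff (tail p *ₚ r) (m ℕ.+ n)
      ≈⟨ +-cong (trans (*-congˡ (br _ (s≤s (ℕ.m≤n+m n m)))) (zeroʳ _))
                (*ₚ-lead m n (tail p) r (tail-below p bp) br) ⟩
    0# + coeff (tail p) m * coeff r n  ≈⟨ +-identityˡ _ ⟩
    coeff (tail p) m * coeff r n       ≈⟨ *-congʳ (reflexive (coeff-tail p m)) ⟩
    coeff p (suc m) * coeff r n        ∎

  poly-lead : ∀ f → coeff (poly f) (deg f) ≈ 1#
  poly-lead (monic zero    [])      = refl
  poly-lead (monic (suc d) (a ∷ v)) = poly-lead (monic d v)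

  poly-below : ∀ f → Below (poly f) (suc (deg f))
  poly-below (monic zero    [])      (suc i) _         = refl
  poly-below (monic (suc d) (a ∷ v)) (suc i) (s≤s le) = poly-below (monic d v) i le

  *ₚ-below : ∀ m n p r → Below p (suc m) → Below r (suc n) → Below (p *ₚ r) (suc (m ℕ.+ n))
  *ₚ-below zero n p r bp br (suc i) (s≤s le) = begin
    coeff (p *ₚ r) (suc i)                               ≈⟨ coeff-*-suc p r i ⟩
    coeff p 0 * coeff r (suc i) + coeff (tail p *ₚ r) i  ≈⟨ +-cong (*-congˡ (br _ (s≤s le))) (*ₚ-zeroˡ (tail p) r (tail-below p bp) i z≤n) ⟩
    coeff p 0 * 0# + 0#                                  ≈⟨ +-identityʳ _ ⟩
    coeff p 0 * 0#                                       ≈⟨ zeroʳ _ ⟩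
    0#                                                   ∎
  *ₚ-below (suc m) n p r bp br (suc i) (s≤s le) = begin
    coeff (p *ₚ r) (suc i)                               ≈⟨ coeff-*-suc p r i ⟩
    coeff p 0 * coeff r (suc i) + coeff (tail p *ₚ r) i
      ≈⟨ +-cong (*-congˡ (br _ (s≤s (ℕ.≤-trans (ℕ.≤-trans (ℕ.m≤n+m n m) (ℕ.n≤1+n _)) le))))
                (*ₚ-below m n (tail p) r (tail-below p bp) br i le) ⟩
    coeff p 0 * 0# + 0#                                  ≈⟨ +-identityʳ _ ⟩
    coeff p 0 * 0#                                       ≈⟨ zeroʳ _ ⟩
    0#                                                   ∎

module FiniteFieldPolynomials {c ℓ₁ ℓ₂} {q : ℕ} (F : FiniteField c ℓ₁ ℓ₂ q) where
  open FiniteField F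
  open Polynomial commutativeRing public
  open SetoidReasoning setoid
  private module E = Inverse elements

  infix 4 _≈?_
  _≈?_ : ∀ x y → Dec (x ≈ y)
  x ≈? y = map′
    (λ e → trans (sym (E.strictlyInverseˡ x)) (trans (E.to-cong e) (E.strictlyInverseˡ y)))
    E.from-cong
    (E.from x Fin.≟ E.from y)

  invertible : ∀ x → ¬ x ≈ 0# → ∃ λ y → y * x ≈ 1#
  invertible x x≉0 with Fin.any? (λ i → E.to i * x ≈? 1#)
  ... | yes (i , e) = E.to i , e
  ... | no none = ⊥-elim (x≉0 (proj₁ (tight x 0#) λ x#0 →
    let y , yx≈1 , _ = #⇒invertible x#0 in
    none (E.from y , (begin
      E.to (E.from y) * x  ≈⟨ *-congʳ (E.strictlyInverseˡ y) ⟩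
      y * x                ≈⟨ *-congˡ (trans (sym (+-identityʳ x)) (+-congˡ (sym -0≈0))) ⟩
      y * (x + - 0#)       ≈⟨ yx≈1 ⟩
      1#                   ∎))))
    where
    -0≈0 : - 0# ≈ 0#
    -0≈0 = trans (sym (+-identityˡ _)) (-‿inverseʳ 0#)

  1≉0 : ¬ 1# ≈ 0#
  1≉0 1≈0 = #-irrefl refl (invertible⇒# {0#} {0#} (0# , e , e))
    where
    e : ∀ {x} → x ≈ 1#
    e {x} = trans (sym (*-identityʳ x)) (trans (*-congˡ 1≈0) (trans (zeroʳ x) (sym 1≈0)))

  x*y≉0 : ∀ {x y} → ¬ x ≈ 0# → ¬ y ≈ 0# → ¬ x * y ≈ 0#
  x*y≉0 {x} {y} x≉0 y≉0 xy≈0 with invertible x x≉0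
  ... | z , zx≈1 = y≉0 (begin
    y            ≈⟨ *-identityˡ y ⟨
    1# * y       ≈⟨ *-congʳ zx≈1 ⟨
    (z * x) * y  ≈⟨ *-assoc z x y ⟩
    z * (x * y)  ≈⟨ *-congˡ xy≈0 ⟩
    z * 0#       ≈⟨ zeroʳ z ⟩
    0#           ∎)

  infix 4 _≈ₚ?_
  _≈ₚ?_ : ∀ p r → Dec (p ≈ₚ r)
  []      ≈ₚ? []      = yes λ _ → refl
  []      ≈ₚ? (b ∷ r) = map′ (λ { (e , f) zero → e ; (e , f) (suc i) → f i }) (λ e → e 0 , e ∘ suc)
                          (0# ≈? b ×-dec [] ≈ₚ? r)
  (a ∷ p) ≈ₚ? []      = map′ (λ { (e , f) zero → e ; (e , f) (suc i) → f i }) (λ e → e 0 , e ∘ suc)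
                          (a ≈? 0# ×-dec p ≈ₚ? [])
  (a ∷ p) ≈ₚ? (b ∷ r) = map′ (λ { (e , f) zero → e ; (e , f) (suc i) → f i }) (λ e → e 0 , e ∘ suc)
                          (a ≈? b ×-dec p ≈ₚ? r)

  HasDegree : Poly → ℕ → Set ℓ₁
  HasDegree p m = ¬ coeff p m ≈ 0# × Below p (suc m)

  degree : ∀ p → Below p 0 ⊎ ∃ (HasDegree p)
  degree [] = inj₁ λ _ _ → refl
  degree (a ∷ p) with degree p | a ≈? 0#
  ... | inj₂ (m , l≉0 , b) | _      = inj₂ (suc m , l≉0 , λ { (suc i) (s≤s le) → b i le })
  ... | inj₁ b             | yes e  = inj₁ λ { zero _ → e ; (suc i) _ → b i z≤n }
  ... | inj₁ b             | no a≉0 = inj₂ (0 , a≉0 , λ { (suc i) _ → b i z≤n })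

  degree-unique : ∀ {p r m n} → p ≈ₚ r → HasDegree p m → HasDegree r n → m ≡ n
  degree-unique {p} {r} {m} {n} e (lp , bp) (lr , br) with ℕ.<-cmp m n
  ... | tri≈ _ m≡n _ = m≡n
  ... | tri< m<n _ _ = ⊥-elim (lr (trans (sym (e n)) (bp n m<n)))
  ... | tri> _ _ n<m = ⊥-elim (lp (trans (e m) (br m n<m)))

  *ₚ-degree : ∀ {p r m n} → HasDegree p m → HasDegree r n → HasDegree (p *ₚ r) (m ℕ.+ n)
  *ₚ-degree {p} {r} {m} {n} (lp , bp) (lr , br) =
    (λ e → x*y≉0 lp lr (trans (sym (*ₚ-lead m n p r bp br)) e)) , *ₚ-below m n p r bp br

  1ₚ-degree : HasDegree 1ₚ 0
  1ₚ-degree = 1≉0 , λ { (suc i) _ → refl }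

  poly-degree : ∀ f → HasDegree (poly f) (deg f)
  poly-degree f = (λ e → 1≉0 (trans (sym (poly-lead f)) e)) , poly-below f

  factor-degrees : ∀ {f x y d} → HasDegree f d → f ≈ₚ x *ₚ y →
    ∃₂ λ m n → HasDegree x m × HasDegree y n × m ℕ.+ n ≡ d
  factor-degrees {f} {x} {y} {d} (l , b) e with degree x | degree y
  ... | inj₁ zx | _ = ⊥-elim (l (trans (e d) (*ₚ-zeroˡ x y zx d z≤n)))
  ... | inj₂ (m , dx) | inj₂ (n , dy) =
    m , n , dx , dy , ≡.sym (degree-unique {f} {x *ₚ y} e (l , b) (*ₚ-degree {x} {y} dx dy))
  ... | inj₂ (m , dx) | inj₁ zy = ⊥-elim (l (begin
      coeff f d               ≈⟨ e d ⟩
      coeff (x *ₚ y) d        ≈⟨ *ₚ-cong {x} {x} {y} {[]} (λ _ → refl) (λ i → zy i z≤n) d ⟩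
      coeff (x *ₚ []) d       ≈⟨ *ₚ-nil x d ⟩
      0#                      ∎))
    where
    *ₚ-nil : ∀ x i → coeff (x *ₚ []) i ≈ 0#
    *ₚ-nil []      i       = refl
    *ₚ-nil (a ∷ x) zero    = refl
    *ₚ-nil (a ∷ x) (suc i) = *ₚ-nil x i

  unit⇒degree-zero : ∀ {x m} → HasDegree x m → x ∣ 1ₚ → m ≡ 0
  unit⇒degree-zero {x} dx (z , e) with factor-degrees {1ₚ} {z} {x} 1ₚ-degree (λ i → sym (e i))
  ... | k , m , dz , dx′ , k+m≡0 =
    ≡.trans (degree-unique {x} {x} (λ _ → refl) dx dx′) (ℕ.m+n≡0⇒n≡0 k k+m≡0)

  degree-zero⇒unit : ∀ {x} → HasDegree x 0 → x ∣ 1ₚ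
  degree-zero⇒unit {x} (x₀≉0 , b) with invertible (coeff x 0) x₀≉0
  ... | z , zx≈1 = (z ∷ []) , λ where
    zero    → trans (coeff-*-zero (z ∷ []) x) zx≈1
    (suc i) → trans (coeff-*-suc (z ∷ []) x i)
                (trans (+-identityʳ _) (trans (*-congˡ (b (suc i) (s≤s z≤n))) (zeroʳ z)))

  fromCodes : ∀ {d} → Vec (Fin q) d → Poly
  fromCodes v = Vec.toList (Vec.map E.to v)

  fromCodes-below : ∀ {d} (v : Vec (Fin q) d) → Below (fromCodes v) d
  fromCodes-below []      i       _        = refl
  fromCodes-below (a ∷ v) (suc i) (s≤s le) = fromCodes-below v i le

  toCodes : ∀ d → Poly → Vec (Fin q) d
  toCodes zero    p = []
  toCodes (suc d) p = E.from (coeff p 0) ∷ toCodes d (tail p)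

  fromCodes-toCodes : ∀ d p → Below p d → fromCodes (toCodes d p) ≈ₚ p
  fromCodes-toCodes zero    p b i       = sym (b i z≤n)
  fromCodes-toCodes (suc d) p b zero    = E.strictlyInverseˡ _
  fromCodes-toCodes (suc d) p b (suc i) =
    trans (fromCodes-toCodes d (tail p) (tail-below p b) i) (reflexive (coeff-tail p i))

  anyCodes? : ∀ d {a} {P : Vec (Fin q) d → Set a} → (∀ v → Dec (P v)) → Dec (∃ P)
  anyCodes? zero    P? = map′ ([] ,_) (λ { ([] , p) → p }) (P? [])
  anyCodes? (suc d) P? = map′ (λ { (a , v , p) → a ∷ v , p }) (λ { (a ∷ v , p) → a , v , p })
    (Fin.any? λ a → anyCodes? d λ v → P? (a ∷ v))

  -- A monic polynomial of degree d ≥ 1 is reducible exactly when it is a product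
  -- of two polynomials of degree < d, of which there are finitely many.
  irreducible? : ∀ f → Dec (IrreducibleMonic f)
  irreducible? f@(monic zero []) = no λ irr →
    RawSemiringDefinitions.Irreducible.p∤1 irr (degree-zero⇒unit (poly-degree f))
  irreducible? f@(monic (suc k) _) with
    anyCodes? (suc k) (λ u → anyCodes? (suc k) λ v → poly f ≈ₚ? fromCodes u *ₚ fromCodes v)
  ... | yes (u , v , e) = no reducible
    where
    no-unit : ∀ {x y m n} → x ∣ 1ₚ → HasDegree x m → HasDegree y n →
      Below y (suc k) → ¬ m ℕ.+ n ≡ suc k
    no-unit {x} {y} x∣1 dx dy by m+n≡d with unit⇒degree-zero {x} dx x∣1
    ... | ≡.refl with m+n≡d
    ...   | ≡.refl = proj₁ dy (by (suc k) ℕ.≤-refl)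

    reducible : ¬ IrreducibleMonic f
    reducible irr with factor-degrees {poly f} {fromCodes u} {fromCodes v} (poly-degree f) e
                     | RawSemiringDefinitions.Irreducible.split-∣1 irr {fromCodes u} {fromCodes v} e
    ... | m , n , du , dv , m+n≡d | inj₁ u∣1 =
      no-unit {fromCodes u} {fromCodes v} u∣1 du dv (fromCodes-below v) m+n≡d
    ... | m , n , du , dv , m+n≡d | inj₂ v∣1 =
      no-unit {fromCodes v} {fromCodes u} v∣1 dv du (fromCodes-below u) (≡.trans (ℕ.+-comm n m) m+n≡d)
  ... | no none = yes record
    { p∤1 = λ f∣1 → ℕ.1+n≢0 (unit⇒degree-zero {poly f} (poly-degree f) f∣1)
    ; split-∣1 = λ {x} {y} e → split x y e
    }
    where
    split : ∀ x y → poly f ≈ₚ x *ₚ y → x ∣ 1ₚ ⊎ y ∣ 1ₚ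
    split x y e with factor-degrees {poly f} {x} {y} (poly-degree f) e
    ... | zero , n , dx , dy , m+n≡d = inj₁ (degree-zero⇒unit dx)
    ... | suc m , zero , dx , dy , m+n≡d = inj₂ (degree-zero⇒unit dy)
    ... | suc m , suc n , dx , dy , m+n≡d = ⊥-elim (none (toCodes (suc k) x , toCodes (suc k) y , λ i →
        trans (e i) (sym (*ₚ-cong {fromCodes (toCodes (suc k) x)} {x} {fromCodes (toCodes (suc k) y)} {y}
          (fromCodes-toCodes (suc k) x bx) (fromCodes-toCodes (suc k) y by) i))))
      where
      bx : Below x (suc k)
      bx i le = proj₂ dx i (ℕ.≤-trans (ℕ.≤-trans (s≤s (ℕ.m≤m+n (suc m) n))
        (ℕ.≤-reflexive (≡.trans (≡.sym (ℕ.+-suc (suc m) n)) m+n≡d))) le)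
      by : Below y (suc k)
      by i le = proj₂ dy i (ℕ.≤-trans (ℕ.≤-trans (s≤s (ℕ.m≤n+m (suc n) m))
        (ℕ.≤-reflexive m+n≡d)) le)

  vectors : ∀ d → List (Vec Carrier d)
  vectors zero    = [] ∷ []
  vectors (suc d) = List.cartesianProductWith _∷_ (List.tabulate E.to) (vectors d)

  monics : ℕ → List Monic
  monics d = List.map (monic d) (vectors d)

  -- elements has one entry for each ≈-class of F, so no polynomial is repeated.
  irreducibles≤ : ℕ → List Monic
  irreducibles≤ n = List.filter irreducible? (List.concatMap monics (List.upTo (suc n)))

  instance
    q≢0 : ℕ.NonZero q
    q≢0 = Fin.nonZeroIndex (E.from 0#)

  ‖_‖ : Monic → ℕ
  ‖ f ‖ = q ℕ.^ deg f

  1/‖_‖ : Monic → ℚ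
  1/‖ f ‖ = (1ℤ / ‖ f ‖) {{ℕ.m^n≢0 q (deg f)}}

open Reals public
  using (ℝ; fromℚ; fromℕ; _≤_; _*_; _⁻¹; exp; γ; e^γn-positive)

IsPrimePower : ℕ → Set
IsPrimePower q = ∃₂ λ p k → Prime p × 1 ℕ.≤ k × q ≡ p ℕ.^ k

∏ : List ℚ → ℚ
∏ = List.foldr ℚ._*_ 1ℚ

-- Let y p = 1/‖p‖, and let p run over the monic irreducibles of degree ≤ n.  A monic f of
-- degree m ≤ n satisfies m ≤ Σ deg p over the pairs (p, k), k ≥ 1, with p^k ∣ f, because f is
-- a product of irreducibles; uniqueness of the factorization is not needed.  Among the monic f
-- of degree m, a proportion of at most ‖p‖^(-k) is divisible by p^k, and none if k deg p > m.
-- Averaging over f gives m ≤ Σ (deg p) (y p)^k over k deg p ≤ m, and summation by parts turns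
-- these inequalities for m ≤ n into H_n ≤ Σ_p Σ_{k ≤ n} (y p)^k / k ≤ Σ_p -log (1 - y p).
-- Hence ∏ (1 - y p) ≤ exp (- H_n) ≤ exp (- γ - log n), as γ ≤ H_n - log n.
--
-- Logarithms are avoided: the analysis rests on two inequalities for the partial sums E_k of
-- the exponential series, E_k (x + t) (1 - t) ≤ E_k (x) and E_k (x) (1 + t) ≤ E_{k+1} (x + t).
module Submission where

open import Defs using (module Rationals; module Reals; ∏; FiniteField; module FiniteFieldPolynomials; module Polynomial)
open import Algebra.Bundles using (CommutativeRing)
open import Algebra.Definitions.RawSemiring using (module Irreducible)
open import Data.Empty using (⊥-elim)
open import Data.Fin.Base using (Fin; zero; suc)
import Data.Fin.Properties as Fin
open import Data.Integer.Base using (1ℤ)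
open import Data.List.Base as List using (List; []; _∷_)
open import Data.List.Membership.Propositional using (_∈_; lose)
import Data.List.Membership.Propositional.Properties as ∈
open import Data.List.Relation.Unary.All as All using (All; []; _∷_)
import Data.List.Relation.Unary.All.Properties as All
open import Data.List.Relation.Unary.Any using (here)
open import Data.Nat.Base as ℕ using (ℕ; zero; suc; z≤n; s≤s)
import Data.Nat.Properties as ℕ
open import Data.Product.Base using (∃; ∃₂; _×_; _,_; proj₁; proj₂)
open import Data.Rational.Base as ℚ using (ℚ; 0ℚ; 1ℚ; ½)
import Data.Rational.Properties as ℚ
open import Data.Rational.Solver using (module +-*-Solver)
open import Data.Sum.Base using (_⊎_; inj₁; inj₂)
open import Data.Vec.Base as Vec using (Vec; []; _∷_)
open import Function.Bundles using (Inverse)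
open import Level using (Level; _⊔_)
open import Relation.Binary.Bundles using (Setoid)
open import Relation.Binary.PropositionalEquality as ≡ using (_≡_)
import Relation.Binary.Reasoning.Setoid as SetoidReasoning
open import Relation.Nullary using (¬_; Dec; yes; no)

-- Write P for the product. As exp and γ exist only as limits of rational sequences, the inequality
-- e^γ n P ≤ 1 is proved for rational entries and every truncation E_k, with explicit errors c/(i +
-- 1) that are removed one limit at a time: the mesh of the logarithm, the entry of γ, the
-- truncation. The first inequality for E_k replaces 1 - t ≤ e^(-t). It is applied along a fine mesh
-- from 0 to y: the derivative of y + y²/2 + ... + yⁿ/n is at most 1/(1 - y) for y < 1, so the
-- factor 1 - y pays for this series in the exponent. The second replaces 1 + t ≤ e^t. It is applied
-- with t = 1/(M + 1), 1/(M + 2), ...: the factors 1 + t telescope to a ratio close to n, while the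
-- numbers t are exactly the terms of the Riemann sum that defines log n. Each application raises k
-- by one, so the bound on P must be available at all truncations.

private variable
  a b : Level
  A : Set a
  B : Set b

-- Inequalities between rationals and removal of vanishing errors.

module RationalBounds where
  open Rationals
  open import Data.Rational.Base using (_+_; _*_; _-_; -_; _≤_; _<_)
  open ≡ using (refl; sym; trans; cong; subst)
  open +-*-Solver using (solve; _:=_; _:+_; _:*_; _:-_; con)

  *-monoˡ : ∀ {a b c} → 0ℚ ≤ c → a ≤ b → c * a ≤ c * b
  *-monoˡ {c = c} 0≤c = ℚ.*-monoˡ-≤-nonNeg c {{ℚ.nonNegative 0≤c}}

  *-monoʳ : ∀ {a b c} → 0ℚ ≤ c → a ≤ b → a * c ≤ b * c
  *-monoʳ {c = c} 0≤c = ℚ.*-monoʳ-≤-nonNeg c {{ℚ.nonNegative 0≤c}}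

  0≤+ : ∀ {a b} → 0ℚ ≤ a → 0ℚ ≤ b → 0ℚ ≤ a + b
  0≤+ = ℚ.+-mono-≤

  0≤1 : 0ℚ ≤ 1ℚ
  0≤1 = 0≤ι 1

  0≤Σ : ∀ n {f} → (∀ j → 0ℚ ≤ f j) → 0ℚ ≤ Σ[ n ] f
  0≤Σ zero    h = ℚ.≤-refl
  0≤Σ (suc n) h = 0≤+ (0≤Σ n h) (h n)

  infixr 8 _^_
  _^_ : ℚ → ℕ → ℚ
  x ^ zero  = 1ℚ
  x ^ suc k = x * x ^ k

  0≤^ : ∀ {x} → 0ℚ ≤ x → ∀ k → 0ℚ ≤ x ^ k
  0≤^ 0≤x zero    = 0≤1
  0≤^ 0≤x (suc k) = 0≤* 0≤x (0≤^ 0≤x k)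

  ^-+ : ∀ x m n → x ^ (m ℕ.+ n) ≡ x ^ m * x ^ n
  ^-+ x zero    n = sym (ℚ.*-identityˡ (x ^ n))
  ^-+ x (suc m) n = trans (cong (x *_) (^-+ x m n)) (sym (ℚ.*-assoc x (x ^ m) (x ^ n)))

  ^-* : ∀ x n m → x ^ (m ℕ.* n) ≡ (x ^ n) ^ m
  ^-* x n zero    = refl
  ^-* x n (suc m) = trans (^-+ x n (m ℕ.* n)) (cong (x ^ n *_) (^-* x n m))

  -- The only limit principle in use: if b < a, the Archimedean property makes the error at most (a
  -- - b)/2 for some i ≥ N.
  ≤-limit : ∀ {a b} c N → (∀ i → N ℕ.≤ i → a ≤ b + c * unit i) → a ≤ b
  ≤-limit {a} {b} c N h with a ℚ.≤? b
  ... | yes a≤b = a≤b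
  ... | no a≰b = ⊥-elim (ℚ.<-irrefl refl (begin-strict
      a                      ≤⟨ h i (ℕ.m≤m+n N _) ⟩
      b + c * unit i         ≤⟨ ℚ.+-monoʳ-≤ b (ℚ.≤-trans (*-monoʳ (0≤unit i) c≤m) (*-monoˡ (0≤ι (suc m)) (unit-antitone (ℕ.m≤n+m j N)))) ⟩
      b + ι (suc m) * unit j ≡⟨ cong (b +_) (Reals.ι*unit m d) ⟩
      b + unit d             ≤⟨ ℚ.+-monoʳ-≤ b d≤ε ⟩
      b + ½ * (a - b)        <⟨ ℚ.+-monoʳ-< b (ℚ.<-respʳ-≡ (half+half (a - b)) (ℚ.<-respˡ-≡ (ℚ.+-identityʳ _) (ℚ.+-monoʳ-< (½ * (a - b)) 0<ε))) ⟩
      b + (a - b)            ≡⟨ solve 2 (λ a b → b :+ (a :- b) := a) refl a b ⟩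
      a                      ∎))
    where
    open ℚ.≤-Reasoning
    0<a-b : 0ℚ < a - b
    0<a-b = subst (_< a - b) (ℚ.+-inverseʳ b) (ℚ.+-monoˡ-< (- b) (ℚ.≰⇒> a≰b))
    0<ε : 0ℚ < ½ * (a - b)
    0<ε = 0<½* 0<a-b
    d = proj₁ (archimedean 0<ε)
    d≤ε = proj₂ (archimedean 0<ε)
    m = proj₁ (Reals.upper c)
    c≤m : c ≤ ι (suc m)
    c≤m = ℚ.≤-trans (proj₂ (Reals.upper c)) (ι-≤ (ℕ.n≤1+n m))
    -- Chosen so that j + 1 = (d + 1)(m + 1), which turns `ι (suc m) * unit j` into `unit d`.
    j = m ℕ.+ d ℕ.* suc m
    i = N ℕ.+ j

  -- Partial sums of the exponential series.

  expTerm : ℚ → ℕ → ℚ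
  expTerm x zero    = 1ℚ
  expTerm x (suc k) = expTerm x k * (x * unit k)

  exp : ℕ → ℚ → ℚ
  exp k x = Σ[ k ] (expTerm x)

  0≤expTerm : ∀ {x} → 0ℚ ≤ x → ∀ k → 0ℚ ≤ expTerm x k
  0≤expTerm 0≤x zero    = 0≤1
  0≤expTerm 0≤x (suc k) = 0≤* (0≤expTerm 0≤x k) (0≤* 0≤x (0≤unit k))

  0≤exp : ∀ {x} → 0ℚ ≤ x → ∀ k → 0ℚ ≤ exp k x
  0≤exp 0≤x k = 0≤Σ k (0≤expTerm 0≤x)

  ι-suc : ∀ k → ι (suc k) ≡ 1ℚ + ι k
  ι-suc = ι-+ 1

  ι-* : ∀ m n → ι (m ℕ.* n) ≡ ι m * ι n
  ι-* zero    n = sym (ℚ.*-zeroˡ (ι n))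
  ι-* (suc m) n = trans (ι-+ n (m ℕ.* n)) (trans (cong (ι n +_) (ι-* m n))
    (sym (trans (cong (_* ι n) (ι-suc m)) (solve 2 (λ m n → (con 1ℚ :+ m) :* n := n :+ m :* n) refl (ι m) (ι n)))))

  [1+k]*unit : ∀ k z → (1ℚ + ι k) * unit k * z ≡ z
  [1+k]*unit k z = trans (cong (λ w → w * unit k * z) (sym (ι-suc k)))
    (trans (cong (_* z) (ι-unit k)) (ℚ.*-identityˡ z))

  -- Multiplication by t is spread over 1 = (1 + c) v, where c = k + 1 and v = 1/(k + 2).
  expTerm-suc : ∀ x t k → t * expTerm x (suc k) ≡
    t * expTerm x (suc k) * unit (suc k) + t * unit (suc k) * (expTerm x k * x)
  expTerm-suc x t k = begin
    t * T₁                                        ≡⟨ [1+k]*unit (suc k) (t * T₁) ⟨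
    (1ℚ + ι (suc k)) * v * (t * (T₀ * (x * u)))   ≡⟨ solve 6 (λ c v t T₀ x u →
        (con 1ℚ :+ c) :* v :* (t :* (T₀ :* (x :* u))) :=
        t :* (T₀ :* (x :* u)) :* v :+ c :* u :* (t :* v :* (T₀ :* x))) refl (ι (suc k)) v t T₀ x u ⟩
    t * T₁ * v + ι (suc k) * u * (t * v * (T₀ * x)) ≡⟨ cong (λ w → t * T₁ * v + w)
        (trans (cong (_* (t * v * (T₀ * x))) (ι-unit k)) (ℚ.*-identityˡ _)) ⟩
    t * T₁ * v + t * v * (T₀ * x)                 ∎
    where
    open ≡.≡-Reasoning
    T₁ = expTerm x (suc k)
    T₀ = expTerm x k
    u = unit k
    v = unit (suc k)

  -- Mean value inequality for u^(k+1)/(k+1)!, whose derivative u^k/k! is largest at the right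
  -- endpoint. By `expTerm-suc`, each defect is x/(k+2) times the previous one plus a nonnegative
  -- term in t².
  expTerm-upper : ∀ {x t} → 0ℚ ≤ x → 0ℚ ≤ t → ∀ k →
    expTerm (x + t) (suc k) ≤ expTerm x (suc k) + t * expTerm (x + t) k
  expTerm-upper {x} {t} 0≤x 0≤t zero = ℚ.≤-reflexive
    (solve 2 (λ x t → con 1ℚ :* ((x :+ t) :* con 1ℚ) := con 1ℚ :* (x :* con 1ℚ) :+ t :* con 1ℚ) refl x t)
  expTerm-upper {x} {t} 0≤x 0≤t (suc k) = 0≤∸⁻¹ (subst (0ℚ ≤_) (sym eq)
    (0≤+ (0≤* (0≤* 0≤x (0≤unit (suc k))) (0≤∸ (expTerm-upper 0≤x 0≤t k)))
         (0≤* (0≤* (0≤* 0≤t 0≤t) (0≤expTerm (0≤+ 0≤x 0≤t) k)) (0≤unit (suc k)))))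
    where
    y = x + t
    X₁ = expTerm x (suc k)
    Y₁ = expTerm y (suc k)
    Y₀ = expTerm y k
    v = unit (suc k)
    eq : (X₁ * (x * v) + t * Y₁) - Y₁ * (y * v) ≡ x * v * ((X₁ + t * Y₀) - Y₁) + t * t * Y₀ * v
    eq = trans (cong (λ w → (X₁ * (x * v) + w) - Y₁ * (y * v)) (expTerm-suc y t k))
      (solve 6 (λ x t X₁ Y₁ Y₀ v →
        (X₁ :* (x :* v) :+ (t :* Y₁ :* v :+ t :* v :* (Y₀ :* (x :+ t)))) :- Y₁ :* ((x :+ t) :* v) :=
        x :* v :* ((X₁ :+ t :* Y₀) :- Y₁) :+ t :* t :* Y₀ :* v) refl x t X₁ Y₁ Y₀ v)

  -- Counterpart of `expTerm-upper` with the derivative at the left endpoint, where it is smallest;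
  -- here the previous defect is multiplied by (x + t)/(k+2).
  expTerm-lower : ∀ {x t} → 0ℚ ≤ x → 0ℚ ≤ t → ∀ k →
    expTerm x (suc k) + t * expTerm x k ≤ expTerm (x + t) (suc k)
  expTerm-lower {x} {t} 0≤x 0≤t zero = ℚ.≤-reflexive
    (solve 2 (λ x t → con 1ℚ :* (x :* con 1ℚ) :+ t :* con 1ℚ := con 1ℚ :* ((x :+ t) :* con 1ℚ)) refl x t)
  expTerm-lower {x} {t} 0≤x 0≤t (suc k) = 0≤∸⁻¹ (subst (0ℚ ≤_) (sym eq)
    (0≤+ (0≤* (0≤* (0≤+ 0≤x 0≤t) (0≤unit (suc k))) (0≤∸ (expTerm-lower 0≤x 0≤t k)))
         (0≤* (0≤* (0≤* 0≤t 0≤t) (0≤expTerm 0≤x k)) (0≤unit (suc k)))))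
    where
    y = x + t
    X₁ = expTerm x (suc k)
    X₀ = expTerm x k
    Y₁ = expTerm y (suc k)
    v = unit (suc k)
    eq : Y₁ * (y * v) - (X₁ * (x * v) + t * X₁) ≡ y * v * (Y₁ - (X₁ + t * X₀)) + t * t * X₀ * v
    eq = trans (cong (λ w → Y₁ * (y * v) - (X₁ * (x * v) + w)) (expTerm-suc x t k))
      (solve 6 (λ x t X₁ Y₁ X₀ v →
        Y₁ :* ((x :+ t) :* v) :- (X₁ :* (x :* v) :+ (t :* X₁ :* v :+ t :* v :* (X₀ :* x))) :=
        (x :+ t) :* v :* (Y₁ :- (X₁ :+ t :* X₀)) :+ t :* t :* X₀ :* v) refl x t X₁ Y₁ X₀ v)

  -- Summing `expTerm-upper` gives E_{k+1}(x + t) ≤ E_{k+1}(x) + t E_k(x + t). Enlarging the last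
  -- E_k to E_{k+1} lets it move to the left, so both sides keep the same truncation.
  exp-upper : ∀ {x t} → 0ℚ ≤ x → 0ℚ ≤ t → ∀ k → exp k (x + t) * (1ℚ - t) ≤ exp k x
  exp-upper {x} {t} 0≤x 0≤t zero    = ℚ.≤-reflexive (ℚ.*-zeroˡ (1ℚ - t))
  exp-upper {x} {t} 0≤x 0≤t (suc k) = begin
    Y * (1ℚ - t)           ≡⟨ solve 2 (λ Y t → Y :* (con 1ℚ :- t) := Y :- t :* Y) refl Y t ⟩
    Y - t * Y              ≤⟨ ℚ.+-monoˡ-≤ (- (t * Y)) (difference k) ⟩
    X + t * exp k y - t * Y ≤⟨ ℚ.+-monoˡ-≤ (- (t * Y)) (ℚ.+-monoʳ-≤ X (*-monoˡ 0≤t (p≤p+r (exp k y) (0≤expTerm (0≤+ 0≤x 0≤t) k)))) ⟩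
    X + t * Y - t * Y      ≡⟨ solve 2 (λ X Z → X :+ Z :- Z := X) refl X (t * Y) ⟩
    X                      ∎
    where
    open ℚ.≤-Reasoning
    y = x + t
    Y = exp (suc k) y
    X = exp (suc k) x
    difference : ∀ k → exp (suc k) y ≤ exp (suc k) x + t * exp k y
    difference zero    = p≤p+r 1ℚ (ℚ.≤-reflexive (sym (ℚ.*-zeroʳ t)))
    difference (suc k) = ℚ.≤-trans (ℚ.+-mono-≤ (difference k) (expTerm-upper 0≤x 0≤t k))
      (ℚ.≤-reflexive (solve 5 (λ a b c d t → (a :+ t :* b) :+ (c :+ t :* d) := (a :+ c) :+ t :* (b :+ d)) refl
        (exp (suc k) x) (exp k y) (expTerm x (suc k)) (expTerm y k) t))

  -- Obtained by summing `expTerm-lower`. The truncation has to rise: for k = 1 the left side is 1 +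
  -- t, while E_1 is constantly 1.
  exp-lower : ∀ {x t} → 0ℚ ≤ x → 0ℚ ≤ t → ∀ k → exp k x * (1ℚ + t) ≤ exp (suc k) (x + t)
  exp-lower {x} {t} 0≤x 0≤t k = begin
    X * (1ℚ + t)            ≡⟨ solve 2 (λ X t → X :* (con 1ℚ :+ t) := X :+ t :* X) refl X t ⟩
    X + t * X               ≤⟨ ℚ.+-monoˡ-≤ (t * X) (p≤p+r X (0≤expTerm 0≤x k)) ⟩
    exp (suc k) x + t * X   ≤⟨ difference k ⟩
    exp (suc k) (x + t)     ∎
    where
    open ℚ.≤-Reasoning
    X = exp k x
    difference : ∀ k → exp (suc k) x + t * exp k x ≤ exp (suc k) (x + t)
    difference zero    = ℚ.≤-reflexive (cong (λ w → 0ℚ + 1ℚ + w) (ℚ.*-zeroʳ t))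
    difference (suc k) = ℚ.≤-trans (ℚ.≤-reflexive
      (solve 5 (λ a b c d t → (a :+ c) :+ t :* (b :+ d) := (a :+ t :* b) :+ (c :+ t :* d)) refl
        (exp (suc k) x) (exp k x) (expTerm x (suc k)) (expTerm x k) t))
      (ℚ.+-mono-≤ (difference k) (expTerm-lower 0≤x 0≤t k))

  expTerm-mono : ∀ {x y} → 0ℚ ≤ x → x ≤ y → ∀ k → expTerm x k ≤ expTerm y k
  expTerm-mono 0≤x x≤y zero    = ℚ.≤-refl
  expTerm-mono 0≤x x≤y (suc k) = *-mono (0≤expTerm 0≤x k) (0≤* (ℚ.≤-trans 0≤x x≤y) (0≤unit k))
    (expTerm-mono 0≤x x≤y k) (*-monoʳ (0≤unit k) x≤y)

  exp-mono : ∀ {x y} → 0ℚ ≤ x → x ≤ y → ∀ k → exp k x ≤ exp k y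
  exp-mono 0≤x x≤y k = Σ-≤ k λ j _ → expTerm-mono 0≤x x≤y j

  exp-0 : ∀ k → exp k 0ℚ ≤ 1ℚ
  exp-0 zero          = 0≤1
  exp-0 (suc zero)    = ℚ.≤-refl
  exp-0 (suc (suc k)) = ℚ.≤-trans (ℚ.≤-reflexive
    (trans (cong (λ w → exp (suc k) 0ℚ + expTerm 0ℚ k * w) (ℚ.*-zeroˡ (unit k)))
    (trans (cong (_+_ (exp (suc k) 0ℚ)) (ℚ.*-zeroʳ (expTerm 0ℚ k))) (ℚ.+-identityʳ _)))) (exp-0 (suc k))

  -- The truncated series of -log (1 - y) in the exponent.

  -- The truncation of -log(1 - y) = y + y²/2 + ….
  logSeries : ℕ → ℚ → ℚ
  logSeries n y = Σ[ n ] λ k → y ^ suc k * unit k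

  0≤logSeries : ∀ {y} → 0ℚ ≤ y → ∀ n → 0ℚ ≤ logSeries n y
  0≤logSeries 0≤y n = 0≤Σ n λ k → 0≤* (0≤^ 0≤y (suc k)) (0≤unit k)

  ^-upper : ∀ {x t} → 0ℚ ≤ x → 0ℚ ≤ t → ∀ k → (x + t) ^ suc k ≤ x ^ suc k + ι (suc k) * (t * (x + t) ^ k)
  ^-upper {x} {t} 0≤x 0≤t zero = ℚ.≤-reflexive
    (solve 2 (λ x t → (x :+ t) :* con 1ℚ := x :* con 1ℚ :+ con 1ℚ :* (t :* con 1ℚ)) refl x t)
  ^-upper {x} {t} 0≤x 0≤t (suc k) = begin
    y * y ^ suc k                                             ≡⟨ solve 3 (λ x t Y → (x :+ t) :* Y := x :* Y :+ t :* Y) refl x t (y ^ suc k) ⟩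
    x * y ^ suc k + t * y ^ suc k                             ≤⟨ ℚ.+-monoˡ-≤ (t * y ^ suc k) (*-monoˡ 0≤x (^-upper 0≤x 0≤t k)) ⟩
    x * (x ^ suc k + c * (t * y ^ k)) + t * y ^ suc k         ≡⟨ solve 6 (λ x X c t Y Z → x :* (X :+ c :* (t :* Y)) :+ Z := x :* X :+ (c :* t :* Y) :* x :+ Z) refl
                                                                   x (x ^ suc k) c t (y ^ k) (t * y ^ suc k) ⟩
    x ^ suc (suc k) + c * t * y ^ k * x + t * y ^ suc k       ≤⟨ ℚ.+-monoˡ-≤ (t * y ^ suc k) (ℚ.+-monoʳ-≤ (x ^ suc (suc k))
                                                                   (*-monoˡ (0≤* (0≤* (0≤ι (suc k)) 0≤t) (0≤^ (0≤+ 0≤x 0≤t) k)) (p≤p+r x 0≤t))) ⟩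
    x ^ suc (suc k) + c * t * y ^ k * y + t * y ^ suc k       ≡⟨ solve 5 (λ X c t Y y → X :+ c :* t :* Y :* y :+ t :* (y :* Y) := X :+ (con 1ℚ :+ c) :* (t :* (y :* Y))) refl
                                                                   (x ^ suc (suc k)) c t (y ^ k) y ⟩
    x ^ suc (suc k) + (1ℚ + c) * (t * y ^ suc k)              ≡⟨ cong (λ w → x ^ suc (suc k) + w * (t * y ^ suc k)) (ι-suc (suc k)) ⟨
    x ^ suc (suc k) + ι (suc (suc k)) * (t * y ^ suc k)       ∎
    where
    open ℚ.≤-Reasoning
    y = x + t
    c = ι (suc k)

  -- Mean value inequality again: the derivative of the truncated series is a geometric sum with
  -- nonnegative terms, hence largest at x + t. The factor k + 1 from `^-upper` cancels the
  -- denominator k + 1.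
  logSeries-upper : ∀ {x t} → 0ℚ ≤ x → 0ℚ ≤ t → ∀ n →
    logSeries n (x + t) ≤ logSeries n x + t * Σ[ n ] ((x + t) ^_)
  logSeries-upper {x} {t} 0≤x 0≤t zero = ℚ.≤-reflexive (sym (trans (ℚ.+-identityˡ _) (ℚ.*-zeroʳ t)))
  logSeries-upper {x} {t} 0≤x 0≤t (suc n) = begin
    logSeries n y + y ^ suc n * u                        ≤⟨ ℚ.+-mono-≤ (logSeries-upper 0≤x 0≤t n) (*-monoʳ (0≤unit n) (^-upper 0≤x 0≤t n)) ⟩
    l + t * g + (x ^ suc n + c * (t * y ^ n)) * u        ≡⟨ solve 7 (λ l t g X c Y u → l :+ t :* g :+ (X :+ c :* (t :* Y)) :* u := l :+ X :* u :+ (t :* g :+ c :* u :* (t :* Y))) refl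
                                                              l t g (x ^ suc n) c (y ^ n) u ⟩
    l + x ^ suc n * u + (t * g + c * u * (t * y ^ n))    ≡⟨ cong (λ w → l + x ^ suc n * u + (t * g + w)) (trans (cong (_* (t * y ^ n)) (ι-unit n)) (ℚ.*-identityˡ _)) ⟩
    l + x ^ suc n * u + (t * g + t * y ^ n)              ≡⟨ cong (l + x ^ suc n * u +_) (ℚ.*-distribˡ-+ t g (y ^ n)) ⟨
    l + x ^ suc n * u + t * (g + y ^ n)                  ∎
    where
    open ℚ.≤-Reasoning
    y = x + t
    l = logSeries n x
    g = Σ[ n ] (y ^_)
    c = ι (suc n)
    u = unit n

  geometric : ∀ y n → (1ℚ - y) * Σ[ n ] (y ^_) ≡ 1ℚ - y ^ n
  geometric y zero    = ℚ.*-zeroʳ (1ℚ - y)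
  geometric y (suc n) = trans (ℚ.*-distribˡ-+ (1ℚ - y) (Σ[ n ] (y ^_)) (y ^ n))
    (trans (cong (_+ (1ℚ - y) * y ^ n) (geometric y n))
      (solve 2 (λ y Y → con 1ℚ :- Y :+ (con 1ℚ :- y) :* Y := con 1ℚ :- y :* Y) refl y (y ^ n)))

  p-r≤p : ∀ p {r} → 0ℚ ≤ r → p - r ≤ p
  p-r≤p p {r} h = subst (p - r ≤_) (ℚ.+-identityʳ p) (ℚ.+-monoʳ-≤ p (ℚ.neg-antimono-≤ h))

  -- Along the mesh 0, δ, 2δ, …, one step from x to y = x + δ increases logSeries by
  -- at most t = δ (1 + y + … + y^(n-1)), and (1 - y) t ≤ δ.
  exp-logSeries-mesh : ∀ {x δ} → 0ℚ ≤ x → 0ℚ ≤ δ → ∀ k n i → ι i * δ ≤ 1ℚ →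
    exp k (x + logSeries n (ι i * δ)) * (1ℚ - ι (suc i) * δ) ≤ exp k x
  exp-logSeries-mesh {x} {δ} 0≤x 0≤δ k n zero _ = begin
    exp k (x + logSeries n (0ℚ * δ)) * (1ℚ - 1ℚ * δ)  ≡⟨ ≡.cong₂ (λ a b → exp k a * (1ℚ - b))
         (trans (cong (x +_) (trans (cong (logSeries n) (ℚ.*-zeroˡ δ)) (logSeries-0 n))) (ℚ.+-identityʳ x)) (ℚ.*-identityˡ δ) ⟩
    exp k x * (1ℚ - δ)  ≤⟨ *-monoˡ (0≤exp 0≤x k) (p-r≤p 1ℚ 0≤δ) ⟩
    exp k x * 1ℚ        ≡⟨ ℚ.*-identityʳ _ ⟩
    exp k x             ∎
    where
    open ℚ.≤-Reasoning
    logSeries-0 : ∀ n → logSeries n 0ℚ ≡ 0ℚ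
    logSeries-0 zero    = refl
    logSeries-0 (suc n) = trans (≡.cong₂ _+_ (logSeries-0 n)
      (trans (cong (_* unit n) (ℚ.*-zeroˡ (0ℚ ^ n))) (ℚ.*-zeroˡ (unit n)))) (ℚ.+-identityˡ 0ℚ)
  exp-logSeries-mesh {x} {δ} 0≤x 0≤δ k n (suc i) y≤1 = begin
    exp k (x + logSeries n (ι (suc i) * δ)) * (1ℚ - ι (suc (suc i)) * δ)
      ≡⟨ ≡.cong₂ (λ a b → exp k (x + logSeries n a) * (1ℚ - b)) y-step
           (trans (cong (_* δ) (ι-suc (suc i))) (trans (solve 2 (λ c d → (con 1ℚ :+ c) :* d := c :* d :+ d) refl (ι (suc i)) δ) (cong (_+ δ) y-step))) ⟩
    exp k (x + logSeries n y) * (1ℚ - (y + δ))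
      ≤⟨ *-monoˡ (0≤exp (0≤+ 0≤x (0≤logSeries 0≤y n)) k) shrink ⟩
    exp k (x + logSeries n y) * ((1ℚ - t) * (1ℚ - y))
      ≡⟨ ℚ.*-assoc (exp k (x + logSeries n y)) (1ℚ - t) (1ℚ - y) ⟨
    exp k (x + logSeries n y) * (1ℚ - t) * (1ℚ - y)
      ≤⟨ *-monoʳ 0≤1-y step ⟩
    exp k (x + logSeries n z) * (1ℚ - y)
      ≡⟨ cong (λ w → exp k (x + logSeries n z) * (1ℚ - w)) y-step ⟨
    exp k (x + logSeries n z) * (1ℚ - ι (suc i) * δ)
      ≤⟨ exp-logSeries-mesh 0≤x 0≤δ k n i (ℚ.≤-trans (*-monoʳ 0≤δ (ι-≤ (ℕ.n≤1+n i))) y≤1) ⟩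
    exp k x ∎
    where
    open ℚ.≤-Reasoning
    z = ι i * δ
    y = z + δ
    g = Σ[ n ] (y ^_)
    t = δ * g
    y-step : ι (suc i) * δ ≡ y
    y-step = trans (cong (_* δ) (ι-suc i)) (solve 2 (λ c d → (con 1ℚ :+ c) :* d := c :* d :+ d) refl (ι i) δ)
    0≤z : 0ℚ ≤ z
    0≤z = 0≤* (0≤ι i) 0≤δ
    0≤y : 0ℚ ≤ y
    0≤y = 0≤+ 0≤z 0≤δ
    0≤t : 0ℚ ≤ t
    0≤t = 0≤* 0≤δ (0≤Σ n (0≤^ 0≤y))
    0≤1-y : 0ℚ ≤ 1ℚ - y
    0≤1-y = 0≤∸ (subst (_≤ 1ℚ) y-step y≤1)
    -- By `geometric`, the difference of the two sides is δ (1 - (1 - y) g) = δ yⁿ.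
    shrink : 1ℚ - (y + δ) ≤ (1ℚ - t) * (1ℚ - y)
    shrink = 0≤∸⁻¹ (subst (0ℚ ≤_) (sym (trans
      (solve 3 (λ y d g → (con 1ℚ :- d :* g) :* (con 1ℚ :- y) :- (con 1ℚ :- (y :+ d)) := d :* (con 1ℚ :- (con 1ℚ :- y) :* g)) refl y δ g)
      (cong (δ *_) (trans (cong (_-_ 1ℚ) (geometric y n)) (solve 1 (λ Y → con 1ℚ :- (con 1ℚ :- Y) := Y) refl (y ^ n))))))
      (0≤* 0≤δ (0≤^ 0≤y n)))
    step : exp k (x + logSeries n y) * (1ℚ - t) ≤ exp k (x + logSeries n z)
    -- Monotonicity of `exp k` may be multiplied by 1 - t only when t ≤ 1; when 1 ≤ t the left side
    -- is at most 0.
    step with ℚ.≤-total t 1ℚ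
    ... | inj₁ t≤1 = ℚ.≤-trans (*-monoʳ (0≤∸ t≤1) (exp-mono (0≤+ 0≤x (0≤logSeries 0≤y n)) (ℚ.≤-trans
        (ℚ.+-monoʳ-≤ x (logSeries-upper 0≤z 0≤δ n)) (ℚ.≤-reflexive (sym (ℚ.+-assoc x (logSeries n z) t)))) k))
      (exp-upper (0≤+ 0≤x (0≤logSeries 0≤z n)) 0≤t k)
    ... | inj₂ 1≤t = ℚ.≤-trans (*-monoˡ (0≤exp (0≤+ 0≤x (0≤logSeries 0≤y n)) k)
        (subst (1ℚ - t ≤_) (ℚ.+-inverseʳ t) (ℚ.+-monoˡ-≤ (- t) 1≤t)))
      (ℚ.≤-trans (ℚ.≤-reflexive (ℚ.*-zeroʳ (exp k (x + logSeries n y)))) (0≤exp (0≤+ 0≤x (0≤logSeries 0≤z n)) k))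

  -- For mesh width δ = y/(i + 1), y is mesh point number i + 1. The factor in the mesh estimate
  -- belongs to the following point, so it is 1 - (y + δ) instead of 1 - y; the resulting error E
  -- y/(i + 1) disappears as i grows.
  exp-logSeries : ∀ {x y} → 0ℚ ≤ x → 0ℚ ≤ y → y ≤ 1ℚ → ∀ k n →
    exp k (x + logSeries n y) * (1ℚ - y) ≤ exp k x
  exp-logSeries {x} {y} 0≤x 0≤y y≤1 k n = ≤-limit (E * y) 0 λ i _ →
    let δ = unit i * y
        e : ι (suc i) * δ ≡ y
        e = trans (sym (ℚ.*-assoc (ι (suc i)) (unit i) y)) (trans (cong (_* y) (ι-unit i)) (ℚ.*-identityˡ y))
        e′ : ι (suc (suc i)) * δ ≡ y + δ
        e′ = trans (cong (_* δ) (ι-suc (suc i))) (trans (solve 2 (λ c d → (con 1ℚ :+ c) :* d := c :* d :+ d) refl (ι (suc i)) δ) (cong (_+ δ) e))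
    in begin
    E * (1ℚ - y)                      ≡⟨ solve 3 (λ e y u → e :* (con 1ℚ :- y) := e :* (con 1ℚ :- (y :+ u :* y)) :+ e :* y :* u) refl E y (unit i) ⟩
    E * (1ℚ - (y + δ)) + E * y * unit i ≤⟨ ℚ.+-monoˡ-≤ (E * y * unit i)
        (subst (_≤ exp k x) (≡.cong₂ (λ a b → exp k (x + logSeries n a) * (1ℚ - b)) e e′)
          (exp-logSeries-mesh 0≤x (0≤* (0≤unit i) 0≤y) k n (suc i) (subst (_≤ 1ℚ) (sym e) y≤1))) ⟩
    exp k x + E * y * unit i          ∎
    where
    open ℚ.≤-Reasoning
    E = exp k (x + logSeries n y)

  ∑ : List A → (A → ℚ) → ℚ
  ∑ []       f = 0ℚ
  ∑ (x ∷ xs) f = f x + ∑ xs f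

  ∑-≥0 : ∀ (xs : List A) {f} → (∀ x → 0ℚ ≤ f x) → 0ℚ ≤ ∑ xs f
  ∑-≥0 []       h = ℚ.≤-refl
  ∑-≥0 (x ∷ xs) h = 0≤+ (h x) (∑-≥0 xs h)

  -- Each factor 1 - y p removes its own series from the exponent by `exp-logSeries`, until
  -- `exp k 0ℚ` is left.
  exp-∑-logSeries : ∀ (y : A → ℚ) → (∀ p → 0ℚ ≤ y p) → (∀ p → y p ≤ 1ℚ) → ∀ k n ps →
    exp k (∑ ps (λ p → logSeries n (y p))) * ∏ (List.map (λ p → 1ℚ - y p) ps) ≤ 1ℚ
  exp-∑-logSeries y 0≤y y≤1 k n []       = ℚ.≤-trans (ℚ.≤-reflexive (ℚ.*-identityʳ _)) (exp-0 k)
  exp-∑-logSeries y 0≤y y≤1 k n (p ∷ ps) = begin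
    exp k (l + s) * ((1ℚ - y p) * P)   ≡⟨ ℚ.*-assoc (exp k (l + s)) (1ℚ - y p) P ⟨
    exp k (l + s) * (1ℚ - y p) * P     ≡⟨ cong (λ w → exp k w * (1ℚ - y p) * P) (ℚ.+-comm l s) ⟩
    exp k (s + l) * (1ℚ - y p) * P     ≤⟨ *-monoʳ (∏-≥0 ps) (exp-logSeries (∑-≥0 ps λ r → 0≤logSeries (0≤y r) n) (0≤y p) (y≤1 p) k n) ⟩
    exp k s * P                        ≤⟨ exp-∑-logSeries y 0≤y y≤1 k n ps ⟩
    1ℚ                                 ∎
    where
    open ℚ.≤-Reasoning
    l = logSeries n (y p)
    s = ∑ ps (λ p → logSeries n (y p))
    P = ∏ (List.map (λ p → 1ℚ - y p) ps)
    ∏-≥0 : ∀ ps → 0ℚ ≤ ∏ (List.map (λ p → 1ℚ - y p) ps)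
    ∏-≥0 []       = 0≤1
    ∏-≥0 (p ∷ ps) = 0≤* (0≤∸ (y≤1 p)) (∏-≥0 ps)

  -- The factors 1 + 1/(a + j + 1) = (a + j + 2)/(a + j + 1) telescope to (a + 1 + l)/(a + 1), and
  -- `exp-lower` moves each of them into the exponent at the cost of one truncation index.
  exp-reciprocals : ∀ {x} → 0ℚ ≤ x → ∀ k a l →
    exp k x * ι (suc a ℕ.+ l) ≤ exp (k ℕ.+ l) (x + Σ[ l ] (λ j → unit (a ℕ.+ j))) * ι (suc a)
  exp-reciprocals {x} 0≤x k a zero = ℚ.≤-reflexive (≡.cong₂ _*_
    (≡.cong₂ exp (sym (ℕ.+-identityʳ k)) (sym (ℚ.+-identityʳ x))) (cong (λ b → ι (suc b)) (ℕ.+-identityʳ a)))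
  exp-reciprocals {x} 0≤x k a (suc l) = begin
    exp k x * ι (suc a ℕ.+ suc l)                 ≡⟨ cong (exp k x *_) grow ⟩
    exp k x * (ι (suc a ℕ.+ l) * (1ℚ + u))        ≡⟨ ℚ.*-assoc (exp k x) _ _ ⟨
    exp k x * ι (suc a ℕ.+ l) * (1ℚ + u)          ≤⟨ *-monoʳ (0≤+ 0≤1 (0≤unit (a ℕ.+ l))) (exp-reciprocals 0≤x k a l) ⟩
    exp (k ℕ.+ l) (x + s) * ι (suc a) * (1ℚ + u)  ≡⟨ solve 3 (λ e c v → e :* c :* v := e :* v :* c) refl (exp (k ℕ.+ l) (x + s)) (ι (suc a)) (1ℚ + u) ⟩
    exp (k ℕ.+ l) (x + s) * (1ℚ + u) * ι (suc a)  ≤⟨ *-monoʳ (0≤ι (suc a)) (exp-lower (0≤+ 0≤x (0≤Σ l λ j → 0≤unit (a ℕ.+ j))) (0≤unit (a ℕ.+ l)) (k ℕ.+ l)) ⟩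
    exp (suc (k ℕ.+ l)) (x + s + u) * ι (suc a)   ≡⟨ ≡.cong₂ (λ b c → exp b c * ι (suc a)) (sym (ℕ.+-suc k l)) (ℚ.+-assoc x s u) ⟩
    exp (k ℕ.+ suc l) (x + (s + u)) * ι (suc a)   ∎
    where
    open ℚ.≤-Reasoning
    u = unit (a ℕ.+ l)
    s = Σ[ l ] (λ j → unit (a ℕ.+ j))
    grow : ι (suc a ℕ.+ suc l) ≡ ι (suc a ℕ.+ l) * (1ℚ + u)
    grow = trans (cong ι (ℕ.+-suc (suc a) l)) (trans (ι-suc (suc a ℕ.+ l))
      (sym (trans (solve 2 (λ c u → c :* (con 1ℚ :+ u) := c :* u :+ c) refl (ι (suc a ℕ.+ l)) u)
        (cong (_+ ι (suc a ℕ.+ l)) (ι-unit (a ℕ.+ l))))))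

  ∏-bounds : ∀ {z : A → ℚ} → (∀ p → 0ℚ ≤ z p) → (∀ p → z p ≤ 1ℚ) → ∀ ps →
    0ℚ ≤ ∏ (List.map z ps) × ∏ (List.map z ps) ≤ 1ℚ
  ∏-bounds 0≤z z≤1 []       = 0≤1 , ℚ.≤-refl
  ∏-bounds 0≤z z≤1 (p ∷ ps) with ∏-bounds 0≤z z≤1 ps
  ... | 0≤P , P≤1 = 0≤* (0≤z p) 0≤P , *-mono (0≤z p) 0≤1 (z≤1 p) P≤1

  ∣∣⇒≤ : ∀ {x y e} → ℚ.∣ x - y ∣ ≤ e → x ≤ y + e
  ∣∣⇒≤ {x} {y} {e} h = subst (_≤ y + e) (solve 2 (λ x y → y :+ (x :- y) := x) refl x y)
    (ℚ.+-monoʳ-≤ y (ℚ.≤-trans (p≤∣p∣ (x - y)) h))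

  -- Entry k of `lim` is an entry of X k that lies within 1/(k + 1) of all later ones. In this form
  -- the later entry i can be sent to infinity while k is fixed.
  lim-upper : ∀ X (c : Reals.IsCauchy X) k → ∃ λ I → ∀ i → I ℕ.≤ i → Reals.seq (Reals.lim X c) k ≤ Reals.seq (X k) i + unit k
  lim-upper X c k = _ , λ i I≤i → ∣∣⇒≤ (proj₂ (Reals.cauchy (X k) (0<unit k)) ℕ.≤-refl I≤i)

  expSum-exp : ∀ x k i → Reals.seq (Reals.expSum x k) i ≡ exp k (Reals.seq x i)
  expSum-exp x zero    i = refl
  expSum-exp x (suc k) i = ≡.cong₂ _+_ (expSum-exp x k i) (go k)
    where
    go : ∀ k → Reals.seq (Reals.expTerm x k) i ≡ expTerm (Reals.seq x i) k
    go zero    = refl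
    go (suc k) = trans (Reals.expTerm-suc x k i) (cong (_* (Reals.seq x i * unit k)) (go k))

  -- Entrywise γ ≤ H - log: entry i of γ exceeds a late entry of `gammaTerm i` by at most 1/(i + 1),
  -- and `gammaTerm` decreases from n to i at every mesh j.
  γ-upper : ∀ n i → n ℕ.≤ i → ∃ λ J → ∀ j → J ℕ.≤ j →
    Reals.seq Reals.γ i + Reals.logSum (suc n) j ≤ Reals.harmonic (suc n) + unit i
  γ-upper n i n≤i = _ , λ j J≤j → let s = Reals.logSum (suc n) j ; H = Reals.harmonic (suc n) in
    subst (Reals.seq Reals.γ i + s ≤_)
      (solve 3 (λ H s u → H :- s :+ u :+ s := H :+ u) refl H s (unit i))
      (ℚ.+-monoˡ-≤ s (ℚ.≤-trans (proj₂ (lim-upper Reals.gammaTerm Reals.gammaTerm-cauchy i) j J≤j)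
        (ℚ.+-monoˡ-≤ (unit i) (Reals.from (λ i → Reals.seq (Reals.gammaTerm i) j ≤ Reals.seq (Reals.gammaTerm n) j)
          (λ d → Reals.gammaTerm-decreasing n d j) n≤i))))

  -- From the harmonic number in the exponent to e^γ n.

  module _ (n : ℕ) {P : ℚ} (0≤P : 0ℚ ≤ P) (P≤1 : P ≤ 1ℚ)
           (exp-harmonic : ∀ k → exp k (Reals.harmonic (suc n)) * P ≤ 1ℚ) where
    open ℚ.≤-Reasoning

    0≤H : 0ℚ ≤ Reals.harmonic (suc n)
    0≤H = 0≤Σ (suc n) 0≤unit

    -- Here g stands for an entry of γ and τ for its error. With M = j + 1, `logSum (suc n) j` is
    -- the sum of the n M reciprocals after 1/M, so `exp-reciprocals` exchanges n + 1 for this sum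
    -- in the exponent, up to the factor (M + 1)/M = 1 + 1/M. The error τ in the exponent is paid
    -- for by 1 - τ through `exp-upper`.
    exp-approximant : ∀ {g τ} → 0ℚ ≤ g → 0ℚ ≤ τ → τ ≤ 1ℚ → ∀ k j →
      g + Reals.logSum (suc n) j ≤ Reals.harmonic (suc n) + τ →
      exp k g * P * ι (suc n) * (1ℚ - τ) ≤ 1ℚ + 1ℚ * unit j
    exp-approximant {g} {τ} 0≤g 0≤τ τ≤1 k j g+s≤H+τ = begin
      w                            ≡⟨ trans (cong (w *_) (ι-unit j)) (ℚ.*-identityʳ w) ⟨
      w * (ι M * unit j)           ≡⟨ solve 6 (λ e P c t M v → e :* P :* c :* t :* (M :* v) := e :* (c :* M) :* P :* t :* v) refl
                                        (exp k g) P (ι (suc n)) (1ℚ - τ) (ι M) (unit j) ⟩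
      exp k g * (ι (suc n) * ι M) * P * (1ℚ - τ) * unit j
        ≤⟨ *-monoʳ (0≤unit j) (*-monoʳ (0≤∸ τ≤1) (*-monoʳ 0≤P (*-monoˡ (0≤exp 0≤g k)
             (ℚ.≤-trans (ℚ.≤-reflexive (sym (ι-* (suc n) M))) (ι-≤ (ℕ.n≤1+n (suc n ℕ.* M))))))) ⟩
      exp k g * ι (suc M ℕ.+ l) * P * (1ℚ - τ) * unit j
        ≤⟨ *-monoʳ (0≤unit j) (*-monoʳ (0≤∸ τ≤1) (*-monoʳ 0≤P (exp-reciprocals 0≤g k M l))) ⟩
      exp (k ℕ.+ l) (g + s) * ι (suc M) * P * (1ℚ - τ) * unit j
        ≡⟨ solve 5 (λ e c P t v → e :* c :* P :* t :* v := e :* t :* (P :* (c :* v))) refl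
             (exp (k ℕ.+ l) (g + s)) (ι (suc M)) P (1ℚ - τ) (unit j) ⟩
      exp (k ℕ.+ l) (g + s) * (1ℚ - τ) * (P * (ι (suc M) * unit j))
        ≤⟨ *-monoʳ 0≤Pcv (*-monoʳ (0≤∸ τ≤1) (exp-mono (0≤+ 0≤g (0≤Σ l λ i → 0≤unit (M ℕ.+ i))) g+s≤H+τ (k ℕ.+ l))) ⟩
      exp (k ℕ.+ l) (H + τ) * (1ℚ - τ) * (P * (ι (suc M) * unit j))
        ≤⟨ *-monoʳ 0≤Pcv (exp-upper 0≤H 0≤τ (k ℕ.+ l)) ⟩
      exp (k ℕ.+ l) H * (P * (ι (suc M) * unit j))
        ≡⟨ ℚ.*-assoc (exp (k ℕ.+ l) H) P _ ⟨
      exp (k ℕ.+ l) H * P * (ι (suc M) * unit j)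
        ≤⟨ *-monoʳ (0≤* (0≤ι (suc M)) (0≤unit j)) (exp-harmonic (k ℕ.+ l)) ⟩
      1ℚ * (ι (suc M) * unit j)
        ≡⟨ trans (ℚ.*-identityˡ _) (trans (cong (_* unit j) (ι-suc M)) (trans (ℚ.*-distribʳ-+ (unit j) 1ℚ (ι M))
             (trans (cong (1ℚ * unit j +_) (ι-unit j)) (ℚ.+-comm (1ℚ * unit j) 1ℚ)))) ⟩
      1ℚ + 1ℚ * unit j ∎
      where
      M = suc j
      l = n ℕ.* M
      s = Reals.logSum (suc n) j
      H = Reals.harmonic (suc n)
      w = exp k g * P * ι (suc n) * (1ℚ - τ)
      0≤Pcv : 0ℚ ≤ P * (ι (suc M) * unit j)
      0≤Pcv = 0≤* 0≤P (0≤* (0≤ι (suc M)) (0≤unit j))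

    -- The mesh index j tends to infinity while k and i are fixed. The condition on i gives n ≤ i
    -- for `γ-upper` and `unit i` ≤ 1/2.
    exp-γ-approximant : ∀ k i → suc n ℕ.≤ i → exp k (Reals.seq Reals.γ i) * P * ι (suc n) ≤ 1ℚ + ι 2 * unit i
    exp-γ-approximant k i n<i = begin
      -- The bound 1/(1 - τ) ≤ 1 + 2τ for τ ≤ 1/2, in the form (1 - τ)(1 + 2τ) = 1 + τ (1 - 2τ).
      w                                      ≤⟨ p≤p+r w (0≤* 0≤w (0≤* (0≤unit i) (0≤∸ 2τ≤1))) ⟩
      w + w * (τ * (1ℚ - ι 2 * τ))           ≡⟨ solve 2 (λ w t → w :+ w :* (t :* (con 1ℚ :- con (ι 2) :* t)) := w :* (con 1ℚ :- t) :* (con 1ℚ :+ con (ι 2) :* t)) refl w τ ⟩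
      w * (1ℚ - τ) * (1ℚ + ι 2 * τ)          ≤⟨ *-monoʳ (0≤+ 0≤1 (0≤* (0≤ι 2) (0≤unit i)))
          (≤-limit {b = 1ℚ} 1ℚ (proj₁ γ-bound) λ j J≤j → exp-approximant (Reals.0≤γ i) (0≤unit i) (unit-antitone {0} {i} ℕ.z≤n) k j (proj₂ γ-bound j J≤j)) ⟩
      1ℚ * (1ℚ + ι 2 * τ)                    ≡⟨ ℚ.*-identityˡ _ ⟩
      1ℚ + ι 2 * τ                           ∎
      where
      τ = unit i
      γ-bound = γ-upper n i (ℕ.<⇒≤ n<i)
      w = exp k (Reals.seq Reals.γ i) * P * ι (suc n)
      0≤w : 0ℚ ≤ w
      0≤w = 0≤* (0≤* (0≤exp (Reals.0≤γ i) k) 0≤P) (0≤ι (suc n))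
      2τ≤1 : ι 2 * τ ≤ 1ℚ
      2τ≤1 = *-monoˡ (0≤ι 2) (unit-antitone (ℕ.≤-trans (s≤s ℕ.z≤n) n<i))

    e^γn : ℕ → ℚ
    e^γn = Reals.seq (Reals.exp Reals.γ Reals.* Reals.fromℕ (suc n))

    -- Entry k of `exp γ` is a value of E_k at some entry of γ; `lim-upper` replaces that entry by a
    -- late entry i at the cost of 1/(k + 1), and i tends to infinity. As P ≤ 1, the cost remains at
    -- most (n + 1)/(k + 1).
    e^γn-bound : ∀ k → P * e^γn k ≤ 1ℚ + ι (suc n) * unit k
    e^γn-bound k = ≤-limit (ι 2) (suc n ℕ.⊔ I) λ i hi → let E = exp k (Reals.seq Reals.γ i) in begin
      P * e^γn k                                  ≤⟨ *-monoˡ 0≤P (*-monoʳ (0≤ι (suc n)) (ℚ.≤-trans (proj₂ near i (ℕ.m⊔n≤o⇒n≤o (suc n) I hi))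
                                                       (ℚ.≤-reflexive (cong (_+ unit k) (expSum-exp Reals.γ k i))))) ⟩
      P * ((E + unit k) * ι (suc n))              ≡⟨ solve 4 (λ P E u c → P :* ((E :+ u) :* c) := E :* P :* c :+ P :* (c :* u)) refl P E (unit k) (ι (suc n)) ⟩
      E * P * ι (suc n) + P * (ι (suc n) * unit k) ≤⟨ ℚ.+-mono-≤ (exp-γ-approximant k i (ℕ.m⊔n≤o⇒m≤o (suc n) I hi))
                                                       (ℚ.≤-trans (*-monoʳ (0≤* (0≤ι (suc n)) (0≤unit k)) P≤1) (ℚ.≤-reflexive (ℚ.*-identityˡ _))) ⟩
      1ℚ + ι 2 * unit i + ι (suc n) * unit k      ≡⟨ solve 3 (λ a b c → a :+ b :+ c := a :+ c :+ b) refl 1ℚ (ι 2 * unit i) (ι (suc n) * unit k) ⟩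
      1ℚ + ι (suc n) * unit k + ι 2 * unit i      ∎
      where
      near = lim-upper (Reals.expSum Reals.γ) (Reals.expSum-cauchy Reals.γ) k
      I = proj₁ near

    1≤e^γn : ∀ k → 1ℚ ≤ e^γn (suc k)
    1≤e^γn k = *-mono {1ℚ} {_} {1ℚ} 0≤1 (0≤ι (suc n)) (Reals.1≤expSum {Reals.γ} Reals.0≤γ k _) (ι-≤ {1} {suc n} (s≤s z≤n))

    ≤1/e^γn : Reals.fromℚ P Reals.≤ ((Reals.exp Reals.γ Reals.* Reals.fromℕ (suc n)) Reals.⁻¹) {{Reals.e^γn-positive (suc n)}}
    -- Entry 0 of `e^γn` comes from an empty sum and is 0, so only indices `suc k` are treated. The
    -- threshold gives (n + 1)/(k + 1) ≤ 1/(d + 1) ≤ ε.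
    ≤1/e^γn {ε} 0<ε = suc (n ℕ.+ d ℕ.* suc n) , λ { {suc k} (s≤s hk) → bound k hk }
      where
      d = proj₁ (archimedean 0<ε)
      d≤ε = proj₂ (archimedean 0<ε)
      bound : ∀ k → n ℕ.+ d ℕ.* suc n ℕ.≤ k → P ≤ inverse (e^γn (suc k)) + ε
      bound k hk = begin
        P                              ≡⟨ trans (cong (P *_) (inverse-* 0<z)) (ℚ.*-identityʳ P) ⟨
        P * (z⁻¹ * z)                  ≡⟨ solve 3 (λ P y z → P :* (y :* z) := P :* z :* y) refl P z⁻¹ z ⟩
        P * z * z⁻¹                    ≤⟨ *-monoʳ (0≤inverse 0<z) (e^γn-bound (suc k)) ⟩
        (1ℚ + c) * z⁻¹                 ≡⟨ solve 2 (λ c y → (con 1ℚ :+ c) :* y := y :+ c :* y) refl c z⁻¹ ⟩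
        z⁻¹ + c * z⁻¹                  ≤⟨ ℚ.+-monoʳ-≤ z⁻¹ (ℚ.≤-trans (*-monoˡ (0≤* (0≤ι (suc n)) (0≤unit (suc k))) (inverse-≤ (0<unit 0) (1≤e^γn k))) (ℚ.≤-reflexive (ℚ.*-identityʳ c))) ⟩
        z⁻¹ + c                        ≤⟨ ℚ.+-monoʳ-≤ z⁻¹ (ℚ.≤-trans (*-monoˡ (0≤ι (suc n)) (unit-antitone (ℕ.≤-trans hk (ℕ.n≤1+n k))))
                                            (ℚ.≤-trans (ℚ.≤-reflexive (Reals.ι*unit n d)) d≤ε)) ⟩
        z⁻¹ + ε                        ∎
        where
        z = e^γn (suc k)
        0<z = ℚ.<-≤-trans (0<unit 0) (1≤e^γn k)
        z⁻¹ = inverse z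
        c = ι (suc n) * unit (suc k)

-- Indicators, positive linear functionals and summation by parts.

module Averages where
  open Rationals
  open RationalBounds
  open import Data.Rational.Base using (_+_; _*_; _≤_)
  open ≡ using (refl; sym; trans; cong; subst)
  open +-*-Solver using (solve; _:=_; _:+_; _:*_; con)

  𝟙 : Dec A → ℚ
  𝟙 (yes _) = 1ℚ
  𝟙 (no _)  = 0ℚ

  0≤𝟙 : (A? : Dec A) → 0ℚ ≤ 𝟙 A?
  0≤𝟙 (yes _) = 0≤1
  0≤𝟙 (no _)  = ℚ.≤-refl

  𝟙≤1 : (A? : Dec A) → 𝟙 A? ≤ 1ℚ
  𝟙≤1 (yes _) = ℚ.≤-refl
  𝟙≤1 (no _)  = 0≤1

  𝟙-mono : (A → B) → (A? : Dec A) (B? : Dec B) → 𝟙 A? ≤ 𝟙 B?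
  𝟙-mono f (yes a) (yes b) = ℚ.≤-refl
  𝟙-mono f (yes a) (no ¬b) = ⊥-elim (¬b (f a))
  𝟙-mono f (no ¬a) B?      = 0≤𝟙 B?

  𝟙-count : ∀ {A : ℕ → Set a} (A? : ∀ k → Dec (A k)) e K → e ℕ.≤ K → (∀ k → k ℕ.< e → A k) →
    ι e ≤ Σ[ K ] (λ k → 𝟙 (A? k))
  𝟙-count A? e zero z≤n h = ℚ.≤-refl
  𝟙-count A? e (suc K) e≤K h with ℕ.m≤n⇒m<n∨m≡n e≤K
  ... | inj₁ (s≤s e≤K′) = ℚ.≤-trans (𝟙-count A? e K e≤K′ h) (p≤p+r _ (0≤𝟙 (A? K)))
  ... | inj₂ refl = ℚ.≤-trans (ℚ.≤-reflexive (trans (ι-suc K) (ℚ.+-comm 1ℚ (ι K))))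
    (ℚ.+-mono-≤ (𝟙-count A? K K ℕ.≤-refl λ k k<K → h k (ℕ.m<n⇒m<1+n k<K)) (1≤𝟙 (A? K) (h K ℕ.≤-refl)))
    where
    1≤𝟙 : (A? : Dec A) → A → 1ℚ ≤ 𝟙 A?
    1≤𝟙 (yes _) _ = ℚ.≤-refl
    1≤𝟙 (no ¬a) a = ⊥-elim (¬a a)

  Σ-scale : ∀ n f c → Σ[ n ] (λ i → f i * c) ≡ Σ[ n ] f * c
  Σ-scale zero    f c = sym (ℚ.*-zeroˡ c)
  Σ-scale (suc n) f c = trans (cong (_+ f n * c) (Σ-scale n f c)) (sym (ℚ.*-distribʳ-+ c (Σ[ n ] f) (f n)))

  ∑-mono : ∀ (xs : List A) {f g} → (∀ x → f x ≤ g x) → ∑ xs f ≤ ∑ xs g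
  ∑-mono []       h = ℚ.≤-refl
  ∑-mono (x ∷ xs) h = ℚ.+-mono-≤ (h x) (∑-mono xs h)

  -- Summation by parts and averaging over polynomials are both functionals of this kind, so their
  -- interchange with the double sum over p and k is proved once.
  record PositiveLinear {X : Set a} (φ : (X → ℚ) → ℚ) : Set a where
    field
      mono  : ∀ {f g} → (∀ x → f x ≤ g x) → φ f ≤ φ g
      add   : ∀ f g → φ (λ x → f x + g x) ≡ φ f + φ g
      scale : ∀ f c → φ (λ x → f x * c) ≡ φ f * c

    zero-function : φ (λ _ → 0ℚ) ≡ 0ℚ
    zero-function = trans (scale (λ _ → 0ℚ) 0ℚ) (ℚ.*-zeroʳ (φ λ _ → 0ℚ))

    Σ-commute : ∀ n (f : ℕ → X → ℚ) → φ (λ x → Σ[ n ] (λ k → f k x)) ≡ Σ[ n ] (λ k → φ (f k))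
    Σ-commute zero    f = zero-function
    Σ-commute (suc n) f = trans (add (λ x → Σ[ n ] (λ k → f k x)) (f n)) (cong (_+ φ (f n)) (Σ-commute n f))

    ∑-commute : ∀ (ps : List A) (f : A → X → ℚ) → φ (λ x → ∑ ps (λ p → f p x)) ≡ ∑ ps (λ p → φ (f p))
    ∑-commute []       f = zero-function
    ∑-commute (p ∷ ps) f = trans (add (f p) (λ x → ∑ ps (λ p → f p x))) (cong (φ (f p) +_) (∑-commute ps f))

    ∑Σ-bound : ∀ (ps : List A) n (f : A → ℕ → X → ℚ) {g : A → ℕ → ℚ} → (∀ p k → φ (f p k) ≤ g p k) →
      φ (λ x → ∑ ps (λ p → Σ[ n ] (λ k → f p k x))) ≤ ∑ ps (λ p → Σ[ n ] (g p))
    ∑Σ-bound ps n f h = ℚ.≤-trans (ℚ.≤-reflexive (∑-commute ps λ p x → Σ[ n ] (λ k → f p k x)))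
      (∑-mono ps λ p → ℚ.≤-trans (ℚ.≤-reflexive (Σ-commute n (f p))) (Σ-≤ n λ k _ → h p k))

  -- If T(m) is the m-th partial sum of t(1) + t(2) + …, summation by parts gives Σ t(j)/j over j ≤ n + 1 as
  -- T(n + 1)/(n + 1) + Σ T(m)/(m (m + 1)) over 1 ≤ m ≤ n.
  byParts : ℕ → (ℕ → ℚ) → ℚ
  byParts n T = Σ[ n ] (λ i → unit i * unit (suc i) * T (suc i)) + unit n * T (suc n)

  byParts-mono : ∀ n S T → (∀ m → m ℕ.≤ n → S (suc m) ≤ T (suc m)) → byParts n S ≤ byParts n T
  byParts-mono n S T h = ℚ.+-mono-≤
    (Σ-≤ n λ i i<n → *-monoˡ (0≤* (0≤unit i) (0≤unit (suc i))) (h i (ℕ.<⇒≤ i<n)))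
    (*-monoˡ (0≤unit n) (h n ℕ.≤-refl))

  byParts-linear : ∀ n → PositiveLinear (byParts n)
  byParts-linear n = record
    { mono  = λ {S} {T} h → byParts-mono n S T λ m _ → h (suc m)
    ; add   = λ S T → trans (≡.cong₂ _+_ (Σ-add n S T) (ℚ.*-distribˡ-+ (unit n) (S (suc n)) (T (suc n))))
        (solve 4 (λ a b c d → (a :+ b) :+ (c :+ d) := (a :+ c) :+ (b :+ d)) refl
          (Σ[ n ] (λ i → w i * S (suc i))) (Σ[ n ] (λ i → w i * T (suc i))) (unit n * S (suc n)) (unit n * T (suc n)))
    ; scale = λ T c → trans (≡.cong₂ _+_ (trans (Σ-≡ n λ i → sym (ℚ.*-assoc (w i) (T (suc i)) c)) (Σ-scale n (λ i → w i * T (suc i)) c)) (sym (ℚ.*-assoc (unit n) (T (suc n)) c)))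
        (sym (ℚ.*-distribʳ-+ c (Σ[ n ] (λ i → w i * T (suc i))) (unit n * T (suc n))))
    }
    where
    w : ℕ → ℚ
    w i = unit i * unit (suc i)
    Σ-add : ∀ n S T → Σ[ n ] (λ i → w i * (S (suc i) + T (suc i))) ≡ Σ[ n ] (λ i → w i * S (suc i)) + Σ[ n ] (λ i → w i * T (suc i))
    Σ-add zero    S T = refl
    Σ-add (suc n) S T = trans (cong (_+ w n * (S (suc n) + T (suc n))) (Σ-add n S T))
      (solve 5 (λ a b w s t → (a :+ b) :+ w :* (s :+ t) := (a :+ w :* s) :+ (b :+ w :* t)) refl
        (Σ[ n ] (λ i → w i * S (suc i))) (Σ[ n ] (λ i → w i * T (suc i))) (w n) (S (suc n)) (T (suc n)))

  unit*ι : ∀ n → unit n * ι (suc n) ≡ 1ℚ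
  unit*ι n = trans (ℚ.*-comm (unit n) (ι (suc n))) (ι-unit n)

  -- The case t(j) = 1, where T(m) = m.
  byParts-ι : ∀ n → byParts n ι ≡ Reals.harmonic (suc n)
  byParts-ι n = trans (≡.cong₂ _+_ (Σ-≡ n λ i → trans
      (solve 3 (λ u v c → u :* v :* c := u :* c :* v) refl (unit i) (unit (suc i)) (ι (suc i)))
      (trans (cong (_* unit (suc i)) (unit*ι i)) (ℚ.*-identityˡ _))) (unit*ι n))
    (shift n)
    where
    shift : ∀ n → Σ[ n ] (λ i → unit (suc i)) + 1ℚ ≡ Reals.harmonic (suc n)
    shift zero    = refl
    shift (suc n) = trans (solve 2 (λ s u → s :+ u :+ con 1ℚ := s :+ con 1ℚ :+ u) refl (Σ[ n ] (λ i → unit (suc i))) (unit (suc n)))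
      (cong (_+ unit (suc n)) (shift n))

  -- Here t is the unit mass at j + 1, so the value is 1/(j + 1) or 0. Once the mass has been
  -- passed, 1/((n+1)(n+2)) + 1/(n+2) = 1/(n+1) keeps the value constant in n.
  byParts-step : ∀ n j → byParts n (λ m → 𝟙 (suc j ℕ.≤? m)) ≤ unit j
  byParts-step n j = ℚ.≤-trans (go n) (ℚ.≤-trans (*-monoʳ (0≤unit j) (𝟙≤1 (suc j ℕ.≤? suc n))) (ℚ.≤-reflexive (ℚ.*-identityˡ _)))
    where
    open ℚ.≤-Reasoning
    s : ℕ → ℚ
    s n = Σ[ n ] (λ i → unit i * unit (suc i) * 𝟙 (suc j ℕ.≤? suc i))
    go : ∀ n → s n + unit n * 𝟙 (suc j ℕ.≤? suc n) ≤ 𝟙 (suc j ℕ.≤? suc n) * unit j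
    go zero with suc j ℕ.≤? 1
    ... | yes (s≤s z≤n) = ℚ.≤-refl
    ... | no _          = ℚ.≤-reflexive (sym (ℚ.*-zeroˡ (unit j)))
    go (suc n) with suc j ℕ.≤? suc n | suc j ℕ.≤? suc (suc n) | go n
    ... | yes j≤n | no j≰n  | _  = ⊥-elim (j≰n (ℕ.m≤n⇒m≤1+n j≤n))
    ... | yes _   | yes _   | ih = begin
      s n + u * v * 1ℚ + v * 1ℚ        ≡⟨ solve 3 (λ s u v → s :+ u :* v :* con 1ℚ :+ v :* con 1ℚ := s :+ (v :* u :+ v)) refl (s n) u v ⟩
      s n + (v * u + v)                ≡⟨ cong (s n +_) (trans (cong (v * u +_) (trans (sym (ℚ.*-identityʳ v)) (cong (v *_) (sym (ι-unit n)))))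
                                           (trans (solve 3 (λ u v c → v :* u :+ v :* (c :* u) := (con 1ℚ :+ c) :* v :* u) refl u v (ι (suc n))) ([1+k]*unit (suc n) u))) ⟩
      s n + u                          ≡⟨ cong (s n +_) (ℚ.*-identityʳ u) ⟨
      s n + u * 1ℚ                     ≤⟨ ih ⟩
      1ℚ * unit j                      ∎
      where
      u = unit n
      v = unit (suc n)
    ... | no j≰n  | yes j≤1+n | ih = begin
      s n + u * v * 0ℚ + v * 1ℚ        ≡⟨ solve 3 (λ s u v → s :+ u :* v :* con 0ℚ :+ v :* con 1ℚ := s :+ u :* con 0ℚ :+ v) refl (s n) u v ⟩
      s n + u * 0ℚ + v                 ≤⟨ ℚ.+-monoˡ-≤ v ih ⟩
      0ℚ * unit j + v                  ≡⟨ trans (cong (_+ v) (ℚ.*-zeroˡ (unit j))) (ℚ.+-identityˡ v) ⟩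
      v                                ≡⟨ cong unit (ℕ.≤-antisym (ℕ.≤-pred (ℕ.≰⇒> j≰n)) (ℕ.≤-pred j≤1+n)) ⟩
      unit j                           ≡⟨ ℚ.*-identityˡ (unit j) ⟨
      1ℚ * unit j                      ∎
      where
      u = unit n
      v = unit (suc n)
    ... | no _    | no _    | ih = begin
      s n + u * v * 0ℚ + v * 0ℚ        ≡⟨ solve 3 (λ s u v → s :+ u :* v :* con 0ℚ :+ v :* con 0ℚ := s :+ u :* con 0ℚ) refl (s n) u v ⟩
      s n + u * 0ℚ                     ≤⟨ ih ⟩
      0ℚ * unit j                      ∎
      where
      u = unit n
      v = unit (suc n)

  -- `byParts` has nonnegative weights, so it may be applied to both sides as functions of m. The
  -- step function that jumps at (k + 1) d p yields at most 1/((k + 1) d p); the weight d p cancels,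
  -- and the term of `logSeries` remains.
  harmonic≤∑-logSeries : ∀ n (ps : List A) (d : A → ℕ) (y : A → ℚ) → (∀ p → 0ℚ ≤ y p) →
    (∀ m → m ℕ.≤ n → ι (suc m) ≤ ∑ ps λ p → Σ[ suc n ] λ k → 𝟙 (suc k ℕ.* d p ℕ.≤? suc m) * (ι (d p) * y p ^ suc k)) →
    Reals.harmonic (suc n) ≤ ∑ ps (λ p → logSeries (suc n) (y p))
  harmonic≤∑-logSeries n ps d y 0≤y h = begin
    Reals.harmonic (suc n)  ≡⟨ byParts-ι n ⟨
    byParts n ι             ≤⟨ byParts-mono n ι T h ⟩
    byParts n T
                            ≤⟨ ∑Σ-bound ps (suc n) (λ p k m → 𝟙 (suc k ℕ.* d p ℕ.≤? m) * (ι (d p) * y p ^ suc k)) (λ p k → term (d p) k (0≤^ (0≤y p) (suc k))) ⟩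
    ∑ ps (λ p → logSeries (suc n) (y p)) ∎
    where
    open ℚ.≤-Reasoning
    open PositiveLinear (byParts-linear n)
    T : ℕ → ℚ
    T = λ m → ∑ ps λ p → Σ[ suc n ] λ k → 𝟙 (suc k ℕ.* d p ℕ.≤? m) * (ι (d p) * y p ^ suc k)
    term : ∀ d k {z} → 0ℚ ≤ z → byParts n (λ m → 𝟙 (suc k ℕ.* d ℕ.≤? m) * (ι d * z)) ≤ z * unit k
    term zero k {z} 0≤z = begin
      byParts n (λ m → 𝟙 (suc k ℕ.* 0 ℕ.≤? m) * (0ℚ * z))  ≡⟨ scale (λ m → 𝟙 (suc k ℕ.* 0 ℕ.≤? m)) (0ℚ * z) ⟩
      byParts n (λ m → 𝟙 (suc k ℕ.* 0 ℕ.≤? m)) * (0ℚ * z)  ≡⟨ trans (cong (byParts n (λ m → 𝟙 (suc k ℕ.* 0 ℕ.≤? m)) *_) (ℚ.*-zeroˡ z)) (ℚ.*-zeroʳ (byParts n (λ m → 𝟙 (suc k ℕ.* 0 ℕ.≤? m)))) ⟩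
      0ℚ                                                    ≤⟨ 0≤* 0≤z (0≤unit k) ⟩
      z * unit k                                            ∎
    term (suc e) k {z} 0≤z = begin
      byParts n (λ m → 𝟙 (suc k ℕ.* suc e ℕ.≤? m) * (ι (suc e) * z))  ≡⟨ scale (λ m → 𝟙 (suc k ℕ.* suc e ℕ.≤? m)) (ι (suc e) * z) ⟩
      byParts n (λ m → 𝟙 (suc j ℕ.≤? m)) * (ι (suc e) * z)  ≤⟨ *-monoʳ (0≤* (0≤ι (suc e)) 0≤z) (byParts-step n j) ⟩
      unit j * (ι (suc e) * z)                              ≡⟨ solve 3 (λ u c z → u :* (c :* z) := z :* (c :* u)) refl (unit j) (ι (suc e)) z ⟩
      z * (ι (suc e) * unit j)                              ≡⟨ cong (z *_) (Reals.ι*unit e k) ⟩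
      z * unit k                                            ∎
      where j = e ℕ.+ k ℕ.* suc e

  -- Averages over vectors of codes.

  sumFin : ∀ n → (Fin n → ℚ) → ℚ
  sumFin zero    f = 0ℚ
  sumFin (suc n) f = f zero + sumFin n (λ i → f (suc i))

  sumFin-linear : ∀ n → PositiveLinear (sumFin n)
  sumFin-linear n = record { mono = go n ; add = add n ; scale = scale n }
    where
    go : ∀ n {f g} → (∀ i → f i ≤ g i) → sumFin n f ≤ sumFin n g
    go zero    h = ℚ.≤-refl
    go (suc n) h = ℚ.+-mono-≤ (h zero) (go n λ i → h (suc i))
    add : ∀ n f g → sumFin n (λ i → f i + g i) ≡ sumFin n f + sumFin n g
    add zero    f g = refl
    add (suc n) f g = trans (cong (f zero + g zero +_) (add n (λ i → f (suc i)) (λ i → g (suc i))))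
      (solve 4 (λ a b c d → (a :+ b) :+ (c :+ d) := (a :+ c) :+ (b :+ d)) refl
        (f zero) (g zero) (sumFin n (λ i → f (suc i))) (sumFin n (λ i → g (suc i))))
    scale : ∀ n f c → sumFin n (λ i → f i * c) ≡ sumFin n f * c
    scale zero    f c = sym (ℚ.*-zeroˡ c)
    scale (suc n) f c = trans (cong (f zero * c +_) (scale n (λ i → f (suc i)) c))
      (sym (ℚ.*-distribʳ-+ c (f zero) (sumFin n (λ i → f (suc i)))))

  sumFin-const : ∀ n c → sumFin n (λ _ → c) ≡ ι n * c
  sumFin-const zero    c = sym (ℚ.*-zeroˡ c)
  sumFin-const (suc n) c = trans (cong (c +_) (sumFin-const n c))
    (trans (solve 2 (λ n c → c :+ n :* c := (con 1ℚ :+ n) :* c) refl (ι n) c) (cong (_* c) (sym (ι-suc n))))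

  sumFin-none : ∀ n {P : Fin n → Set a} (P? : ∀ i → Dec (P i)) → (∀ i → ¬ P i) → sumFin n (λ i → 𝟙 (P? i)) ≡ 0ℚ
  sumFin-none zero    P? none = refl
  sumFin-none (suc n) P? none with P? zero
  ... | yes p = ⊥-elim (none zero p)
  ... | no _  = trans (ℚ.+-identityˡ _) (sumFin-none n (λ i → P? (suc i)) (λ i → none (suc i)))

  sumFin-unique : ∀ n {P : Fin n → Set a} (P? : ∀ i → Dec (P i)) → (∀ i j → P i → P j → i ≡ j) →
    sumFin n (λ i → 𝟙 (P? i)) ≤ 1ℚ
  sumFin-unique zero    P? unique = 0≤1
  sumFin-unique (suc n) P? unique with P? zero
  ... | yes p = ℚ.≤-reflexive (cong (1ℚ +_) (sumFin-none n (λ i → P? (suc i)) λ i pᵢ → Fin.0≢1+n (unique zero (suc i) p pᵢ)))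
  ... | no _  = ℚ.≤-trans (ℚ.≤-reflexive (ℚ.+-identityˡ _))
    (sumFin-unique n (λ i → P? (suc i)) λ i j p r → Fin.suc-injective (unique (suc i) (suc j) p r))

  sumFin-any : ∀ n {P : Fin n → Set a} (P? : ∀ i → Dec (P i)) → (∀ i j → P i → P j → i ≡ j) →
    sumFin n (λ i → 𝟙 (P? i)) ≤ 𝟙 (Fin.any? P?)
  sumFin-any n P? unique with Fin.any? P?
  ... | yes _   = sumFin-unique n P? unique
  ... | no none = ℚ.≤-reflexive (sumFin-none n P? λ i p → none (i , p))

  -- Vectors list coefficients from the constant term upwards, so agreement after the first e
  -- entries means that the monic polynomials differ by a polynomial of degree below e.
  Agree : ∀ e {m} {A : Set a} → Vec A (e ℕ.+ m) → Vec A (e ℕ.+ m) → Set a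
  Agree zero    v       w       = v ≡ w
  Agree (suc e) (_ ∷ v) (_ ∷ w) = Agree e v w

  Agree-refl : ∀ e {m} (v : Vec A (e ℕ.+ m)) → Agree e v v
  Agree-refl zero    v       = refl
  Agree-refl (suc e) (_ ∷ v) = Agree-refl e v

  module Average (q : ℕ) (r : ℚ) (0≤r : 0ℚ ≤ r) (q*r≡1 : ι q * r ≡ 1ℚ) where

    -- The mean over all vectors, with r = 1/q. The head is averaged innermost, for a fixed tail, as
    -- the induction in `average-determined` requires.
    average : ∀ m → (Vec (Fin q) m → ℚ) → ℚ
    average zero    f = f []
    average (suc m) f = average m λ v → sumFin q (λ i → f (i ∷ v)) * r

    average-linear : ∀ m → PositiveLinear (average m)
    average-linear m = record { mono = mono m ; add = add m ; scale = scale m }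
      where
      module S = PositiveLinear (sumFin-linear q)
      mono : ∀ m {f g} → (∀ v → f v ≤ g v) → average m f ≤ average m g
      mono zero    h = h []
      mono (suc m) h = mono m λ v → *-monoʳ 0≤r (S.mono λ i → h (i ∷ v))
      ext : ∀ m {f g} → (∀ v → f v ≡ g v) → average m f ≡ average m g
      ext m h = ℚ.≤-antisym (mono m λ v → ℚ.≤-reflexive (h v)) (mono m λ v → ℚ.≤-reflexive (sym (h v)))
      add : ∀ m f g → average m (λ v → f v + g v) ≡ average m f + average m g
      add zero    f g = refl
      add (suc m) f g = trans (ext m λ v → trans (cong (_* r) (S.add (λ i → f (i ∷ v)) (λ i → g (i ∷ v)))) (ℚ.*-distribʳ-+ r (sumFin q (λ i → f (i ∷ v))) (sumFin q (λ i → g (i ∷ v)))))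
        (add m (λ v → sumFin q (λ i → f (i ∷ v)) * r) (λ v → sumFin q (λ i → g (i ∷ v)) * r))
      scale : ∀ m f c → average m (λ v → f v * c) ≡ average m f * c
      scale zero    f c = refl
      scale (suc m) f c = trans (ext m λ v → trans (cong (_* r) (S.scale (λ i → f (i ∷ v)) c))
        (solve 3 (λ s c r → s :* c :* r := s :* r :* c) refl (sumFin q (λ i → f (i ∷ v))) c r))
        (scale m (λ v → sumFin q (λ i → f (i ∷ v)) * r) c)

    average-const : ∀ m c → average m (λ _ → c) ≡ c
    average-const zero    c = refl
    average-const (suc m) c = trans (cong (λ w → average m λ _ → w) (trans (cong (_* r) (sumFin-const q c))
      (trans (solve 3 (λ n c r → n :* c :* r := n :* r :* c) refl (ι q) c r) (trans (cong (_* c) q*r≡1) (ℚ.*-identityˡ c)))))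
      (average-const m c)

    -- For a fixed tail at most one head satisfies P, so averaging over the head leaves r times the
    -- indicator that some head does. That event on tails is determined in the same sense with e - 1
    -- free entries.
    average-determined : ∀ e m {P : Vec (Fin q) (e ℕ.+ m) → Set a} (P? : ∀ v → Dec (P v)) →
      (∀ v w → Agree e v w → P v → P w → v ≡ w) → average (e ℕ.+ m) (λ v → 𝟙 (P? v)) ≤ r ^ e
    average-determined zero m P? _ =
      ℚ.≤-trans (PositiveLinear.mono (average-linear m) λ v → 𝟙≤1 (P? v)) (ℚ.≤-reflexive (average-const m 1ℚ))
    average-determined (suc e) m P? determined = begin
      average (e ℕ.+ m) (λ v → sumFin q (λ i → 𝟙 (P? (i ∷ v))) * r)
        ≤⟨ L.mono (λ v → *-monoʳ 0≤r (sumFin-any q (λ i → P? (i ∷ v)) λ i j p p′ →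
             cong Vec.head (determined (i ∷ v) (j ∷ v) (Agree-refl e v) p p′))) ⟩
      average (e ℕ.+ m) (λ v → 𝟙 (Fin.any? λ i → P? (i ∷ v)) * r)
        ≡⟨ L.scale (λ v → 𝟙 (Fin.any? λ i → P? (i ∷ v))) r ⟩
      average (e ℕ.+ m) (λ v → 𝟙 (Fin.any? λ i → P? (i ∷ v))) * r
        ≤⟨ *-monoʳ 0≤r (average-determined e m (λ v → Fin.any? λ i → P? (i ∷ v)) λ v w agree (i , p) (j , p′) →
             cong Vec.tail (determined (i ∷ v) (j ∷ w) agree p p′)) ⟩
      r ^ e * r
        ≡⟨ ℚ.*-comm (r ^ e) r ⟩
      r * r ^ e ∎
      where
      open ℚ.≤-Reasoning
      module L = PositiveLinear (average-linear (e ℕ.+ m))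

-- Arithmetic and divisibility of polynomials over a commutative ring.

module PolynomialProperties {c ℓ} (R : CommutativeRing c ℓ) where
  open CommutativeRing R
  open Polynomial R
  open SetoidReasoning setoid
  open import Algebra.Properties.CommutativeSemigroup +-commutativeSemigroup using (interchange)

  -- A record, so that p and r can be inferred from a proof of p ≋ r.
  infix 4 _≋_
  record _≋_ (p r : Poly) : Set ℓ where
    constructor pointwise
    field at : p ≈ₚ r

  open _≋_ public

  polySetoid : Setoid c ℓ
  polySetoid = record
    { Carrier       = Poly
    ; _≈_           = _≋_
    ; isEquivalence = record
      { refl  = pointwise λ i → refl
      ; sym   = λ e → pointwise λ i → sym (at e i)
      ; trans = λ e f → pointwise λ i → trans (at e i) (at f i)
      }
    }

  module ≋ = Setoid polySetoid

  *ₚ-congˡ : ∀ p {r s} → r ≋ s → p *ₚ r ≋ p *ₚ s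
  *ₚ-congˡ p {r} {s} e = pointwise (*ₚ-cong {p} {p} {r} {s} (λ i → refl) (at e))

  *ₚ-congʳ : ∀ s {p r} → p ≋ r → p *ₚ s ≋ r *ₚ s
  *ₚ-congʳ s {p} {r} e = pointwise (*ₚ-cong {p} {r} {s} {s} (at e) (λ i → refl))

  -- Mirror image of `coeff-*-suc`, splitting off the constant term of the second factor; together
  -- they give commutativity by induction on the index.
  coeff-*-suc′ : ∀ p r i →
    coeff (p *ₚ r) (suc i) ≈ coeff (p *ₚ tail r) i + coeff r 0 * coeff p (suc i)
  coeff-*-suc′ p r zero = begin
    coeff (p *ₚ r) 1                                          ≈⟨ coeff-*-suc p r 0 ⟩
    coeff p 0 * coeff r 1 + coeff (tail p *ₚ r) 0             ≈⟨ +-cong (*-congˡ (reflexive (≡.sym (coeff-tail r 0)))) (coeff-*-zero (tail p) r) ⟩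
    coeff p 0 * coeff (tail r) 0 + coeff (tail p) 0 * coeff r 0 ≈⟨ +-cong (sym (coeff-*-zero p (tail r))) (trans (*-comm _ _) (*-congˡ (reflexive (coeff-tail p 0)))) ⟩
    coeff (p *ₚ tail r) 0 + coeff r 0 * coeff p 1             ∎
  coeff-*-suc′ p r (suc i) = begin
    coeff (p *ₚ r) (suc (suc i))                              ≈⟨ coeff-*-suc p r (suc i) ⟩
    coeff p 0 * coeff r (suc (suc i)) + coeff (tail p *ₚ r) (suc i)
      ≈⟨ +-cong (*-congˡ (reflexive (≡.sym (coeff-tail r (suc i))))) (coeff-*-suc′ (tail p) r i) ⟩
    coeff p 0 * coeff (tail r) (suc i) + (coeff (tail p *ₚ tail r) i + coeff r 0 * coeff (tail p) (suc i))
      ≈⟨ +-assoc _ _ _ ⟨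
    coeff p 0 * coeff (tail r) (suc i) + coeff (tail p *ₚ tail r) i + coeff r 0 * coeff (tail p) (suc i)
      ≈⟨ +-cong (sym (coeff-*-suc p (tail r) i)) (*-congˡ (reflexive (coeff-tail p (suc i)))) ⟩
    coeff (p *ₚ tail r) (suc i) + coeff r 0 * coeff p (suc (suc i)) ∎

  *ₚ-comm : ∀ p r → p *ₚ r ≋ r *ₚ p
  *ₚ-comm p r = pointwise (go p r)
    where
    go : ∀ p r → p *ₚ r ≈ₚ r *ₚ p
    go p r zero    = trans (coeff-*-zero p r) (trans (*-comm _ _) (sym (coeff-*-zero r p)))
    go p r (suc i) = trans (coeff-*-suc′ p r i)
      (trans (+-congʳ (go p (tail r) i)) (trans (+-comm _ _) (sym (coeff-*-suc r p i))))

  -- Stated through coefficients to serve two purposes: the recursion of `_*ₚ_` in `*ₚ-assoc` and,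
  -- with a = -1, the difference of two multiples of g in `divisible-determined`.
  *ₚ-linear : ∀ a {t p s} → (∀ i → coeff t i ≈ coeff p i + a * coeff s i) → ∀ r i →
    coeff (t *ₚ r) i ≈ coeff (p *ₚ r) i + a * coeff (s *ₚ r) i
  *ₚ-linear a {t} {p} {s} e r zero = begin
    coeff (t *ₚ r) 0                                      ≈⟨ coeff-*-zero t r ⟩
    coeff t 0 * coeff r 0                                 ≈⟨ *-congʳ (e 0) ⟩
    (coeff p 0 + a * coeff s 0) * coeff r 0               ≈⟨ distribʳ _ _ _ ⟩
    coeff p 0 * coeff r 0 + a * coeff s 0 * coeff r 0     ≈⟨ +-cong (sym (coeff-*-zero p r)) (trans (*-assoc _ _ _) (*-congˡ (sym (coeff-*-zero s r)))) ⟩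
    coeff (p *ₚ r) 0 + a * coeff (s *ₚ r) 0               ∎
  *ₚ-linear a {t} {p} {s} e r (suc i) = begin
    coeff (t *ₚ r) (suc i)                                          ≈⟨ coeff-*-suc t r i ⟩
    coeff t 0 * ρ + coeff (tail t *ₚ r) i
      ≈⟨ +-cong (trans (*-congʳ (e 0)) (distribʳ _ _ _)) (*ₚ-linear a {tail t} {tail p} {tail s} tails r i) ⟩
    (coeff p 0 * ρ + a * coeff s 0 * ρ) + (coeff (tail p *ₚ r) i + a * coeff (tail s *ₚ r) i)
      ≈⟨ interchange _ _ _ _ ⟩
    (coeff p 0 * ρ + coeff (tail p *ₚ r) i) + (a * coeff s 0 * ρ + a * coeff (tail s *ₚ r) i)
      ≈⟨ +-cong (sym (coeff-*-suc p r i)) (trans (+-congʳ (*-assoc _ _ _)) (sym (distribˡ _ _ _))) ⟩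
    coeff (p *ₚ r) (suc i) + a * (coeff s 0 * ρ + coeff (tail s *ₚ r) i)
      ≈⟨ +-congˡ (*-congˡ (sym (coeff-*-suc s r i))) ⟩
    coeff (p *ₚ r) (suc i) + a * coeff (s *ₚ r) (suc i)             ∎
    where
    ρ = coeff r (suc i)
    tails : ∀ j → coeff (tail t) j ≈ coeff (tail p) j + a * coeff (tail s) j
    tails j = begin
      coeff (tail t) j                       ≡⟨ coeff-tail t j ⟩
      coeff t (suc j)                        ≈⟨ e (suc j) ⟩
      coeff p (suc j) + a * coeff s (suc j)  ≡⟨ ≡.cong₂ (λ x y → x + a * y) (coeff-tail p j) (coeff-tail s j) ⟨
      coeff (tail p) j + a * coeff (tail s) j ∎

  coeff-∷-* : ∀ a p r i → coeff ((a ∷ p) *ₚ r) i ≈ coeff (0# ∷ p *ₚ r) i + a * coeff r i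
  coeff-∷-* a p r i = trans (coeff-+ (List.map (a *_) r) _ i) (trans (+-comm _ _) (+-congˡ (coeff-map a r i)))

  *ₚ-assoc : ∀ p r s → (p *ₚ r) *ₚ s ≋ p *ₚ (r *ₚ s)
  *ₚ-assoc p r s = pointwise (go p)
    where
    go : ∀ p → (p *ₚ r) *ₚ s ≈ₚ p *ₚ (r *ₚ s)
    go []      i = refl
    go (a ∷ p) i = begin
      coeff (((a ∷ p) *ₚ r) *ₚ s) i                          ≈⟨ *ₚ-linear a {(a ∷ p) *ₚ r} {0# ∷ p *ₚ r} {r} (coeff-∷-* a p r) s i ⟩
      coeff ((0# ∷ p *ₚ r) *ₚ s) i + a * coeff (r *ₚ s) i    ≈⟨ +-congʳ (trans (coeff-∷-* 0# (p *ₚ r) s i) (trans (+-congˡ (zeroˡ _)) (+-identityʳ _))) ⟩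
      coeff (0# ∷ (p *ₚ r) *ₚ s) i + a * coeff (r *ₚ s) i    ≈⟨ +-congʳ (shift i) ⟩
      coeff (0# ∷ p *ₚ (r *ₚ s)) i + a * coeff (r *ₚ s) i    ≈⟨ coeff-∷-* a p (r *ₚ s) i ⟨
      coeff ((a ∷ p) *ₚ (r *ₚ s)) i                          ∎
      where
      shift : 0# ∷ (p *ₚ r) *ₚ s ≈ₚ 0# ∷ p *ₚ (r *ₚ s)
      shift zero    = refl
      shift (suc i) = go p i

  coeff-const-* : ∀ a p i → coeff ((a ∷ []) *ₚ p) i ≈ a * coeff p i
  coeff-const-* a p i = trans (coeff-∷-* a [] p i) (trans (+-congʳ (zeros i)) (+-identityˡ _))
    where
    zeros : ∀ i → coeff (0# ∷ []) i ≈ 0#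
    zeros zero    = refl
    zeros (suc i) = refl

  *ₚ-identityˡ : ∀ p → 1ₚ *ₚ p ≋ p
  *ₚ-identityˡ p = pointwise λ i → trans (coeff-const-* 1# p i) (*-identityˡ _)

  infix 4 _∣ₚ_
  _∣ₚ_ : Poly → Poly → Set (c ⊔ ℓ)
  g ∣ₚ f = ∃ λ z → f ≋ z *ₚ g

  ∣ₚ-*ˡ : ∀ {g f} h → g ∣ₚ f → g ∣ₚ h *ₚ f
  ∣ₚ-*ˡ {g} h (z , e) = h *ₚ z , ≋.trans (*ₚ-congˡ h e) (≋.sym (*ₚ-assoc h z g))

  ∣ₚ-respʳ : ∀ {g f f′} → f ≋ f′ → g ∣ₚ f → g ∣ₚ f′
  ∣ₚ-respʳ e (z , e′) = z , ≋.trans (≋.sym e) e′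

  ∣ₚ-refl : ∀ {g} → g ∣ₚ g
  ∣ₚ-refl {g} = 1ₚ , ≋.sym (*ₚ-identityˡ g)

  ∣ₚ-trans : ∀ {g f h} → g ∣ₚ f → f ∣ₚ h → g ∣ₚ h
  ∣ₚ-trans {g} {f} g∣f (z , e) = ∣ₚ-respʳ {g} (≋.sym e) (∣ₚ-*ˡ {g} {f} z g∣f)

  infixr 8 _^ₚ_
  _^ₚ_ : Poly → ℕ → Poly
  g ^ₚ zero  = 1ₚ
  g ^ₚ suc k = g *ₚ g ^ₚ k

  ^ₚ-∣ₚ : ∀ g {k e} → k ℕ.≤ e → g ^ₚ k ∣ₚ g ^ₚ e
  ^ₚ-∣ₚ g {e = zero}  z≤n = ∣ₚ-refl {1ₚ}
  ^ₚ-∣ₚ g {k} {suc e} k≤e with ℕ.m≤n⇒m<n∨m≡n k≤e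
  ... | inj₁ (s≤s k≤e′) = ∣ₚ-*ˡ {g ^ₚ k} {g ^ₚ e} g (^ₚ-∣ₚ g k≤e′)
  ... | inj₂ ≡.refl     = ∣ₚ-refl {g ^ₚ k}

-- Irreducible factors, and divisibility on average, over a finite field.

module Divisors {c ℓ₁ ℓ₂} {q : ℕ} (F : FiniteField c ℓ₁ ℓ₂ q) where
  open Rationals
  open RationalBounds
  open Averages
  open FiniteField F hiding (zero)
  open FiniteFieldPolynomials F
  open PolynomialProperties commutativeRing public
  open CommutativeRing commutativeRing using (ring; +-group)
  open import Algebra.Properties.Ring ring using (-1*x≈-x)
  open import Algebra.Properties.Group +-group using (x∙y⁻¹≈ε⇒x≈y)
  private module E = Inverse elements

  -- As f is nonzero of degree m, a quotient has degree at most m, and its coefficients can be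
  -- searched for among finitely many vectors.
  divides? : ∀ g f {m} → HasDegree f m → Dec (g ∣ₚ f)
  divides? g f {m} df with anyCodes? (suc m) (λ v → f ≈ₚ? fromCodes v *ₚ g)
  ... | yes (v , e) = yes (fromCodes v , pointwise e)
  ... | no none = no λ (z , e) → let k , l , dz , _ , k+l≡m = factor-degrees {f} {z} {g} df (at e) in
    none (toCodes (suc m) z , at (≋.trans {f} {z *ₚ g} e (*ₚ-congʳ g {z} (≋.sym {fromCodes (toCodes (suc m) z)} (pointwise
      (fromCodes-toCodes (suc m) z λ i m<i →
        proj₂ dz i (ℕ.≤-trans (s≤s (ℕ.m+n≤o⇒m≤o k (ℕ.≤-reflexive k+l≡m))) m<i)))))))

  ∣ₚ⇒degree-≤ : ∀ {g f d m} → HasDegree g d → HasDegree f m → g ∣ₚ f → d ℕ.≤ m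
  ∣ₚ⇒degree-≤ {g} {f} dg df (z , e) with factor-degrees {f} {z} {g} df (at e)
  ... | k , l , _ , dg′ , k+l≡m = ℕ.≤-trans (ℕ.≤-reflexive (degree-unique {g} {g} (λ i → refl) dg dg′))
    (ℕ.m+n≤o⇒n≤o k (ℕ.≤-reflexive k+l≡m))

  ^ₚ-degree : ∀ {g d} → HasDegree g d → ∀ k → HasDegree (g ^ₚ k) (k ℕ.* d)
  ^ₚ-degree dg zero    = 1ₚ-degree
  ^ₚ-degree {g} dg (suc k) = *ₚ-degree {g} {g ^ₚ k} dg (^ₚ-degree {g} dg k)

  degree-< : ∀ {g d m} → HasDegree g d → Below g m → d ℕ.< m
  degree-< {d = d} {m} (l≉0 , _) below with d ℕ.<? m
  ... | yes d<m = d<m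
  ... | no d≮m  = ⊥-elim (l≉0 (below d (ℕ.≮⇒≥ d≮m)))

  ofCodes : ∀ {d} → Vec (Fin q) d → Monic
  ofCodes v = monic _ (Vec.map E.to v)

  ofCodes∈monics : ∀ {d} (v : Vec (Fin q) d) → ofCodes v ∈ monics d
  ofCodes∈monics v = ∈.∈-map⁺ (monic _) (∈vectors v)
    where
    ∈vectors : ∀ {d} (v : Vec (Fin q) d) → Vec.map E.to v ∈ vectors d
    ∈vectors []      = here ≡.refl
    ∈vectors (a ∷ v) = ∈.∈-cartesianProductWith⁺ _∷_ (∈.∈-tabulate⁺ a) (∈vectors v)

  ofCodes-toCodes : ∀ d p → coeff p d ≈ 1# → Below p (suc d) → poly (ofCodes (toCodes d p)) ≈ₚ p
  ofCodes-toCodes zero    p lead below zero    = sym lead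
  ofCodes-toCodes zero    p lead below (suc i) = sym (below (suc i) (s≤s z≤n))
  ofCodes-toCodes (suc d) p lead below zero    = E.strictlyInverseˡ _
  ofCodes-toCodes (suc d) p lead below (suc i) =
    trans (ofCodes-toCodes d (tail p) (trans (reflexive (coeff-tail p d)) lead) (tail-below p below) i)
      (reflexive (coeff-tail p i))

  ofCodes-injective : ∀ {d} (v w : Vec (Fin q) d) → poly (ofCodes v) ≈ₚ poly (ofCodes w) → v ≡ w
  ofCodes-injective []      []      e = ≡.refl
  ofCodes-injective (a ∷ v) (b ∷ w) e = ≡.cong₂ _∷_
    (≡.trans (≡.sym (E.strictlyInverseʳ a)) (≡.trans (E.from-cong (e 0)) (E.strictlyInverseʳ b)))
    (ofCodes-injective v w (λ i → e (suc i)))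

  -- Division by the leading coefficient, followed by passage to the chosen representatives of the
  -- coefficients; only polynomials of the form `ofCodes v` are known to be listed in `monics`.
  monic-associate : ∀ d f → HasDegree f d → ∃ λ (v : Vec (Fin q) d) → poly (ofCodes v) ∣ₚ f
  monic-associate d f (l≉0 , below) = toCodes d cf , lead ∷ [] , pointwise λ i → begin
    coeff f i                                            ≈⟨ *-identityˡ _ ⟨
    1# * coeff f i                                       ≈⟨ *-congʳ (trans (*-comm lead c⁻¹) c⁻¹*lead≈1) ⟨
    lead * c⁻¹ * coeff f i                               ≈⟨ *-assoc lead c⁻¹ _ ⟩
    lead * (c⁻¹ * coeff f i)                             ≈⟨ *-congˡ (coeff-map c⁻¹ f i) ⟨
    lead * coeff cf i                                    ≈⟨ *-congˡ (ofCodes-toCodes d cf (trans (coeff-map c⁻¹ f d) c⁻¹*lead≈1)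
                                                              (λ j d<j → trans (coeff-map c⁻¹ f j) (trans (*-congˡ (below j d<j)) (zeroʳ _))) i) ⟨
    lead * coeff (poly (ofCodes (toCodes d cf))) i       ≈⟨ coeff-const-* lead (poly (ofCodes (toCodes d cf))) i ⟨
    coeff ((lead ∷ []) *ₚ poly (ofCodes (toCodes d cf))) i ∎
    where
    open SetoidReasoning setoid
    lead = coeff f d
    c⁻¹ = proj₁ (invertible lead l≉0)
    c⁻¹*lead≈1 = proj₂ (invertible lead l≉0)
    cf = List.map (c⁻¹ *_) f

  -- Descent on the degree: either no two polynomials of degree at most d multiply to the monic
  -- associate, which is then irreducible, or the first of two such factors has degree between 1 and
  -- d and takes the place of f. `fuel` makes the recursion structural.
  irreducible-divisor : ∀ n f {d} → HasDegree f (suc d) → suc d ℕ.≤ n → ∃ λ p → p ∈ irreducibles≤ n × poly p ∣ₚ f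
  irreducible-divisor n f {d} df d<n = go d f ℕ.≤-refl df d<n
    where
    go : ∀ fuel {d} f → d ℕ.≤ fuel → HasDegree f (suc d) → suc d ℕ.≤ n → ∃ λ p → p ∈ irreducibles≤ n × poly p ∣ₚ f
    go fuel {d} f d≤fuel df d<n with monic-associate (suc d) f df
    ... | v , p∣f with anyCodes? (suc d) (λ u → anyCodes? (suc d) λ w → poly (ofCodes v) ≈ₚ? fromCodes u *ₚ fromCodes w)
    ...   | no none = ofCodes v , ∈.∈-filter⁺ irreducible?
        (∈.∈-concatMap⁺ monics (lose (∈.∈-upTo⁺ (s≤s d<n)) (ofCodes∈monics v))) irreducible , p∣f
      where
      p = poly (ofCodes v)
      dp = poly-degree (ofCodes v)
      codes : ∀ x {m} → HasDegree x m → m ℕ.< suc d → fromCodes (toCodes (suc d) x) ≋ x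
      codes x dx m<d = pointwise (fromCodes-toCodes (suc d) x λ i d≤i → proj₂ dx i (ℕ.≤-trans m<d d≤i))
      split : ∀ x y → p ≈ₚ x *ₚ y → x ∣ 1ₚ ⊎ y ∣ 1ₚ
      split x y e with factor-degrees {p} {x} {y} dp e
      ... | zero  , _     , dx , _  , _ = inj₁ (degree-zero⇒unit dx)
      ... | suc _ , zero  , _  , dy , _ = inj₂ (degree-zero⇒unit dy)
      ... | suc k , suc l , dx , dy , k+l≡d = ⊥-elim (none (toCodes (suc d) x , toCodes (suc d) y ,
        at (≋.trans {p} {x *ₚ y} (pointwise e) (≋.sym (≋.trans
          (*ₚ-congʳ (fromCodes (toCodes (suc d) y)) (codes x dx (≡.subst (suc k ℕ.<_) k+l≡d (ℕ.m<m+n (suc k) ℕ.z<s))))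
          (*ₚ-congˡ x (codes y dy (≡.subst (suc l ℕ.<_) k+l≡d (ℕ.m<n+m (suc l) ℕ.z<s)))))))))
      irreducible : IrreducibleMonic (ofCodes v)
      irreducible = record
        { p∤1 = λ p∣1 → ℕ.1+n≢0 (unit⇒degree-zero {p} dp p∣1)
        ; split-∣1 = λ {x} {y} e → split x y e
        }
    ...   | yes (u , w , e) with factor-degrees {poly (ofCodes v)} {fromCodes u} {fromCodes w} (poly-degree (ofCodes v)) e
    ...     | k , l , du , dw , k+l≡d with degree-< {fromCodes u} du (fromCodes-below u) | degree-< {fromCodes w} dw (fromCodes-below w)
    ...       | k<d | l<d = descend k fuel du k+l≡d k<d d≤fuel
      where
      u∣f : fromCodes u ∣ₚ f
      u∣f = ∣ₚ-trans {fromCodes u} {poly (ofCodes v)} {f}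
        (fromCodes w , ≋.trans (pointwise e) (*ₚ-comm (fromCodes u) (fromCodes w))) p∣f
      descend : ∀ k fuel → HasDegree (fromCodes u) k → k ℕ.+ l ≡ suc d → k ℕ.< suc d → d ℕ.≤ fuel →
        ∃ λ p → p ∈ irreducibles≤ n × poly p ∣ₚ f
      -- A constant first factor would force the second to have degree d + 1, beyond the searched
      -- range.
      descend zero    fuel du l≡d _ _ = ⊥-elim (ℕ.<-irrefl l≡d l<d)
      descend (suc k) zero du _ (s≤s k<d) d≤0 = ⊥-elim (ℕ.n≮0 (ℕ.≤-trans k<d d≤0))
      descend (suc k) (suc fuel) du _ (s≤s k<d) d≤fuel with
        go fuel (fromCodes u) (ℕ.≤-pred (ℕ.≤-trans k<d d≤fuel)) du (ℕ.≤-trans (ℕ.m≤n⇒m≤1+n k<d) d<n)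
      ... | p , p∈ , p∣u = p , p∈ , ∣ₚ-trans {poly p} {fromCodes u} {f} p∣u u∣f

  remove-factor : ∀ p f {d m} → HasDegree p (suc d) → HasDegree f m → ∃₂ λ e f′ → ∃ λ m′ →
    HasDegree f′ m′ × f ≋ f′ *ₚ p ^ₚ e × ¬ p ∣ₚ f′ × m′ ℕ.+ e ℕ.* suc d ≡ m
  remove-factor p f {d} {m} dp df = go m f ℕ.≤-refl df
    where
    go : ∀ fuel f {m} → m ℕ.≤ fuel → HasDegree f m → ∃₂ λ e f′ → ∃ λ m′ →
      HasDegree f′ m′ × f ≋ f′ *ₚ p ^ₚ e × ¬ p ∣ₚ f′ × m′ ℕ.+ e ℕ.* suc d ≡ m
    go fuel f {m} m≤fuel df with divides? p f df
    ... | no p∤f = 0 , f , m , df , ≋.trans (≋.sym (*ₚ-identityˡ f)) (*ₚ-comm 1ₚ f) , p∤f , ℕ.+-identityʳ m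
    ... | yes (z , e) with factor-degrees {f} {z} {p} df (at e)
    ...   | k , l , dz , dp′ , k+l≡m with degree-unique {p} {p} (λ i → refl) dp′ dp
    ...     | ≡.refl = descend fuel m≤fuel
      where
      descend : ∀ fuel → m ℕ.≤ fuel → ∃₂ λ e f′ → ∃ λ m′ →
        HasDegree f′ m′ × f ≋ f′ *ₚ p ^ₚ e × ¬ p ∣ₚ f′ × m′ ℕ.+ e ℕ.* suc d ≡ m
      descend zero       m≤0 = ⊥-elim (ℕ.1+n≰n (ℕ.≤-trans (ℕ.≤-trans (s≤s z≤n) (ℕ.≤-reflexive (≡.sym (ℕ.+-suc k d)))) (ℕ.≤-trans (ℕ.≤-reflexive k+l≡m) m≤0)))
      descend (suc fuel) m≤fuel with go fuel z (ℕ.≤-pred (ℕ.≤-trans (ℕ.m<m+n k ℕ.z<s) (ℕ.≤-trans (ℕ.≤-reflexive k+l≡m) m≤fuel))) dz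
      ... | j , f′ , m′ , df′ , z≋ , p∤f′ , m′+≡k = suc j , f′ , m′ , df′ , f≋ , p∤f′ , (begin
          m′ ℕ.+ (suc d ℕ.+ j ℕ.* suc d)  ≡⟨ ≡.cong (m′ ℕ.+_) (ℕ.+-comm (suc d) (j ℕ.* suc d)) ⟩
          m′ ℕ.+ (j ℕ.* suc d ℕ.+ suc d)  ≡⟨ ℕ.+-assoc m′ _ _ ⟨
          m′ ℕ.+ j ℕ.* suc d ℕ.+ suc d    ≡⟨ ≡.cong (ℕ._+ suc d) m′+≡k ⟩
          k ℕ.+ suc d                     ≡⟨ k+l≡m ⟩
          m                               ∎)
        where
        open ≡.≡-Reasoning
        f≋ : f ≋ f′ *ₚ (p *ₚ p ^ₚ j)
        f≋ = ≋.trans e (≋.trans (*ₚ-congʳ p z≋) (≋.trans (*ₚ-assoc f′ (p ^ₚ j) p) (*ₚ-congˡ f′ (*ₚ-comm (p ^ₚ j) p))))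

  -- The exponent is written as a sum of indicators because each indicator has a computable bound
  -- when averaged over f.
  multiplicity : ℕ → Monic → ∀ f {m} → HasDegree f m → ℚ
  multiplicity n p f df = Σ[ n ] λ k → 𝟙 (divides? (poly p ^ₚ suc k) f df) ℚ.* ι (deg p)

  -- If p^e is split off from f, then p, ..., p^e all divide f, and e ≤ m ≤ n, so e deg p is at most
  -- the multiplicity of p. The other multiplicities refer to the cofactor f₁ and only grow on
  -- passing to f, as f₁ ∣ f. Later divisions cannot make p a divisor again.
  remove-factors : ∀ n ps → All (λ p → 1 ℕ.≤ deg p) ps → ∀ f {m} (df : HasDegree f m) → m ℕ.≤ n →
    ∃₂ λ f′ m′ → HasDegree f′ m′ × f′ ∣ₚ f × All (λ p → ¬ poly p ∣ₚ f′) ps ×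
      ι m ℚ.≤ ι m′ ℚ.+ ∑ ps (λ p → multiplicity n p f df)
  remove-factors n []       []         f {m} df m≤n = f , m , df , ∣ₚ-refl {f} , [] , ℚ.≤-reflexive (≡.sym (ℚ.+-identityʳ (ι m)))
  remove-factors n (p@(monic (suc d) _) ∷ ps) (s≤s z≤n ∷ 1≤ps) f {m} df m≤n with remove-factor (poly p) f (poly-degree p) df
  ... | e , f₁ , m₁ , df₁ , f≋ , p∤f₁ , m₁+≡m with remove-factors n ps 1≤ps f₁ df₁ (ℕ.≤-trans (ℕ.m+n≤o⇒m≤o m₁ (ℕ.≤-reflexive m₁+≡m)) m≤n)
  ...   | f′ , m′ , df′ , f′∣f₁ , none , m₁≤ = f′ , m′ , df′ , ∣ₚ-trans {f′} {f₁} {f} f′∣f₁ f₁∣f ,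
    (λ p∣f′ → p∤f₁ (∣ₚ-trans {poly p} {f′} {f₁} p∣f′ f′∣f₁)) ∷ none , (begin
      ι m                                              ≡⟨ ≡.cong ι m₁+≡m ⟨
      ι (m₁ ℕ.+ e ℕ.* suc d)                           ≡⟨ ι-+ m₁ (e ℕ.* suc d) ⟩
      ι m₁ ℚ.+ ι (e ℕ.* suc d)                         ≡⟨ ≡.cong (ι m₁ ℚ.+_) (ι-* e (suc d)) ⟩
      ι m₁ ℚ.+ ι e ℚ.* ι (suc d)                       ≤⟨ ℚ.+-mono-≤ (ℚ.≤-trans m₁≤ (ℚ.+-monoʳ-≤ (ι m′) (∑-mono ps λ r → Σ-≤ n λ k _ → *-monoʳ (0≤ι (deg r))
                                                            (𝟙-mono (λ h → ∣ₚ-trans {poly r ^ₚ suc k} {f₁} {f} h f₁∣f) (divides? (poly r ^ₚ suc k) f₁ df₁) (divides? (poly r ^ₚ suc k) f df)))))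
                                                          powers ⟩
      (ι m′ ℚ.+ ∑ ps (λ p → multiplicity n p f df)) ℚ.+ multiplicity n p f df  ≡⟨ ℚ.+-assoc (ι m′) _ _ ⟩
      ι m′ ℚ.+ (∑ ps (λ p → multiplicity n p f df) ℚ.+ multiplicity n p f df)  ≡⟨ ≡.cong (ι m′ ℚ.+_) (ℚ.+-comm (∑ ps (λ p → multiplicity n p f df)) (multiplicity n p f df)) ⟩
      ι m′ ℚ.+ (multiplicity n p f df ℚ.+ ∑ ps (λ p → multiplicity n p f df))  ∎)
    where
    open ℚ.≤-Reasoning
    f₁∣f : f₁ ∣ₚ f
    f₁∣f = poly p ^ₚ e , ≋.trans f≋ (*ₚ-comm f₁ (poly p ^ₚ e))
    e≤m : e ℕ.≤ m
    e≤m = ℕ.≤-trans (ℕ.m≤m*n e (suc d)) (ℕ.m+n≤o⇒n≤o m₁ (ℕ.≤-reflexive m₁+≡m))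
    powers : ι e ℚ.* ι (suc d) ℚ.≤ multiplicity n p f df
    powers = ℚ.≤-trans (*-monoʳ (0≤ι (suc d)) (𝟙-count (λ k → divides? (poly p ^ₚ suc k) f df) e n (ℕ.≤-trans e≤m m≤n)
        λ k k<e → ∣ₚ-respʳ {poly p ^ₚ suc k} (≋.sym {f} f≋) (∣ₚ-*ˡ {poly p ^ₚ suc k} {poly p ^ₚ e} f₁ (^ₚ-∣ₚ (poly p) k<e))))
      (ℚ.≤-reflexive (≡.sym (Σ-scale n (λ k → 𝟙 (divides? (poly p ^ₚ suc k) f df)) (ι (suc d)))))

  1≤irreducibles : ∀ n → All (λ p → 1 ℕ.≤ deg p) (irreducibles≤ n)
  1≤irreducibles n = All.map positive (All.all-filter irreducible? (List.concatMap monics (List.upTo (suc n))))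
    where
    positive : ∀ {p} → IrreducibleMonic p → 1 ℕ.≤ deg p
    positive {monic zero [] }   irr = ⊥-elim (Irreducible.p∤1 irr (degree-zero⇒unit (poly-degree (monic zero []))))
    positive {monic (suc d) _} irr = s≤s z≤n

  -- What is left after removing all listed irreducibles is constant, since otherwise
  -- `irreducible-divisor` would find a listed divisor of it.
  degree≤∑multiplicity : ∀ n f {m} (df : HasDegree f m) → m ℕ.≤ n →
    ι m ℚ.≤ ∑ (irreducibles≤ n) (λ p → multiplicity n p f df)
  degree≤∑multiplicity n f df m≤n with remove-factors n (irreducibles≤ n) (1≤irreducibles n) f df m≤n
  ... | f′ , zero , df′ , f′∣f , none , m≤ = ℚ.≤-trans m≤ (ℚ.≤-reflexive (ℚ.+-identityˡ (∑ (irreducibles≤ n) (λ p → multiplicity n p f df))))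
  ... | f′ , suc d , df′ , f′∣f , none , m≤ with irreducible-divisor n f′ df′ (ℕ.≤-trans (∣ₚ⇒degree-≤ {f′} {f} df′ df f′∣f) m≤n)
  ...   | p , p∈ , p∣f′ = ⊥-elim (All.lookup none p∈ p∣f′)

  -- The difference of the two multiples of g has degree below e = deg g, hence vanishes.
  divisible-determined : ∀ {g e m} → HasDegree g e → ∀ (v w : Vec (Fin q) (e ℕ.+ m)) → Agree e v w →
    g ∣ₚ poly (ofCodes v) → g ∣ₚ poly (ofCodes w) → v ≡ w
  divisible-determined {g} {e} dg v w agree (x , v≋) (y , w≋) = ofCodes-injective v w λ i →
    x∙y⁻¹≈ε⇒x≈y _ _ (trans (sym (difference i)) (vanishes i))
    where
    z = x +ₚ List.map (- 1# *_) y
    D = z *ₚ g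
    difference : ∀ i → coeff D i ≈ coeff (poly (ofCodes v)) i + - coeff (poly (ofCodes w)) i
    difference i = trans (*ₚ-linear (- 1#) {z} {x} {y} (λ j → trans (coeff-+ x _ j) (+-congˡ (coeff-map (- 1#) y j))) g i)
      (+-cong (sym (at v≋ i)) (trans (*-congˡ (sym (at w≋ i))) (-1*x≈-x _)))
    agree-coeff : ∀ e {m} (v w : Vec (Fin q) (e ℕ.+ m)) → Agree e v w → ∀ i → e ℕ.≤ i →
      coeff (poly (ofCodes v)) i ≡ coeff (poly (ofCodes w)) i
    agree-coeff zero    v       .v      ≡.refl i       _         = ≡.refl
    agree-coeff (suc e) (_ ∷ v) (_ ∷ w) agree  (suc i) (s≤s e≤i) = agree-coeff e v w agree i e≤i
    below : Below D e
    below i e≤i = trans (difference i) (trans (+-congʳ (reflexive (agree-coeff e v w agree i e≤i))) (-‿inverseʳ _))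
    vanishes : ∀ i → coeff D i ≈ 0#
    vanishes i with degree D
    ... | inj₁ D≈0      = D≈0 i z≤n
    ... | inj₂ (d , dD) = ⊥-elim (ℕ.<⇒≱ (degree-< {D} dD below) (∣ₚ⇒degree-≤ {g} {D} dg dD (z , ≋.refl)))

  module _ (r : ℚ) (0≤r : 0ℚ ℚ.≤ r) (q*r≡1 : ι q ℚ.* r ≡ 1ℚ) where
    open Average q r 0≤r q*r≡1

    average-divisible : ∀ {g e} → HasDegree g e → ∀ m →
      average m (λ v → 𝟙 (divides? g (poly (ofCodes v)) (poly-degree (ofCodes v)))) ℚ.≤ 𝟙 (e ℕ.≤? m) ℚ.* r ^ e
    average-divisible {g} {e} dg m with e ℕ.≤? m
    ... | no e≰m  = ℚ.≤-trans (PositiveLinear.mono (average-linear m) λ v → 𝟙≤0 v (divides? g (poly (ofCodes v)) (poly-degree (ofCodes v))))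
      (ℚ.≤-reflexive (≡.trans (average-const m 0ℚ) (≡.sym (ℚ.*-zeroˡ (r ^ e)))))
      where
      𝟙≤0 : ∀ (v : Vec (Fin q) m) (g∣v? : Dec (g ∣ₚ poly (ofCodes v))) → 𝟙 g∣v? ℚ.≤ 0ℚ
      𝟙≤0 v (yes g∣v) = ⊥-elim (e≰m (∣ₚ⇒degree-≤ {g} {poly (ofCodes v)} dg (poly-degree (ofCodes v)) g∣v))
      𝟙≤0 v (no _)    = ℚ.≤-refl
    ... | yes e≤m with ℕ.m≤n⇒∃[o]m+o≡n e≤m
    ...   | m′ , ≡.refl = ℚ.≤-trans
      (average-determined e m′ (λ v → divides? g (poly (ofCodes v)) (poly-degree (ofCodes v))) (divisible-determined {g} dg))
      (ℚ.≤-reflexive (≡.sym (ℚ.*-identityˡ (r ^ e))))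

    degree-bound : ∀ n m → m ℕ.≤ n → ι m ℚ.≤
      ∑ (irreducibles≤ n) λ p → Σ[ n ] λ k → 𝟙 (suc k ℕ.* deg p ℕ.≤? m) ℚ.* (ι (deg p) ℚ.* (r ^ deg p) ^ suc k)
    degree-bound n m m≤n = begin
      ι m                         ≡⟨ average-const m (ι m) ⟨
      average m (λ _ → ι m)       ≤⟨ mono (λ v → degree≤∑multiplicity n (poly (ofCodes v)) (poly-degree (ofCodes v)) m≤n) ⟩
      average m (λ v → ∑ (irreducibles≤ n) λ p → multiplicity n p (poly (ofCodes v)) (poly-degree (ofCodes v)))
        ≤⟨ ∑Σ-bound (irreducibles≤ n) n (λ p k v → 𝟙 (divides? (poly p ^ₚ suc k) (poly (ofCodes v)) (poly-degree (ofCodes v))) ℚ.* ι (deg p)) term ⟩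
      (∑ (irreducibles≤ n) λ p → Σ[ n ] λ k → 𝟙 (suc k ℕ.* deg p ℕ.≤? m) ℚ.* (ι (deg p) ℚ.* (r ^ deg p) ^ suc k)) ∎
      where
      open ℚ.≤-Reasoning
      open PositiveLinear (average-linear m)
      term : ∀ p k → average m (λ v → 𝟙 (divides? (poly p ^ₚ suc k) (poly (ofCodes v)) (poly-degree (ofCodes v))) ℚ.* ι (deg p)) ℚ.≤
        𝟙 (suc k ℕ.* deg p ℕ.≤? m) ℚ.* (ι (deg p) ℚ.* (r ^ deg p) ^ suc k)
      term p k = begin
        average m (λ v → 𝟙 (divides? g (poly (ofCodes v)) (poly-degree (ofCodes v))) ℚ.* ι (deg p))  ≡⟨ scale (λ v → 𝟙 (divides? g (poly (ofCodes v)) (poly-degree (ofCodes v)))) (ι (deg p)) ⟩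
        average m (λ v → 𝟙 (divides? g (poly (ofCodes v)) (poly-degree (ofCodes v)))) ℚ.* ι (deg p)  ≤⟨ *-monoʳ (0≤ι (deg p)) (average-divisible {g} (^ₚ-degree {poly p} (poly-degree p) (suc k)) m) ⟩
        χ ℚ.* r ^ (suc k ℕ.* deg p) ℚ.* ι (deg p)         ≡⟨ ℚ.*-assoc χ (r ^ (suc k ℕ.* deg p)) (ι (deg p)) ⟩
        χ ℚ.* (r ^ (suc k ℕ.* deg p) ℚ.* ι (deg p))       ≡⟨ ≡.cong (χ ℚ.*_) (ℚ.*-comm (r ^ (suc k ℕ.* deg p)) (ι (deg p))) ⟩
        χ ℚ.* (ι (deg p) ℚ.* r ^ (suc k ℕ.* deg p))       ≡⟨ ≡.cong (λ w → χ ℚ.* (ι (deg p) ℚ.* w)) (^-* r (deg p) (suc k)) ⟩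
        χ ℚ.* (ι (deg p) ℚ.* (r ^ deg p) ^ suc k)         ∎
        where
        g = poly p ^ₚ suc k
        χ = 𝟙 (suc k ℕ.* deg p ℕ.≤? m)

-- The product over irreducibles, with 1/‖p‖ as a power of 1/q.

module FieldProducts {c ℓ₁ ℓ₂} {q : ℕ} (F : FiniteField c ℓ₁ ℓ₂ q) where
  open Rationals
  open RationalBounds
  open Averages
  open FiniteFieldPolynomials F

  r : ℚ
  r = 1ℤ ℚ./ q

  0≤r : 0ℚ ℚ.≤ r
  0≤r = ℚ.nonNegative⁻¹ r {{ℚ.normalize-nonNeg 1 q}}

  1/‖p‖≡ : ∀ p → 1/‖ p ‖ ≡ r ^ deg p
  1/‖p‖≡ p = go (deg p)
    where
    1/-* : ∀ m n .{{_ : ℕ.NonZero m}} .{{_ : ℕ.NonZero n}} .{{_ : ℕ.NonZero (m ℕ.* n)}} → 1ℤ ℚ./ (m ℕ.* n) ≡ (1ℤ ℚ./ m) ℚ.* (1ℤ ℚ./ n)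
    1/-* (suc m) (suc n) = ≡.sym (frac-* 1 m 1 n)
    go : ∀ d → (1ℤ ℚ./ (q ℕ.^ d)) {{ℕ.m^n≢0 q d}} ≡ r ^ d
    go zero    = ≡.refl
    go (suc d) = ≡.trans (1/-* q (q ℕ.^ d) {{q≢0}} {{ℕ.m^n≢0 q d}} {{ℕ.m^n≢0 q (suc d)}}) (≡.cong (r ℚ.*_) (go d))

  q*r≡1 : ι q ℚ.* r ≡ 1ℚ
  q*r≡1 = go q
    where
    go : ∀ q .{{_ : ℕ.NonZero q}} → ι q ℚ.* (1ℤ ℚ./ q) ≡ 1ℚ
    go (suc q) = ι-unit q

  r≤1 : r ℚ.≤ 1ℚ
  r≤1 = go q
    where
    go : ∀ q .{{_ : ℕ.NonZero q}} → 1ℤ ℚ./ q ℚ.≤ 1ℚ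
    go (suc q) = unit-antitone {0} {q} z≤n

  0≤1/‖p‖ : ∀ p → 0ℚ ℚ.≤ 1/‖ p ‖
  0≤1/‖p‖ p = ≡.subst (0ℚ ℚ.≤_) (≡.sym (1/‖p‖≡ p)) (0≤^ 0≤r (deg p))

  1/‖p‖≤1 : ∀ p → 1/‖ p ‖ ℚ.≤ 1ℚ
  1/‖p‖≤1 p = ≡.subst (ℚ._≤ 1ℚ) (≡.sym (1/‖p‖≡ p)) (go (deg p))
    where
    go : ∀ d → r ^ d ℚ.≤ 1ℚ
    go zero    = ℚ.≤-refl
    go (suc d) = *-mono 0≤r 0≤1 r≤1 (go d)

  harmonic-bound : ∀ n → Reals.harmonic (suc n) ℚ.≤ ∑ (irreducibles≤ (suc n)) (λ p → logSeries (suc n) 1/‖ p ‖)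
  harmonic-bound n = harmonic≤∑-logSeries n ps deg 1/‖_‖ 0≤1/‖p‖ λ m m≤n → ℚ.≤-trans
    (Divisors.degree-bound F r 0≤r q*r≡1 (suc n) (suc m) (s≤s m≤n))
    (∑-mono ps λ p → Σ-≤ (suc n) λ k _ → ℚ.≤-reflexive
      (≡.cong (λ y → 𝟙 (suc k ℕ.* deg p ℕ.≤? suc m) ℚ.* (ι (deg p) ℚ.* y ^ suc k)) (≡.sym (1/‖p‖≡ p))))
    where ps = irreducibles≤ (suc n)

  product-bound : ∀ n → let P = ∏ (List.map (λ p → 1ℚ ℚ.- 1/‖ p ‖) (irreducibles≤ (suc n))) in
    Reals.fromℚ P Reals.≤ ((Reals.exp Reals.γ Reals.* Reals.fromℕ (suc n)) Reals.⁻¹) {{Reals.e^γn-positive (suc n)}}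
  product-bound n = ≤1/e^γn n (proj₁ bounds) (proj₂ bounds) λ k → ℚ.≤-trans
    (*-monoʳ (proj₁ bounds) (exp-mono (0≤Σ (suc n) 0≤unit) (harmonic-bound n) k))
    (exp-∑-logSeries 1/‖_‖ 0≤1/‖p‖ 1/‖p‖≤1 k (suc n) (irreducibles≤ (suc n)))
    where
    bounds = ∏-bounds {z = λ p → 1ℚ ℚ.- 1/‖ p ‖} (λ p → 0≤∸ (1/‖p‖≤1 p)) (λ p → p-r≤p 1ℚ (0≤1/‖p‖ p)) (irreducibles≤ (suc n))

open import Defs
open import Data.Nat.Base using (NonZero)
open import Data.List.Base using (map)
open import Data.Rational.Base using () renaming (_-_ to _-ℚ_)

proposition3p3 : ∀ {c ℓ₁ ℓ₂} (q : ℕ) → IsPrimePower q → (F : FiniteField c ℓ₁ ℓ₂ q) →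
    let open FiniteFieldPolynomials F in
    (n : ℕ) → .{{_ : NonZero n}} →
    fromℚ (∏ (map (λ p → 1ℚ -ℚ 1/‖ p ‖) (irreducibles≤ n))) ≤ ((exp γ * fromℕ n) ⁻¹) {{e^γn-positive n}}
proposition3p3 q _ F zero    = ⊥-elim (ℕ.≢-nonZero⁻¹ 0 ≡.refl)
proposition3p3 q _ F (suc n) = FieldProducts.product-bound F n
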